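{- Fix $k\ge1$ and a $k$-tuple of skew shapes $\boldsymbol\mu$ of total size $n$, and let $\mathrm{Des}(\mathbf{T})=\{j:\sigma(\mathbf{T})_j=-1\}$ for $\mathbf{T}\in\mathrm{SYT}(\boldsymbol\mu)$. Then the involutions $\{D_i\}_{1<i<n}$ form a weak dual equivalence for $(\mathrm{SYT}(\boldsymbol\mu),\mathrm{Des})$, and when $k\le2$ they form a dual equivalence for $(\mathrm{SYT}(\boldsymbol\mu),\mathrm{Des})$.
   Context: Diagrams use French convention: a cell $(a,b)$ ($a$ column, $b$ row), content $c(a,b)=a-b$; skew shapes $\lambda/\mu$ are set differences of partition diagrams, not identified up to translation. $\boldsymbol\mu=(\mu^{(0)},\dots,\mu^{(k-1)})$; $\mathrm{SYT}(\boldsymbol\mu)$ is the set of bijections from the (disjoint union of) cells to $[n]$ increasing along rows and up columns in each component. Shifted content of a cell $x$ of $\mu^{(i)}$: $\tilde c(x)=k\,c(x)+i$. Content reading word $w(\mathbf{T})$: entries in increasing shifted content, equal shifted content read southwest to northeast. $\sigma(\mathbf{T})\in\{\pm1\}^{n-1}$: $\sigma_j=+1$ iff $j$ is left of $j+1$ in $w(\mathbf{T})$. $\mathrm{dist}(a,b)$ = absolute difference of the shifted contents of the cells of entries $a,b$; $\mathrm{dist}(i-1,i,i+1)$ = maximum pairwise distance. $d_i(w)$: identity if $i$ lies positionally between $i-1,i+1$; else swap $i$ with the farther of $i\pm1$. $\tilde d_i(w)$: identity if $i$ lies between; else, writing $abc$ for the subword of $i-1,i,i+1$ in positional order, replace it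 in the same positions by $bca$ if $a=i$, by $cab$ if $c=i$. $D_i(\mathbf{T})$ is the filling of the same cells with reading word $d_i(w(\mathbf{T}))$ if $\mathrm{dist}(i-1,i,i+1)>k$, and $\tilde d_i(w(\mathbf{T}))$ otherwise. For $D\subseteq[m-1]$, $Q_D(X)=\sum x_{i_1}\cdots x_{i_m}$ over $i_1\le\dots\le i_m$ with $i_j<i_{j+1}$ for $j\in D$. Given a finite set $\mathcal{A}$, $\mathrm{Des}(T)\subseteq[n-1]$, involutions $\varphi_2,\dots,\varphi_{n-1}$, for $1<h\le i<n$ let $[T]_{h,i}$ be the class of $T$ under the relation generated by $\varphi_h,\dots,\varphi_i$ and $\mathrm{Des}_{h,i}(U)=\{d-(h-2):d\in\mathrm{Des}(U)\cap\{h-1,\dots,i\}\}\subseteq[i-h+2]$. The family is a weak dual equivalence if (i) for all $1<h\le i<n$ with $i-h\le3$ and all $T$, $\sum_{U\in[T]_{h,i}}Q_{\mathrm{Des}_{h,i}(U)}(X)$ (degree $i-h+3$) is a nonnegative integer combination of Schur functions, and is a single Schur function when $h=i$; (ii) $\varphi_i\varphi_j=\varphi_j\varphi_i$ for $|i-j|\ge3$. It is a dual equivalence if moreover in (i) the sum is a single Schur function $s_\lambda$ ($\lambda$ a partition of $i-h+3$) for all such $h\le i$. -}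

module Defs where

open import Level using (0ℓ)
open import Data.Bool.Base using (if_then_else_)
open import Data.Nat.Base as ℕ using (ℕ; zero; suc; _+_; _*_; _∸_; _⊔_; _≤_; _<_; _≥_; z≤n; s≤s)
import Data.Nat.Properties as ℕ
open import Data.Nat.ListAction using (sum)
open import Data.Integer.Base as ℤ using (ℤ; +_; ∣_∣)
import Data.Integer.Properties as ℤ
open import Data.Sign.Base using (Sign)
import Data.Sign.Properties as Sign
open import Data.Fin.Base as Fin using (Fin; toℕ; fromℕ<; inject₁)
import Data.Fin.Properties as Fin
open import Data.Fin.Subset using (Subset; _∈_)
open import Data.Fin.Subset.Properties using (_∈?_)
open import Data.Product.Base using (∃-syntax; Σ-syntax; _×_; _,_; proj₁; proj₂)
open import Data.Product.Relation.Binary.Lex.NonStrict using (×-decTotalOrder)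
open import Data.List.Base as List
  using (List; []; _∷_; length; map; filter; concatMap; allFin; upTo; cartesianProductWith)
open import Data.List.Relation.Unary.All using (All)
open import Data.List.Relation.Unary.Any as Any using ()
open import Data.List.Relation.Unary.Linked using (Linked)
import Data.List.Relation.Unary.Enumerates.Setoid as Enumerates
import Data.List.Relation.Unary.Unique.Setoid as Unique
import Data.List.Membership.Setoid as SetoidMembership
import Data.List.Membership.Propositional as List
open import Data.List.Membership.Propositional.Properties
  using (∈-concatMap⁺; ∈-map⁺; ∈-upTo⁺; ∈-allFin)
open import Data.List.Relation.Binary.Permutation.Propositional using (↭-sym)
open import Data.List.Relation.Binary.Permutation.Propositional.Properties using (∈-resp-↭)
import Data.List.Membership.DecPropositional as DecMembership
import Data.List.Sort as Sort
open import Data.Vec.Base as Vec using (Vec; []; _∷_; lookup; tabulate; toList; fromList)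
import Data.Vec.Properties as Vec
open import Function.Bundles using (_⇔_)
open import Function.Definitions using (Bijective)
open import Relation.Binary.Bundles using (Setoid; DecTotalOrder)
import Relation.Binary.Construct.On as On
open import Relation.Binary.Construct.Closure.Equivalence using (EqClosure)
open import Relation.Binary.PropositionalEquality
  using (_≡_; refl; trans; cong; subst; _→-setoid_)
open import Relation.Nullary.Decidable using (Dec; does; _×-dec_; _→-dec_)
open import Relation.Unary using (Pred; Decidable)

-- The number e ∈ [n] = {1,…,n} is the element of Fin n with toℕ equal to
-- e ∸ 1; likewise a subset of [m] is a Subset m.

-- The pair j, j+1 of elements of [n], for j ∈ [n-1].
lower upper : ∀ {n} → Fin (n ∸ 1) → Fin n
lower {suc n} j = inject₁ j
upper {suc n} j = Fin.suc j

-- The indices i with 1 < i < n.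
record Interior (n : ℕ) : Set where
  constructor interior
  field
    idx   : ℕ
    1<idx : 1 < idx
    idx<n : idx < n

open Interior public

pred# self# succ# : ∀ {n} → Interior n → Fin n
pred# (interior i _ i<n) = fromℕ< {i ∸ 2} (ℕ.≤-<-trans (ℕ.m∸n≤m i 2) i<n)
self# (interior i _ i<n) = fromℕ< {i ∸ 1} (ℕ.≤-<-trans (ℕ.m∸n≤m i 1) i<n)
succ# (interior i _ i<n) = fromℕ< {i} i<n

record Partition : Set where
  field
    parts      : List ℕ
    decreasing : Linked _≥_ parts
    positive   : All (0 <_) parts

open Partition public

nth : List ℕ → ℕ → ℕ
nth []       _       = 0
nth (p ∷ _)  zero    = p
nth (_ ∷ ps) (suc b) = nth ps b

-- The length of row b; rows and columns are numbered from 0, so (a , b)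
-- is a cell of the diagram of ν exactly when a < part ν b.
part : Partition → ℕ → ℕ
part ν = nth (parts ν)

∥_∥ : Partition → ℕ
∥ ν ∥ = sum (parts ν)

diagram : Partition → List (ℕ × ℕ)
diagram ν = concatMap (λ b → map (_, b) (upTo (part ν b))) (upTo (length (parts ν)))

record SkewShape : Set where
  field
    outer inner : Partition
    inner⊆outer : ∀ b → part inner b ≤ part outer b

open SkewShape public

record Cell {k : ℕ} (𝛍 : Fin k → SkewShape) : Set where
  constructor cell
  field
    comp    : Fin k
    col row : ℕ
    ∉inner  : part (inner (𝛍 comp)) row ≤ col
    ∈outer  : col < part (outer (𝛍 comp)) row

open Cell public

module _ {k : ℕ} (𝛍 : Fin k → SkewShape) where

  private
    width : Fin k → ℕ → ℕ
    width i b = part (outer (𝛍 i)) b ∸ part (inner (𝛍 i)) b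

    inside : ∀ m {o} (t : Fin (o ∸ m)) → m + toℕ t < o
    inside zero    t       = Fin.toℕ<n t
    inside (suc m) {suc o} t = s≤s (inside m t)

    cellAt : ∀ i b → Fin (width i b) → Cell 𝛍
    cellAt i b t = cell i (part (inner (𝛍 i)) b + toℕ t) b (ℕ.m≤m+n _ _)
                     (inside (part (inner (𝛍 i)) b) t)

    rowCells : ∀ i → ℕ → List (Cell 𝛍)
    rowCells i b = map (cellAt i b) (allFin (width i b))

    componentCells : Fin k → List (Cell 𝛍)
    componentCells i = concatMap (rowCells i) (upTo (length (parts (outer (𝛍 i)))))

  cells : List (Cell 𝛍)
  cells = concatMap componentCells (allFin k)

  size : ℕ
  size = length cells

  private
    row-bound : ∀ ps b {a} → a < nth ps b → b < length ps
    row-bound (_ ∷ _)  zero    _ = s≤s z≤n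
    row-bound (_ ∷ ps) (suc b) p = s≤s (row-bound ps b p)

    cell-≡ : ∀ {i a a′ b l u l′ u′} → a ≡ a′ → cell {𝛍 = 𝛍} i a b l u ≡ cell i a′ b l′ u′
    cell-≡ {i} {a} {_} {b} {l} {u} {l′} {u′} refl
      with refl ← ℕ.≤-irrelevant l l′ | refl ← ℕ.≤-irrelevant u u′ = refl

    ∈-row : ∀ x → x List.∈ rowCells (comp x) (row x)
    ∈-row (cell i a b l u) =
      subst (List._∈ rowCells i b)
        (cell-≡ (trans (cong (part (inner (𝛍 i)) b ℕ.+_) (Fin.toℕ-fromℕ< t<width))
                       (ℕ.m+[n∸m]≡n l)))
        (∈-map⁺ (cellAt i b) (∈-allFin (fromℕ< t<width)))
      where
      t<width : a ∸ part (inner (𝛍 i)) b < width i b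
      t<width = ℕ.∸-monoˡ-< u l

  ∈-cells : ∀ x → x List.∈ cells
  ∈-cells x = ∈-concatMap⁺ componentCells (Any.map (λ { refl → ∈-component }) (∈-allFin (comp x)))
    where
    ∈-component : x List.∈ componentCells (comp x)
    ∈-component = ∈-concatMap⁺ (rowCells (comp x))
      (Any.map (λ { refl → ∈-row x })
        (∈-upTo⁺ (row-bound (parts (outer (𝛍 (comp x)))) (row x) (∈outer x))))

  content : Cell 𝛍 → ℤ
  content x = + col x ℤ.- + row x

  shiftedContent : Cell 𝛍 → ℤ
  shiftedContent x = + k ℤ.* content x ℤ.+ + toℕ (comp x)

  -- Cells of equal shifted content lie on one diagonal of one component;
  -- southwest to northeast along it is increasing column.
  readingKey : Cell 𝛍 → ℤ × ℕ
  readingKey x = shiftedContent x , col x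

  private
    readingDecTotalOrder : DecTotalOrder 0ℓ 0ℓ 0ℓ
    readingDecTotalOrder =
      On.decTotalOrder (×-decTotalOrder ℤ.≤-decTotalOrder ℕ.≤-decTotalOrder) readingKey

  open Sort readingDecTotalOrder using (sort; sort-↭; sort-↗) public

  readingOrder : List (Cell 𝛍)
  readingOrder = sort cells

  ∈-readingOrder : ∀ x → x List.∈ readingOrder
  ∈-readingOrder x = ∈-resp-↭ (↭-sym (sort-↭ cells)) (∈-cells x)

  position : Cell 𝛍 → Fin (length readingOrder)
  position x = Any.index (∈-readingOrder x)

module _ {n : ℕ} where

  open DecMembership (Fin._≟_ {n}) using () renaming (_∈?_ to _∈ˡ?_)

  LeftOf : ∀ {N} → Vec (Fin n) N → Fin n → Fin n → Set
  LeftOf w u v = ∃[ p ] ∃[ q ] p Fin.< q × lookup w p ≡ u × lookup w q ≡ v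

  leftOf? : ∀ {N} (w : Vec (Fin n) N) u v → Dec (LeftOf w u v)
  leftOf? w u v = Fin.any? λ p → Fin.any? λ q →
    (p Fin.<? q) ×-dec (lookup w p Fin.≟ u) ×-dec (lookup w q Fin.≟ v)

  subword : ∀ {N} → Interior n → Vec (Fin n) N → List (Fin n)
  subword i w = filter (_∈ˡ? (pred# i ∷ self# i ∷ succ# i ∷ [])) (toList w)

  substitute : List (Fin n × Fin n) → Fin n → Fin n
  substitute []               v = v
  substitute ((u , u′) ∷ ρ) v = if does (v Fin.≟ u) then u′ else substitute ρ v

  -- Substitutions effecting d_i and d̃_i on a word whose subword is abc.
  -- When i is the first (last) of the three letters, the farther of i±1 is
  -- the last (first).  On a word of a bijective filling the subword always
  -- has exactly three letters.
  dRule d̃Rule : Interior n → List (Fin n) → List (Fin n × Fin n)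

  dRule i (a ∷ b ∷ c ∷ []) =
    if      does (a Fin.≟ self# i) then (a , c) ∷ (c , a) ∷ []
    else if does (c Fin.≟ self# i) then (a , c) ∷ (c , a) ∷ []
    else []
  dRule i _ = []

  d̃Rule i (a ∷ b ∷ c ∷ []) =
    if      does (a Fin.≟ self# i) then (a , b) ∷ (b , c) ∷ (c , a) ∷ []
    else if does (c Fin.≟ self# i) then (a , c) ∷ (b , a) ∷ (c , b) ∷ []
    else []
  d̃Rule i _ = []

  d d̃ : ∀ {N} → Interior n → Vec (Fin n) N → Vec (Fin n) N
  d i w = Vec.map (substitute (dRule i (subword i w))) w
  d̃ i w = Vec.map (substitute (d̃Rule i (subword i w))) w

module _ {k : ℕ} (𝛍 : Fin k → SkewShape) {n : ℕ} where

  record IsSYT (T : Cell 𝛍 → Fin n) : Set where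
    field
      bijective  : Bijective _≡_ _≡_ T
      row-increasing : ∀ x y → comp x ≡ comp y → row x ≡ row y → col x < col y → T x Fin.< T y
      col-increasing : ∀ x y → comp x ≡ comp y → col x ≡ col y → row x < row y → T x Fin.< T y

record SYT {k : ℕ} (𝛍 : Fin k → SkewShape) (n : ℕ) : Set where
  constructor syt
  field
    filling  : Cell 𝛍 → Fin n
    standard : IsSYT 𝛍 filling

  open IsSYT standard public

  cellOf : Fin n → Cell 𝛍
  cellOf e = proj₁ (proj₂ bijective e)

open SYT public

SYT-setoid : ∀ {k} (𝛍 : Fin k → SkewShape) (n : ℕ) → Setoid 0ℓ 0ℓ
SYT-setoid 𝛍 n = On.setoid (Cell 𝛍 →-setoid Fin n) (filling {𝛍 = 𝛍} {n})

module _ {k : ℕ} {𝛍 : Fin k → SkewShape} {n : ℕ} where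

  readingWord : SYT 𝛍 n → Vec (Fin n) (length (readingOrder 𝛍))
  readingWord T = Vec.map (filling T) (fromList (readingOrder 𝛍))

  σ : SYT 𝛍 n → Vec Sign (n ∸ 1)
  σ T = tabulate λ j →
    if does (leftOf? (readingWord T) (lower j) (upper j)) then Sign.+ else Sign.-

  Des : SYT 𝛍 n → Subset (n ∸ 1)
  Des T = tabulate λ j → does (lookup (σ T) j Sign.≟ Sign.-)

  dist : SYT 𝛍 n → Fin n → Fin n → ℕ
  dist T e f = ∣ shiftedContent 𝛍 (cellOf T e) ℤ.- shiftedContent 𝛍 (cellOf T f) ∣

  dist₃ : SYT 𝛍 n → Fin n → Fin n → Fin n → ℕ
  dist₃ T e f g = dist T e f ⊔ dist T f g ⊔ dist T e g

  D : Interior n → SYT 𝛍 n → Cell 𝛍 → Fin n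
  D i T x = lookup w′ (position 𝛍 x)
    where
    w′ : Vec (Fin n) (length (readingOrder 𝛍))
    w′ = if does (k ℕ.<? dist₃ T (pred# i) (self# i) (succ# i))
         then d i (readingWord T)
         else d̃ i (readingWord T)

-- A formal power series in x₁, x₂, … with coefficients in ℕ, given by the
-- coefficient of x₁^α₁ ⋯ x_N^α_N for each N and each α.
Series : Set
Series = ∀ {N} → Vec ℕ N → ℕ

infix 4 _≋_
_≋_ : Series → Series → Set
f ≋ g = ∀ {N} (α : Vec ℕ N) → f α ≡ g α

words : ∀ N m → List (Vec (Fin N) m)
words N zero    = [] ∷ []
words N (suc m) = cartesianProductWith _∷_ (allFin N) (words N m)

exponents : ∀ {N m} → Vec (Fin N) m → Vec ℕ N
exponents w = tabulate λ v → Vec.count (v Fin.≟_) w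

-- Σ x_{w₁} ⋯ x_{w_m} over the words w satisfying P.  Only the variables
-- x₁, …, x_N can occur in a product equal to x₁^α₁ ⋯ x_N^α_N.
generating : ∀ m (P : ∀ {N} → Pred (Vec (Fin N) m) 0ℓ) → (∀ {N} → Decidable (P {N})) → Series
generating m P P? {N} α =
  length (filter (λ w → P? w ×-dec Vec.≡-dec ℕ._≟_ (exponents w) α) (words N m))

IsCompatible : ∀ m → Subset (m ∸ 1) → ∀ {N} → Pred (Vec (Fin N) m) 0ℓ
IsCompatible m D w = ∀ j → (lookup w (lower j) Fin.≤ lookup w (upper j)) ×
                         (j ∈ D → lookup w (lower j) Fin.< lookup w (upper j))

isCompatible? : ∀ m (D : Subset (m ∸ 1)) {N} → Decidable (IsCompatible m D {N})
isCompatible? m D w = Fin.all? λ j →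
  (lookup w (lower j) Fin.≤? lookup w (upper j)) ×-dec
  ((j ∈? D) →-dec (lookup w (lower j) Fin.<? lookup w (upper j)))

Q : ∀ m → Subset (m ∸ 1) → Series
Q m D = generating m (IsCompatible m D) (isCompatible? m D)

-- A filling of the diagram of ν is the word of its entries, in the order in
-- which diagram ν lists the cells.
IsSSYT : ∀ ν {N} → Pred (Vec (Fin N) (length (diagram ν))) 0ℓ
IsSSYT ν T = ∀ p q →
  let (a , b)   = List.lookup (diagram ν) p
      (a′ , b′) = List.lookup (diagram ν) q
  in (b ≡ b′ → a < a′ → lookup T p Fin.≤ lookup T q) ×
     (a ≡ a′ → b < b′ → lookup T p Fin.< lookup T q)

isSSYT? : ∀ ν {N} → Decidable (IsSSYT ν {N})
isSSYT? ν T = Fin.all? λ p → Fin.all? λ q →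
  let (a , b)   = List.lookup (diagram ν) p
      (a′ , b′) = List.lookup (diagram ν) q
  in ((b ℕ.≟ b′) →-dec ((a ℕ.<? a′) →-dec (lookup T p Fin.≤? lookup T q))) ×-dec
     ((a ℕ.≟ a′) →-dec ((b ℕ.<? b′) →-dec (lookup T p Fin.<? lookup T q)))

schur : Partition → Series
schur ν = generating (length (diagram ν)) (IsSSYT ν) (isSSYT? ν)

SchurPositive : Series → Set
SchurPositive f = Σ[ cs ∈ List (ℕ × Partition) ]
  f ≋ (λ α → sum (map (λ (c , ν) → c * schur ν α) cs))

IsSchur : ℕ → Series → Set
IsSchur m f = ∃[ ν ] ∥ ν ∥ ≡ m × f ≋ schur ν

-- Des_{h,i} as a function of Des.  An element j of [i-h+2] belongs to it
-- exactly when d = j + (h-2), which then lies in {h-1,…,i}, belongs to Des;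
-- subtracting 1 on both sides, the same shift relates the elements of Fin.
restrict : ∀ {n} (h i : Interior n) → idx h ≤ idx i → Subset (n ∸ 1) → Subset (2 + (idx i ∸ idx h))
restrict {n} (interior h 1<h _) (interior i _ i<n) h≤i D =
  tabulate λ j → lookup D (fromℕ< {toℕ j + (h ∸ 2)} (bound j))
  where
  open ℕ.≤-Reasoning
  bound : (j : Fin (2 + (i ∸ h))) → toℕ j + (h ∸ 2) < n ∸ 1
  bound j = begin-strict
    toℕ j + (h ∸ 2)             <⟨ ℕ.+-monoˡ-< (h ∸ 2) (Fin.toℕ<n j) ⟩
    2 + (i ∸ h) + (h ∸ 2)       ≡⟨ cong (_+ (h ∸ 2)) (ℕ.+-comm 2 (i ∸ h)) ⟩
    (i ∸ h) + 2 + (h ∸ 2)       ≡⟨ ℕ.+-assoc (i ∸ h) 2 (h ∸ 2) ⟩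
    (i ∸ h) + (2 + (h ∸ 2))     ≡⟨ cong ((i ∸ h) ℕ.+_) (ℕ.m+[n∸m]≡n 1<h) ⟩
    (i ∸ h) + h                 ≡⟨ ℕ.m∸n+n≡m h≤i ⟩
    i                           ≤⟨ ℕ.∸-monoˡ-≤ 1 i<n ⟩
    n ∸ 1                       ∎

module DualEquivalence
  {n : ℕ} (A : Setoid 0ℓ 0ℓ)
  (Desc : Setoid.Carrier A → Subset (n ∸ 1))
  (φ : Interior n → Setoid.Carrier A → Setoid.Carrier A)
  where

  open Setoid A using (_≈_) renaming (Carrier to C)
  open SetoidMembership A using () renaming (_∈_ to _∈ᴬ_)

  -- The class of T is closed under _≈_ as soon as h ≤ i and φ respects
  -- _≈_: if T ≈ T′, then T and T′ are both related to φ h T.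
  [_] : C → Interior n → Interior n → Pred C 0ℓ
  [ T ] h i = EqClosure (λ U V → ∃[ j ] idx h ≤ idx j × idx j ≤ idx i × φ j U ≈ V) T

  Lists : List C → Pred C 0ℓ → Set
  Lists us P = Unique.Unique A us × (∀ U → U ∈ᴬ us ⇔ P U)

  ΣQ : (h i : Interior n) → idx h ≤ idx i → List C → Series
  ΣQ h i h≤i us α = sum (map (λ U → Q (3 + (idx i ∸ idx h)) (restrict h i h≤i (Desc U)) α) us)

  ClassSum : (h i : Interior n) → idx h ≤ idx i → C → (Series → Set) → Set
  ClassSum h i h≤i T P = ∃[ us ] Lists us ([ T ] h i) × P (ΣQ h i h≤i us)

  record IsWeakDualEquivalence : Set where
    field
      finite        : ∃[ xs ] Enumerates.IsEnumeration A xs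
      Desc-cong     : ∀ {T U} → T ≈ U → Desc T ≡ Desc U
      φ-cong        : ∀ i {T U} → T ≈ U → φ i T ≈ φ i U
      φ-involutive  : ∀ i T → φ i (φ i T) ≈ T
      schurPositive : ∀ h i (h≤i : idx h ≤ idx i) → idx i ∸ idx h ≤ 3 →
                      ∀ T → ClassSum h i h≤i T SchurPositive
      schurSingle   : ∀ h i (h≤i : idx h ≤ idx i) → idx h ≡ idx i →
                      ∀ T → ClassSum h i h≤i T (IsSchur (3 + (idx i ∸ idx h)))
      φ-commute     : ∀ i j → 3 ≤ ℕ.∣ idx i - idx j ∣ → ∀ T → φ i (φ j T) ≈ φ j (φ i T)

  record IsDualEquivalence : Set where
    field
      isWeakDualEquivalence : IsWeakDualEquivalence
      singleSchur           : ∀ h i (h≤i : idx h ≤ idx i) → idx i ∸ idx h ≤ 3 →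
                              ∀ T → ClassSum h i h≤i T (IsSchur (3 + (idx i ∸ idx h)))

open DualEquivalence public using (IsWeakDualEquivalence; IsDualEquivalence)

{-# OPTIONS --safe #-}

-- On the cells of i−1, i, i+1 the operator D i permutes three entries, and how
-- depends only on the reading order of these cells and on whether the outer two
-- are within distance k.  It respects the shape: when they are, the middle cell
-- is incomparable to both, since otherwise it would share a diagonal with one
-- of them and their entries would differ by at least 3; when they are not, the
-- two entries that are swapped are consecutive, hence not in adjacent cells.
--
-- The class of T under φ_h, …, φ_i is therefore determined by the relative
-- reading order of the m = i−h+3 ≤ 6 cells of the window and by which of them
-- are within distance k.  Sorting the cells, the latter is a weakly increasing
-- vector f (f_p is the last position close to p), and only positions at least 2
-- apart matter, so there are 2, 5, 14, 42 vectors for m = 3, 4, 5, 6.  For each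
-- of them every orbit on the permutations of m is computed and its descent sets
-- are compared with those of standard Young tableaux, using that s_ν is the sum
-- of Q_Des over the standard tableaux of shape ν (P-partitions).
--
-- For k ≤ 2 a nontrivial d̃ acts on cells with shifted contents c, c+1, c+2, so
-- k = 2 and the outer cells are comparable: their order is the same in all
-- standard fillings.  Every orbit with this property is a single Schur function.

module Submission where

open import Defs
open import Level using (0ℓ)
open import Algebra.Properties.CommutativeSemigroup using (interchange; x∙yz≈y∙xz)
open import Data.Bool.Base using (Bool; true; false; if_then_else_; _∧_; _∨_; not; T)
open import Data.Bool.ListAction using (all; any)
open import Data.Bool.Properties using (T-∧; T-∨; T-≡; T-not-≡)
open import Data.Fin.Base as Fin using (Fin; zero; suc; toℕ; fromℕ<; inject₁; punchOut)
import Data.Fin.Properties as Fin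
open import Data.Fin.Subset using (Subset) renaming (_∈_ to _∈ˢ_)
open import Data.Integer.Base as ℤ using (ℤ; +_; ∣_∣)
import Data.Integer.Properties as ℤ
open import Algebra.Properties.AbelianGroup ℤ.+-0-abelianGroup using (∙-cancelˡ)
open import Data.Integer.Solver using (module +-*-Solver)
open import Data.List.Base as List using (List; []; _∷_; _++_; map; concatMap; filter; foldr; length; upTo)
import Data.List.Properties as List
import Data.List.Membership.DecPropositional as DecMembership
open import Data.List.Membership.Propositional using (_∈_; find; lose)
open import Data.List.Membership.Propositional.Properties
open import Data.List.Membership.Propositional.Properties.WithK using (unique∧set⇒bag)
import Data.List.Membership.Setoid as SetoidMembership
open import Data.List.Relation.Binary.BagAndSetEquality using (∼bag⇒↭)
open import Data.List.Relation.Binary.Permutation.Propositional using (_↭_; ↭-refl; ↭-sym; ↭-trans; prep; swap)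
open import Data.List.Relation.Binary.Permutation.Propositional.Properties using (map⁺; ↭-length; ∈-resp-↭)
open import Data.List.Relation.Binary.Pointwise using (Pointwise; []; _∷_)
open import Data.List.Relation.Unary.All as All using (All; []; _∷_)
import Data.List.Relation.Unary.All.Properties as All
open import Data.List.Relation.Unary.AllPairs as AllPairs using (AllPairs; []; _∷_)
import Data.List.Relation.Unary.AllPairs.Properties as AllPairs
open import Data.List.Relation.Unary.Any as Any using (Any; here; there)
import Data.List.Relation.Unary.Any.Properties as Any
open import Data.List.Relation.Unary.Linked as Linked using (Linked; []; [-]; _∷_)
import Data.List.Relation.Unary.Linked.Properties as Linked
open import Data.List.Relation.Unary.Unique.Propositional using (Unique)
import Data.List.Relation.Unary.Unique.Propositional.Properties as Unique
open import Data.Maybe.Base using (Maybe; just; nothing; maybe′)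
open import Data.Nat.Base as ℕ using (ℕ; zero; suc; _+_; _*_; _∸_; _⊔_; _≤_; _<_; _≡ᵇ_; _<ᵇ_; _≤ᵇ_; z≤n; s≤s)
import Data.Nat.Properties as ℕ
open import Data.Nat.ListAction using (sum)
open import Data.Nat.ListAction.Properties using (sum-++; sum-↭)
open import Data.Product.Base using (Σ-syntax; ∃-syntax; _×_; _,_; proj₁; proj₂)
open import Data.Product.Properties using (,-injective)
open import Data.Sign.Base using (Sign)
import Data.Sign.Properties as Sign
open import Data.Sum.Base as Sum using (_⊎_; inj₁; inj₂; [_,_]′)
open import Data.Unit.Base using (⊤; tt)
open import Data.Vec.Base as Vec using (Vec; []; _∷_; lookup; tabulate; toList; fromList; here; there)
import Data.Vec.Properties as Vec
import Data.Vec.Membership.Propositional as VecMem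
import Data.Vec.Membership.Propositional.Properties as VecMem
open import Data.Vec.Relation.Unary.All as VecAll using ([]; _∷_)
import Data.Vec.Relation.Unary.All.Properties as VecAll
open import Data.Vec.Relation.Unary.AllPairs as VecPairs using ([]; _∷_; allPairs?)
import Data.Vec.Relation.Unary.Any as VecAny
import Data.Vec.Relation.Unary.Any.Properties as VecAny
open import Data.Vec.Relation.Unary.Linked as VecLinked using ([]; [-]; _∷_; linked?)
import Data.Vec.Relation.Unary.Unique.Propositional as VecUnique
import Data.Vec.Relation.Unary.Unique.Propositional.Properties as VecUnique
open import Function.Base using (_∘_; id)
open import Function.Bundles using (_⇔_; mk⇔; Equivalence)
open import Relation.Binary.Bundles using (Setoid)
open import Relation.Binary.Construct.Closure.Equivalence as Eq using (EqClosure)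
open import Relation.Binary.Construct.Closure.ReflexiveTransitive using (ε; _◅_)
open import Relation.Binary.Construct.Closure.Symmetric using (fwd; bwd)
open import Relation.Binary.Definitions using (tri<; tri≈; tri>)
open import Relation.Binary.PropositionalEquality hiding ([_])
open import Relation.Nullary using (¬_; Dec; yes; no; does)
open import Relation.Nullary.Decidable
  using (map′; ¬?; _×-dec_; _⊎-dec_; _→-dec_; dec-true; dec-false; does-⇔; True; toWitness)
open import Relation.Nullary.Negation using (contradiction)
open import Relation.Unary using (Decidable)

-- The local moves and the finite check

-- The operators only move entries among fixed cells, so the places of the entries of a window
-- evolve without reference to the shape. For example, if m = 4 and all places are close, the words
-- 1423, 1342, 2143, 3124, 2314 form one orbit, with descents 3; 2; 1 and 3; 2; 1, which is s_31 +
-- s_22. The test `tameᵇ` brings back just enough of the shape: the order of the outer two cells of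
-- a nontrivial d̃. Since this is a property of a whole orbit, it is tested on the computed list,
-- and it is supplied for tableaux only after states and class members have been matched.

insertions : ∀ {A : Set} {n} → A → Vec A n → List (Vec A (suc n))
insertions x []      = (x ∷ []) ∷ []
insertions x (y ∷ v) = (x ∷ y ∷ v) ∷ map (y ∷_) (insertions x v)

perms : ∀ {A : Set} {n} → Vec A n → List (Vec A n)
perms []      = [] ∷ []
perms (x ∷ v) = concatMap (insertions x) (perms v)

module _ {X : Set} (lt close : X → X → Bool) where

  -- a, b, c are the places of i−1, i, i+1 in the reading word; the result
  -- lists their places after d̃_i if the outer two are close, after d_i if not.
  rotate : X → X → X → X × X × X
  rotate a b c =
    if lt a b
    then (if lt b c then (a , b , c) else
          if lt a c then (if close a b then (c , a , b) else (b , a , c))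
                    else (if close c b then (b , c , a) else (a , c , b)))
    else (if lt b c
          then (if lt a c then (if close b c then (b , c , a) else (a , c , b))
                          else (if close b a then (c , a , b) else (b , a , c)))
          else (a , b , c))

  -- The outer two places when d̃_i applies and is not the identity.
  ends : X → X → X → Maybe (X × X)
  ends a b c =
    if lt a b
    then (if lt b c then nothing else
          if lt a c then (if close a b then just (a , b) else nothing)
                    else (if close c b then just (c , b) else nothing))
    else (if lt b c
          then (if lt a c then (if close b c then just (b , c) else nothing)
                          else (if close b a then just (b , a) else nothing))
          else nothing)

  -- Vectors are indexed by entries and hold places, so an offset selects three consecutive entries,
  -- wherever these stand in the reading word.
  move : ∀ {r} → Fin (suc r) → Vec X (3 + r) → Vec X (3 + r)
  move zero (a ∷ b ∷ c ∷ v) = let (a′ , b′ , c′) = rotate a b c in a′ ∷ b′ ∷ c′ ∷ v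
  move {suc r} (suc j) (a ∷ v) = a ∷ move j v

  endsAt : ∀ {r} → Fin (suc r) → Vec X (3 + r) → Maybe (X × X)
  endsAt zero (a ∷ b ∷ c ∷ v) = ends a b c
  endsAt {suc r} (suc j) (a ∷ v) = endsAt j v

descents : ∀ {X : Set} {n} → (X → X → Bool) → Vec X (suc n) → Subset n
descents lt (a ∷ [])    = []
descents lt (a ∷ b ∷ v) = lt b a ∷ descents lt (b ∷ v)

-- As a state is indexed by entries, this asks which of the places x and y holds the smaller entry.
before : ∀ {n} → ℕ → ℕ → Vec ℕ n → Bool
before x y []      = false
before x y (z ∷ v) = if z ≡ᵇ x then true else if z ≡ᵇ y then false else before x y v

eqᵇ : ∀ {n} → Vec ℕ n → Vec ℕ n → Bool
eqᵇ []      []      = true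
eqᵇ (x ∷ u) (y ∷ v) = if x ≡ᵇ y then eqᵇ u v else false

elem : ∀ {n} → Vec ℕ n → List (Vec ℕ n) → Bool
elem x = any (eqᵇ x)

distinct : ∀ {n} → List (Vec ℕ n) → Bool
distinct []      = true
distinct (x ∷ L) = not (elem x L) ∧ distinct L

-- A multiset of subsets, as the binary tree of their multiplicities.
data Tally : ℕ → Set where
  leaf : ℕ → Tally 0
  node : ∀ {n} → Tally n → Tally n → Tally (suc n)

empty : ∀ n → Tally n
empty zero    = leaf 0
empty (suc n) = node (empty n) (empty n)

zipTally : (ℕ → ℕ → ℕ) → ∀ {n} → Tally n → Tally n → Tally n
zipTally f (leaf a)   (leaf b)   = leaf (f a b)
zipTally f (node s t) (node u v) = node (zipTally f s u) (zipTally f t v)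

mapTally : (ℕ → ℕ) → ∀ {n} → Tally n → Tally n
mapTally f (leaf a)   = leaf (f a)
mapTally f (node s t) = node (mapTally f s) (mapTally f t)

increment : ∀ {n} → Subset n → Tally n → Tally n
increment []          (leaf a)   = leaf (suc a)
increment (false ∷ D) (node s t) = node (increment D s) t
increment (true  ∷ D) (node s t) = node s (increment D t)

tally : ∀ {n} → List (Subset n) → Tally n
tally {n} = foldr increment (empty n)

sameᵇ : ∀ {n} → Tally n → Tally n → Bool
sameᵇ (leaf a)   (leaf b)   = a ≡ᵇ b
sameᵇ (node s t) (node u v) = sameᵇ s u ∧ sameᵇ t v

-- A list that is too long is cut off at the leaf. The lists `lead` of `entry` are one letter too
-- long: they also mark the end of the last row.
multiplicity : ∀ {n} → List Bool → Tally n → ℕ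
multiplicity _           (leaf a)   = a
multiplicity []          (node s t) = multiplicity [] s
multiplicity (false ∷ D) (node s t) = multiplicity D s
multiplicity (true ∷ D)  (node s t) = multiplicity D t

module _ (ν : Partition) where

  private
    m = length (diagram ν)

  colᵈ rowᵈ : Fin m → ℕ
  colᵈ p = proj₁ (List.lookup (diagram ν) p)
  rowᵈ p = proj₂ (List.lookup (diagram ν) p)

  _⊏ᵈ_ : Fin m → Fin m → Set
  p ⊏ᵈ q = (rowᵈ p ≡ rowᵈ q × colᵈ p < colᵈ q) ⊎ (colᵈ p ≡ colᵈ q × rowᵈ p < rowᵈ q)

  _⊏ᵈ?_ : ∀ p q → Dec (p ⊏ᵈ q)
  p ⊏ᵈ? q = ((rowᵈ p ℕ.≟ rowᵈ q) ×-dec (colᵈ p ℕ.<? colᵈ q)) ⊎-dec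
            ((colᵈ p ℕ.≟ colᵈ q) ×-dec (rowᵈ p ℕ.<? rowᵈ q))

  -- Equal entries are standardised in this order, which makes columns strict.
  _◁_ : Fin m → Fin m → Set
  p ◁ q = rowᵈ q < rowᵈ p ⊎ (rowᵈ p ≡ rowᵈ q × colᵈ p < colᵈ q)

  _◁?_ : ∀ p q → Dec (p ◁ q)
  p ◁? q = (rowᵈ q ℕ.<? rowᵈ p) ⊎-dec ((rowᵈ p ℕ.≟ rowᵈ q) ×-dec (colᵈ p ℕ.<? colᵈ q))

  -- Here π lists the cells by increasing entry, so this is standardness of the tableau that π
  -- encodes.
  IsLinearExtension : Vec (Fin m) m → Set
  IsLinearExtension = VecPairs.AllPairs (λ p q → ¬ (q ⊏ᵈ p))

  isLinearExtension? : ∀ π → Dec (IsLinearExtension π)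
  isLinearExtension? = allPairs? (λ p q → ¬? (q ⊏ᵈ? p))

descentsOf : ∀ {X : Set} {n} → (X → X → Bool) → Vec X n → Subset (n ∸ 1)
descentsOf {n = zero}  lt v = []
descentsOf {n = suc n} lt v = descents lt v

tableauDescents : ∀ ν → List (Subset (length (diagram ν) ∸ 1))
tableauDescents ν = map (descentsOf (λ p q → does (_◁?_ ν p q))) (List.filter (isLinearExtension? ν) (perms (Vec.allFin _)))

record Shape (m : ℕ) : Set where
  constructor shape
  field
    ν      : Partition
    card   : length (diagram ν) ≡ m
    weight : ∥ ν ∥ ≡ m

tableaux : ∀ {m} → Shape m → List (Subset (m ∸ 1))
tableaux (shape ν card _) = subst (λ m → List (Subset (m ∸ 1))) card (tableauDescents ν)

Entry : ℕ → Set
Entry n = Shape (suc n) × List Bool × Tally n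

entry : ∀ {n} → Shape (suc n) → Entry n
entry σ = σ , lead (parts (Shape.ν σ)) , tally (tableaux σ)
  where
  -- The descents of the tableau filled row after row. No other tableau of shape ν has this descent
  -- set, and another shape can have it only if it dominates ν; this is why subtraction in
  -- decreasing lexicographic order finds the coefficients.
  lead : List ℕ → List Bool
  lead []       = []
  lead (p ∷ ps) = List.replicate (p ∸ 1) false ++ true ∷ lead ps

-- A guess of the Schur expansion: the shapes are listed in decreasing
-- lexicographic order, and the coefficient of each is read off at its leading
-- descent set.  Nothing is proved about it; schurᵇ checks the guess.
greedy : ∀ {n} → List (Entry n) → Tally n → List (ℕ × Entry n)
greedy []       t = []
greedy (e@(σ , l , s) ∷ es) t with multiplicity l t
... | zero    = greedy es t
... | suc c   = (suc c , e) ∷ greedy es (zipTally _∸_ t (mapTally (suc c *_) s))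

combination : ∀ {n} → List (ℕ × Entry n) → Tally n
combination {n} []                   = empty n
combination     ((c , _ , _ , s) ∷ cs) = zipTally _+_ (mapTally (c *_) s) (combination cs)

singleᵇ : ∀ {n} → List (ℕ × Entry n) → Bool
singleᵇ ((c , _) ∷ []) = c ≡ᵇ 1
singleᵇ _              = false

-- Branches on the place of each entry in turn, so that a permutation of an orbit already checked is
-- recognised without scanning the earlier orbits.
data Trie : ℕ → Set where
  none : ∀ {n} → Trie n
  leaf : Trie 0
  node : ∀ {n} → List (Trie n) → Trie (suc n)

mutual
  member : ∀ {n} → Vec ℕ n → Trie n → Bool
  member v       none      = false
  member []      leaf      = true
  member (x ∷ v) (node ts) = memberAt x v ts

  memberAt : ∀ {n} → ℕ → Vec ℕ n → List (Trie n) → Bool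
  memberAt _       _ []       = false
  memberAt zero    v (t ∷ ts) = member v t
  memberAt (suc x) v (t ∷ ts) = memberAt x v ts

mutual
  insert : ∀ {n} → Vec ℕ n → Trie n → Trie n
  insert []      t         = leaf
  insert (x ∷ v) none      = node (insertAt x v [])
  insert (x ∷ v) (node ts) = node (insertAt x v ts)

  insertAt : ∀ {n} → ℕ → Vec ℕ n → List (Trie n) → List (Trie n)
  insertAt zero    v []       = insert v none ∷ []
  insertAt zero    v (t ∷ ts) = insert v t ∷ ts
  insertAt (suc x) v []       = none ∷ insertAt x v []
  insertAt (suc x) v (t ∷ ts) = t ∷ insertAt x v ts

-- The default matters little: `close p q` is consulted only when a third place lies between p and
-- q, and among 3 + r places this forces p ≤ r, where f has an entry.
nthᵛ : ∀ {n} → Vec ℕ n → ℕ → ℕ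
nthᵛ []      _       = 0
nthᵛ (x ∷ v) zero    = x
nthᵛ (x ∷ v) (suc p) = nthᵛ v p

-- A state lists the places, in reading order, of the entries of a window.
-- Neighbouring places never enclose a third one, so close p (p + 1) is irrelevant.
module Local (r : ℕ) (f : Vec ℕ (suc r)) where

  State : Set
  State = Vec ℕ (3 + r)

  close : ℕ → ℕ → Bool
  close p q = q ≤ᵇ nthᵛ f p

  act : Fin (suc r) → State → State
  act = move _<ᵇ_ close

  indices : List (Fin (suc r))
  indices = List.allFin (suc r)

  visit : State → List State × List State → List State × List State
  visit y (seen , frontier) = if elem y seen then (seen , frontier) else (y ∷ seen , y ∷ frontier)

  -- Fuel serves termination only. Completeness of the result is not proved but tested: a list that
  -- is still incomplete fails `closedᵇ`.
  search : ℕ → List State × List State → List State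
  search (suc fuel) (seen , x ∷ frontier) =
    search fuel (foldr (λ j → visit (act j x)) (seen , frontier) indices)
  search _ (seen , _) = seen

  -- No orbit has more than 71 elements.
  orbit : State → List State
  orbit x = search 100 (x ∷ [] , x ∷ [])

  -- Involutivity is tested along with closure, since it lets the directed relation `Reach` be
  -- followed backwards.
  closedᵇ : List State → Bool
  closedᵇ L = all (λ x → all (λ j → elem (act j x) L ∧ eqᵇ (act j (act j x)) x) indices) L

  constantᵇ : List State → ℕ → ℕ → Bool
  constantᵇ L p q = all (before p q) L ∨ all (λ x → not (before p q x)) L

  -- The form in which comparability of the outer two cells survives once the shape is forgotten:
  -- whenever some member of the orbit has these ends, all members agree on which end holds the
  -- smaller entry.
  tameᵇ : List State → Bool
  tameᵇ L = all (λ x → all (λ j → maybe′ (λ (p , q) → constantᵇ L p q) true (endsAt _<ᵇ_ close j x)) indices) L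

  -- Every orbit needs an expansion with coefficients in ℕ; a single Schur function is demanded only
  -- if r = 0 or the orbit is tame. In this order of the disjunction, `tameᵇ` is evaluated only for
  -- orbits that are not single.
  schurᵇ : List State → Tally (2 + r) → List (ℕ × Entry (2 + r)) → Bool
  schurᵇ L t cs = sameᵇ t (combination cs) ∧ (singleᵇ cs ∨ not ((r ≡ᵇ 0) ∨ tameᵇ L))

  classᵇ : List (Entry (2 + r)) → List State → Bool
  classᵇ table L = closedᵇ L ∧ distinct L ∧
    (let t = tally (map (descents _<ᵇ_) L) in schurᵇ L t (greedy table t))

  -- The trie holds the states of the orbits that have already been checked.
  cover : List (Entry (2 + r)) → List State → Trie (3 + r) → Bool
  cover table []       t = true
  cover table (p ∷ ps) t =
    if member p t then cover table ps t else
      (let L = orbit p in elem p L ∧ classᵇ table L ∧ cover table ps (foldr insert t L))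

-- Weakly increasing vectors with p < f_p < m. Together with the forced entry m-1 at p = m-2 they
-- are Dyck paths, so that for l = m-2 their number is the Catalan number C_(m-1).
farVectors : ∀ (m : ℕ) l → ℕ → ℕ → List (Vec ℕ l)
farVectors m zero    p lo = [] ∷ []
farVectors m (suc l) p lo =
  concatMap (λ v → map (v ∷_) (farVectors m l (suc p) v))
            (map (λ d → d + (lo ⊔ suc p)) (List.upTo (m ∸ (lo ⊔ suc p))))

indexOf : ∀ {n l} → Fin n → Vec (Fin n) l → ℕ
indexOf e []      = 0
indexOf e (x ∷ v) = if toℕ e ≡ᵇ toℕ x then 0 else suc (indexOf e v)

-- A reading word sends places to entries, a state sends entries to places.
inverse : ∀ {n l} → Vec (Fin n) l → Vec ℕ n
inverse π = Vec.map (λ e → indexOf e π) (Vec.allFin _)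

check : ∀ r → List (Entry (2 + r)) → List (Vec ℕ (3 + r)) → Bool
check r table ps = all (λ f → Local.cover r f table ps none) (farVectors (3 + r) (suc r) 0 0)

partition : (ps : List ℕ) {_ : True (Linked.linked? ℕ._≥?_ ps)} {_ : True (All.all? (0 ℕ.<?_) ps)} → Partition
partition ps {d} {p} = record { parts = ps ; decreasing = toWitness d ; positive = toWitness p }

young : ∀ {m} (ps : List ℕ) {d : True (Linked.linked? ℕ._≥?_ ps)} {p : True (All.all? (0 ℕ.<?_) ps)} →
        let ν = partition ps {d} {p} in {_ : True (length (diagram ν) ℕ.≟ m)} {_ : True (∥ ν ∥ ℕ.≟ m)} → Shape m
young ps {d} {p} {card} {weight} = shape (partition ps {d} {p}) (toWitness card) (toWitness weight)

shapes : ∀ r → List (Shape (3 + r))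
shapes 0 = young (3 ∷ []) ∷ young (2 ∷ 1 ∷ []) ∷ young (1 ∷ 1 ∷ 1 ∷ []) ∷ []
shapes 1 = young (4 ∷ []) ∷ young (3 ∷ 1 ∷ []) ∷ young (2 ∷ 2 ∷ []) ∷ young (2 ∷ 1 ∷ 1 ∷ []) ∷
           young (1 ∷ 1 ∷ 1 ∷ 1 ∷ []) ∷ []
shapes 2 = young (5 ∷ []) ∷ young (4 ∷ 1 ∷ []) ∷ young (3 ∷ 2 ∷ []) ∷ young (3 ∷ 1 ∷ 1 ∷ []) ∷
           young (2 ∷ 2 ∷ 1 ∷ []) ∷ young (2 ∷ 1 ∷ 1 ∷ 1 ∷ []) ∷ young (1 ∷ 1 ∷ 1 ∷ 1 ∷ 1 ∷ []) ∷ []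
shapes 3 = young (6 ∷ []) ∷ young (5 ∷ 1 ∷ []) ∷ young (4 ∷ 2 ∷ []) ∷ young (4 ∷ 1 ∷ 1 ∷ []) ∷
           young (3 ∷ 3 ∷ []) ∷ young (3 ∷ 2 ∷ 1 ∷ []) ∷ young (3 ∷ 1 ∷ 1 ∷ 1 ∷ []) ∷ young (2 ∷ 2 ∷ 2 ∷ []) ∷
           young (2 ∷ 2 ∷ 1 ∷ 1 ∷ []) ∷ young (2 ∷ 1 ∷ 1 ∷ 1 ∷ 1 ∷ []) ∷ young (1 ∷ 1 ∷ 1 ∷ 1 ∷ 1 ∷ 1 ∷ []) ∷
           []
shapes _ = []

checkAll : ℕ → Bool
checkAll r = check r (map entry (shapes r)) (map inverse (perms (Vec.allFin (3 + r))))

-- Soundness of the finite check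

∑ : ∀ {A : Set} → List A → (A → ℕ) → ℕ
∑ xs f = sum (map f xs)

T-∧⁻ : ∀ {x y} → T (x ∧ y) → T x × T y
T-∧⁻ = Equivalence.to T-∧

-- The linear extension of F to multisets of subsets. With F D a coefficient of Q_D, an equality of
-- tallies becomes an equality of coefficients of quasisymmetric functions.
mass : ∀ {n} → (Subset n → ℕ) → Tally n → ℕ
mass F (leaf a)   = a * F []
mass F (node s t) = mass (F ∘ (false ∷_)) s + mass (F ∘ (true ∷_)) t

mass-empty : ∀ n (F : Subset n → ℕ) → mass F (empty n) ≡ 0
mass-empty zero    F = refl
mass-empty (suc n) F = cong₂ _+_ (mass-empty n _) (mass-empty n _)

mass-increment : ∀ {n} (F : Subset n → ℕ) D t → mass F (increment D t) ≡ F D + mass F t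
mass-increment F []          (leaf a)   = refl
mass-increment F (false ∷ D) (node s t) =
  trans (cong (_+ mass _ t) (mass-increment _ D s)) (ℕ.+-assoc (F (false ∷ D)) _ _)
mass-increment F (true ∷ D)  (node s t) =
  trans (cong (_+_ (mass _ s)) (mass-increment _ D t)) (x∙yz≈y∙xz ℕ.+-commutativeSemigroup (mass _ s) (F (true ∷ D)) _)

mass-tally : ∀ {n} (F : Subset n → ℕ) Ds → mass F (tally Ds) ≡ ∑ Ds F
mass-tally F []       = mass-empty _ F
mass-tally F (D ∷ Ds) = trans (mass-increment F D (tally Ds)) (cong (_+_ (F D)) (mass-tally F Ds))

mass-+ : ∀ {n} (F : Subset n → ℕ) s t → mass F (zipTally _+_ s t) ≡ mass F s + mass F t
mass-+ F (leaf a)   (leaf b)   = ℕ.*-distribʳ-+ (F []) a b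
mass-+ F (node s t) (node u v) =
  trans (cong₂ _+_ (mass-+ _ s u) (mass-+ _ t v)) (interchange ℕ.+-commutativeSemigroup (mass _ s) _ _ _)

mass-* : ∀ {n} (F : Subset n → ℕ) c t → mass F (mapTally (c *_) t) ≡ c * mass F t
mass-* F c (leaf a)   = ℕ.*-assoc c a _
mass-* F c (node s t) =
  trans (cong₂ _+_ (mass-* _ c s) (mass-* _ c t)) (sym (ℕ.*-distribˡ-+ c (mass _ s) _))

sameᵇ⇒≡ : ∀ {n} (s t : Tally n) → T (sameᵇ s t) → s ≡ t
sameᵇ⇒≡ (leaf a)   (leaf b)   e = cong leaf (ℕ.≡ᵇ⇒≡ a b e)
sameᵇ⇒≡ (node s t) (node u v) e =
  let (e₁ , e₂) = T-∧⁻ e in cong₂ node (sameᵇ⇒≡ s u e₁) (sameᵇ⇒≡ t v e₂)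

mass-combination : ∀ {n} (F : Subset n → ℕ) (cs : List (ℕ × Entry n)) →
                   mass F (combination cs) ≡ ∑ cs (λ (c , _ , _ , t) → c * mass F t)
mass-combination F []                   = mass-empty _ F
mass-combination F ((c , _ , _ , t) ∷ cs) =
  trans (mass-+ F (mapTally (c *_) t) (combination cs)) (cong₂ _+_ (mass-* F c t) (mass-combination F cs))

-- The one fact kept about the guess: its tallies come from the table, hence are tallies of standard
-- tableaux.
greedy-entries : ∀ {n} (table : List (Entry n)) t → All (λ (_ , e) → e ∈ table) (greedy table t)
greedy-entries []                 t = []
greedy-entries ((σ , l , s) ∷ es) t with multiplicity l t
... | zero  = All.map there (greedy-entries es t)
... | suc c = here refl ∷ All.map there (greedy-entries es _)

eqᵇ⇒≡ : ∀ {n} (u v : Vec ℕ n) → T (eqᵇ u v) → u ≡ v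
eqᵇ⇒≡ []      []      _ = refl
eqᵇ⇒≡ (x ∷ u) (y ∷ v) e with x ≡ᵇ y in eq
... | true = cong₂ _∷_ (ℕ.≡ᵇ⇒≡ x y (subst T (sym eq) tt)) (eqᵇ⇒≡ u v e)

eqᵇ-refl : ∀ {n} (u : Vec ℕ n) → T (eqᵇ u u)
eqᵇ-refl []      = tt
eqᵇ-refl (x ∷ u) with x ≡ᵇ x in eq
... | true  = eqᵇ-refl u
... | false = subst T eq (ℕ.≡⇒≡ᵇ x x refl)

elem⇒∈ : ∀ {n} (x : Vec ℕ n) L → T (elem x L) → x ∈ L
elem⇒∈ x L e = Any.map (eqᵇ⇒≡ x _) (Any.any⁻ (eqᵇ x) L e)

∈⇒elem : ∀ {n} {x : Vec ℕ n} {L} → x ∈ L → T (elem x L)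
∈⇒elem {x = x} x∈L = Any.any⁺ (eqᵇ x) (Any.map (λ { refl → eqᵇ-refl x }) x∈L)

distinct⇒Unique : ∀ {n} (L : List (Vec ℕ n)) → T (distinct L) → Unique L
distinct⇒Unique []      _ = []
distinct⇒Unique (x ∷ L) e =
  let (x∉L , d) = T-∧⁻ e in
  All.tabulate (λ { y∈L refl → subst T (Equivalence.to T-not-≡ x∉L) (∈⇒elem y∈L) }) ∷ distinct⇒Unique L d

mutual
  -- Only positive answers of `member` have to be trusted; a wrong negative one would merely cause
  -- an orbit to be checked again.
  member-insert : ∀ {n} (x y : Vec ℕ n) t → T (member x (insert y t)) → x ≡ y ⊎ T (member x t)
  member-insert []      []      t         _ = inj₁ refl
  member-insert (x ∷ u) (y ∷ v) none      e with memberAt-insertAt x u y v [] e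
  ... | inj₁ eq = inj₁ eq
  member-insert (x ∷ u) (y ∷ v) (node ts) e = memberAt-insertAt x u y v ts e

  memberAt-insertAt : ∀ {n} x (u : Vec ℕ n) y v ts → T (memberAt x u (insertAt y v ts)) →
                      x ∷ u ≡ y ∷ v ⊎ T (memberAt x u ts)
  memberAt-insertAt zero    u zero    v []       e with member-insert u v none e
  ... | inj₁ refl = inj₁ refl
  memberAt-insertAt zero    u zero    v (t ∷ ts) e = Sum.map₁ (cong (0 ∷_)) (member-insert u v t e)
  memberAt-insertAt zero    u (suc y) v (t ∷ ts) e = inj₂ e
  memberAt-insertAt (suc x) u zero    v (t ∷ ts) e = inj₂ e
  memberAt-insertAt (suc x) u (suc y) v []       e with memberAt-insertAt x u y v [] e
  ... | inj₁ refl = inj₁ refl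
  memberAt-insertAt (suc x) u (suc y) v (t ∷ ts) e with memberAt-insertAt x u y v ts e
  ... | inj₁ refl = inj₁ refl
  ... | inj₂ m    = inj₂ m

member-insertAll : ∀ {n} (x : Vec ℕ n) L t → T (member x (foldr insert t L)) → x ∈ L ⊎ T (member x t)
member-insertAll x []      t e = inj₂ e
member-insertAll x (y ∷ L) t e with member-insert x y (foldr insert t L) e
... | inj₁ eq = inj₁ (here eq)
... | inj₂ e′ = Sum.map₁ there (member-insertAll x L t e′)

module LocalSoundness (r : ℕ) (f : Vec ℕ (suc r)) where

  open Local r f

  data Reach (x : State) : State → Set where
    start : Reach x x
    step  : ∀ {y} j → Reach x y → Reach x (act j y)

  visit-All : ∀ {P : State → Set} {y s} → P y → All P (proj₁ s) × All P (proj₂ s) →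
              All P (proj₁ (visit y s)) × All P (proj₂ (visit y s))
  visit-All {y = y} {s} py (ps , qs) with elem y (proj₁ s)
  ... | true  = ps , qs
  ... | false = py ∷ ps , py ∷ qs

  search-All : ∀ {P : State → Set} → (∀ {y} j → P y → P (act j y)) → ∀ fuel s →
               All P (proj₁ s) → All P (proj₂ s) → All P (search fuel s)
  search-All         stable zero       s                     ps qs       = ps
  search-All         stable (suc fuel) (seen , [])           ps qs       = ps
  search-All {P}     stable (suc fuel) (seen , x ∷ frontier) ps (q ∷ qs) =
    let (ps′ , qs′) = expand indices in search-All stable fuel _ ps′ qs′
    where
    expand : ∀ is → let s = foldr (λ j → visit (act j x)) (seen , frontier) is in All P (proj₁ s) × All P (proj₂ s)
    expand []       = ps , qs
    expand (j ∷ is) = visit-All (stable j q) (expand is)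

  orbit-reach : ∀ x → All (Reach x) (orbit x)
  orbit-reach x = search-All step 100 _ (start ∷ []) (start ∷ [])

  Tame : List State → Set
  Tame L = ∀ {x y} j {p q} → x ∈ L → y ∈ L → endsAt _<ᵇ_ close j x ≡ just (p , q) → before p q y ≡ before p q x

  -- This direction is the one required because `schurᵇ` lets several Schur functions pass on the
  -- ground that `tameᵇ` fails.
  tame⇒tameᵇ : ∀ L → Tame L → T (tameᵇ L)
  tame⇒tameᵇ L tame =
    All.all⁻ _ (All.tabulate λ {x} x∈L → All.all⁻ _ (All.tabulate {xs = indices} λ {j} _ → constant j x∈L))
    where
    constant : ∀ {x} j → x ∈ L → T (maybe′ (λ (p , q) → constantᵇ L p q) true (endsAt _<ᵇ_ close j x))
    constant {x} j x∈L with endsAt _<ᵇ_ close j x in eq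
    ... | nothing      = tt
    ... | just (p , q) with before p q x in b
    ... | true  = Equivalence.from T-∨ (inj₁ (All.all⁻ _ (All.tabulate λ y∈L →
                    subst T (sym (trans (tame j x∈L y∈L eq) b)) tt)))
    ... | false = Equivalence.from T-∨ (inj₂ (All.all⁻ _ (All.tabulate λ y∈L →
                    subst (T ∘ not) (sym (trans (tame j x∈L y∈L eq) b)) tt)))

  -- What is remembered of a checked orbit. The field `expansion` holds for every F, so the
  -- coefficients of the Q_D can be put in afterwards, one monomial at a time.
  record Class : Set where
    field
      root       : State
      members    : List State
      root∈      : root ∈ members
      unique     : Unique members
      reachable  : ∀ {x} → x ∈ members → Reach root x
      closed     : ∀ {x} j → x ∈ members → act j x ∈ members
      involutive : ∀ {x} j → x ∈ members → act j (act j x) ≡ x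
      schurs     : List (ℕ × Shape (3 + r))
      expansion  : ∀ F → ∑ (map (descents _<ᵇ_) members) F ≡ ∑ schurs (λ (c , σ) → c * ∑ (tableaux σ) F)
      tame⇒schur : r ≡ 0 ⊎ Tame members → ∃[ σ ] schurs ≡ (1 , σ) ∷ []

  open Class

  table = map entry (shapes r)

  expand-table : ∀ F (cs : List (ℕ × Entry (2 + r))) → All (λ (_ , e) → e ∈ table) cs →
                 ∑ cs (λ (c , _ , _ , t) → c * mass F t) ≡
                 ∑ (map (λ (c , σ , _) → c , σ) cs) (λ (c , σ) → c * ∑ (tableaux σ) F)
  expand-table F []       []         = refl
  expand-table F ((c , e) ∷ cs) (e∈ ∷ es) with ∈-map⁻ entry e∈
  ... | σ , _ , refl = cong₂ _+_ (cong (c *_) (mass-tally F (tableaux σ))) (expand-table F cs es)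

  class : ∀ x → T (elem x (orbit x)) → T (classᵇ table (orbit x)) → Σ[ C ∈ Class ] members C ≡ orbit x
  class x x∈ c = record
    { root       = x
    ; members    = L
    ; root∈      = elem⇒∈ x L x∈
    ; unique     = distinct⇒Unique L apart
    ; reachable  = All.lookup (orbit-reach x)
    ; closed     = λ j y∈L → elem⇒∈ _ L (proj₁ (closed′ j y∈L))
    ; involutive = λ j y∈L → eqᵇ⇒≡ _ _ (proj₂ (closed′ j y∈L))
    ; schurs     = map (λ (c , σ , _) → c , σ) cs
    ; expansion  = λ F → trans (sym (mass-tally F Ds))
                         (trans (cong (mass F) (sameᵇ⇒≡ (tally Ds) (combination cs) same))
                         (trans (mass-combination F cs)
                                (expand-table F cs (greedy-entries table (tally Ds)))))
    -- The check established `singleᵇ` or the failure of both conditions; the hypothesis rules out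
    -- the latter.
    ; tame⇒schur = λ tame → single cs ([ id , (λ ¬tame → contradiction′ ¬tame (Equivalence.from T-∨ (Sum.map (ℕ.≡⇒≡ᵇ r 0) (tame⇒tameᵇ L) tame))) ]′ (Equivalence.to T-∨ s))
    } , refl
    where
    L Ds : List _
    L  = orbit x
    Ds = map (descents _<ᵇ_) L
    cs = greedy table (tally Ds)
    cl = proj₁ (T-∧⁻ c)
    apart = proj₁ (T-∧⁻ (proj₂ (T-∧⁻ {closedᵇ L} c)))
    ex : T (sameᵇ (tally Ds) (combination cs)) × T (singleᵇ cs ∨ not ((r ≡ᵇ 0) ∨ tameᵇ L))
    ex = T-∧⁻ (proj₂ (T-∧⁻ {distinct L} (proj₂ (T-∧⁻ {closedᵇ L} c))))
    same = proj₁ ex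
    s    = proj₂ ex
    closed′ : ∀ {y} j → y ∈ L → T (elem (act j y) L) × T (eqᵇ (act j (act j y)) y)
    closed′ j y∈L = T-∧⁻ (All.lookup (All.all⁺ _ indices (All.lookup (All.all⁺ _ L cl) y∈L)) (∈-allFin j))
    contradiction′ : ∀ {b} {A : Set} → T (not b) → T b → A
    contradiction′ {false} _ ()
    single : ∀ (cs : List (ℕ × Entry (2 + r))) → T (singleᵇ cs) →
             ∃[ σ ] map (λ (c , σ , _) → c , σ) cs ≡ (1 , σ) ∷ []
    single ((c , σ , _) ∷ []) e = σ , cong (λ c → (c , σ) ∷ []) (ℕ.≡ᵇ⇒≡ c 1 e)

  Good : State → Set
  Good x = Σ[ C ∈ Class ] x ∈ members C

  -- The invariant is that every state in the trie lies in a checked class. Inserting the orbit of p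
  -- preserves it, since the class of p serves all its members.
  cover-sound : ∀ ps t → (∀ x → T (member x t) → Good x) → T (cover table ps t) → All Good ps
  cover-sound []       t good c = []
  cover-sound (p ∷ ps) t good c with member p t in eq
  ... | true  = good p (subst T (sym eq) tt) ∷ cover-sound ps t good c
  ... | false = (C , subst (p ∈_) (sym C≡) (elem⇒∈ p (orbit p) p∈)) ∷ cover-sound ps _ good′ rest
    where
    p∈   = proj₁ (T-∧⁻ c)
    cls  = proj₁ (T-∧⁻ {classᵇ table (orbit p)} (proj₂ (T-∧⁻ {elem p (orbit p)} c)))
    rest = proj₂ (T-∧⁻ {classᵇ table (orbit p)} (proj₂ (T-∧⁻ {elem p (orbit p)} c)))
    C    = proj₁ (class p p∈ cls)
    C≡   = proj₂ (class p p∈ cls)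
    good′ : ∀ x → T (member x (foldr insert t (orbit p))) → Good x
    good′ x e = [ (λ x∈ → C , subst (x ∈_) (sym C≡) x∈) , good x ]′ (member-insertAll x (orbit p) t e)

Far : ∀ {l} → ℕ → ℕ → ℕ → Vec ℕ l → Set
Far m p lo []      = ⊤
Far m p lo (x ∷ v) = lo ≤ x × p < x × x < m × Far m (suc p) x v

∈-farVectors : ∀ m {l} p lo (v : Vec ℕ l) → Far m p lo v → v ∈ farVectors m l p lo
∈-farVectors m p lo []      _                       = here refl
∈-farVectors m p lo (x ∷ v) (lo≤x , p<x , x<m , far) =
  ∈-concatMap⁺ (λ v → map (v ∷_) (farVectors m _ (suc p) v))
    (Any.map (λ { refl → ∈-map⁺ (x ∷_) (∈-farVectors m (suc p) x v far) })
      (subst (_∈ map (λ d → d + (lo ⊔ suc p)) (List.upTo (m ∸ (lo ⊔ suc p)))) (ℕ.m∸n+n≡m b≤x)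
        (∈-map⁺ (λ d → d + (lo ⊔ suc p)) (∈-upTo⁺ (ℕ.∸-monoˡ-< x<m b≤x)))))
  where
  b≤x : lo ⊔ suc p ≤ x
  b≤x = ℕ.⊔-lub lo≤x p<x

check-sound : ∀ r → checkAll r ≡ true → ∀ {f} → Far (3 + r) 0 0 f →
              ∀ {π} → π ∈ perms (Vec.allFin (3 + r)) → LocalSoundness.Good r f (inverse π)
check-sound r ok {f} far π∈ =
  All.lookup (cover-sound _ none (λ _ ())
    (All.lookup (All.all⁺ _ (farVectors (3 + r) (suc r) 0 0) (Equivalence.from T-≡ ok)) (∈-farVectors (3 + r) 0 0 f far)))
    (∈-map⁺ inverse π∈)
  where open LocalSoundness r f

-- Permutations sorted by a strict total order

-- The Iverson bracket. Existence and uniqueness of a sorted permutation become one equation, a sum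
-- of brackets equal to 1.
⟦_⟧ : ∀ {P : Set} → Dec P → ℕ
⟦ P? ⟧ = if does P? then 1 else 0

⟦⟧-× : ∀ {P R : Set} (P? : Dec P) (R? : Dec R) → ⟦ P? ×-dec R? ⟧ ≡ ⟦ P? ⟧ * ⟦ R? ⟧
⟦⟧-× (yes _) R? = sym (ℕ.+-identityʳ _)
⟦⟧-× (no _)  R? = refl

⟦⟧-⇔ : ∀ {P R : Set} (P? : Dec P) (R? : Dec R) → P ⇔ R → ⟦ P? ⟧ ≡ ⟦ R? ⟧
⟦⟧-⇔ (yes p) (yes r) eq = refl
⟦⟧-⇔ (yes p) (no ¬r) eq = contradiction (Equivalence.to eq p) ¬r
⟦⟧-⇔ (no ¬p) (yes r) eq = contradiction (Equivalence.from eq r) ¬p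
⟦⟧-⇔ (no ¬p) (no ¬r) eq = refl

module _ {A : Set} where

  ∑-cong-∈ : ∀ (xs : List A) {f g : A → ℕ} → (∀ {x} → x ∈ xs → f x ≡ g x) → ∑ xs f ≡ ∑ xs g
  ∑-cong-∈ []       eq = refl
  ∑-cong-∈ (x ∷ xs) eq = cong₂ _+_ (eq (here refl)) (∑-cong-∈ xs (eq ∘ there))

  ∑-cong : ∀ (xs : List A) {f g : A → ℕ} → (∀ x → f x ≡ g x) → ∑ xs f ≡ ∑ xs g
  ∑-cong xs eq = ∑-cong-∈ xs (λ {x} _ → eq x)

  ∑-0 : ∀ (xs : List A) → ∑ xs (λ _ → 0) ≡ 0
  ∑-0 []       = refl
  ∑-0 (x ∷ xs) = ∑-0 xs

  ∑-+ : ∀ (xs : List A) f g → ∑ xs (λ x → f x + g x) ≡ ∑ xs f + ∑ xs g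
  ∑-+ []       f g = refl
  ∑-+ (x ∷ xs) f g = trans (cong (_+_ (f x + g x)) (∑-+ xs f g)) (interchange ℕ.+-commutativeSemigroup (f x) (g x) _ _)

  ∑-*ˡ : ∀ (xs : List A) c f → ∑ xs (λ x → c * f x) ≡ c * ∑ xs f
  ∑-*ˡ []       c f = sym (ℕ.*-zeroʳ c)
  ∑-*ˡ (x ∷ xs) c f = trans (cong (_+_ (c * f x)) (∑-*ˡ xs c f)) (sym (ℕ.*-distribˡ-+ c (f x) _))

  ∑-↭ : ∀ {xs ys : List A} (f : A → ℕ) → xs ↭ ys → ∑ xs f ≡ ∑ ys f
  ∑-↭ f p = sum-↭ (map⁺ f p)

  length-filter : ∀ {P : A → Set} (P? : Decidable P) xs → length (filter P? xs) ≡ ∑ xs (λ x → ⟦ P? x ⟧)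
  length-filter P? []       = refl
  length-filter P? (x ∷ xs) with does (P? x)
  ... | true  = cong suc (length-filter P? xs)
  ... | false = length-filter P? xs

  ∑-filter : ∀ {P : A → Set} (P? : Decidable P) xs f → ∑ (filter P? xs) f ≡ ∑ xs (λ x → ⟦ P? x ⟧ * f x)
  ∑-filter P? []       f = refl
  ∑-filter P? (x ∷ xs) f with does (P? x)
  ... | true  = cong₂ _+_ (sym (ℕ.+-identityʳ (f x))) (∑-filter P? xs f)
  ... | false = ∑-filter P? xs f

module _ {A B : Set} where

  ∑-map : ∀ (g : A → B) xs f → ∑ (map g xs) f ≡ ∑ xs (f ∘ g)
  ∑-map g xs f = cong sum (sym (List.map-∘ xs))

  ∑-concatMap : ∀ (g : A → List B) xs f → ∑ (concatMap g xs) f ≡ ∑ xs (λ x → ∑ (g x) f)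
  ∑-concatMap g []       f = refl
  ∑-concatMap g (x ∷ xs) f =
    trans (cong sum (List.map-++ f (g x) _))
    (trans (sum-++ (map f (g x)) _) (cong (_+_ (∑ (g x) f)) (∑-concatMap g xs f)))

  ∑-swap : ∀ (xs : List A) (ys : List B) (f : A → B → ℕ) →
           ∑ xs (λ x → ∑ ys (f x)) ≡ ∑ ys (λ y → ∑ xs (λ x → f x y))
  ∑-swap []       ys f = sym (∑-0 ys)
  ∑-swap (x ∷ xs) ys f = trans (cong (_+_ (∑ ys (f x))) (∑-swap xs ys f)) (sym (∑-+ ys (f x) _))

module _ {A : Set} where

  data Insertion (x : A) : ∀ {n} → Vec A n → Vec A (suc n) → Set where
    here  : ∀ {n} {v : Vec A n} → Insertion x v (x ∷ v)
    there : ∀ {n} {v : Vec A n} {y u} → Insertion x v u → Insertion x (y ∷ v) (y ∷ u)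

  data Permutation : ∀ {n} → Vec A n → Vec A n → Set where
    []  : Permutation [] []
    _∷_ : ∀ {n x} {u v : Vec A n} {w} → Insertion x v w → Permutation u v → Permutation (x ∷ u) w

  ∈-insertions⁻ : ∀ {n x} (v : Vec A n) {u} → u ∈ insertions x v → Insertion x v u
  ∈-insertions⁻ []      (here refl) = here
  ∈-insertions⁻ (y ∷ v) (here refl) = here
  ∈-insertions⁻ (y ∷ v) (there u∈)  with ∈-map⁻ (y ∷_) u∈
  ... | _ , u∈′ , refl = there (∈-insertions⁻ v u∈′)

  ∈-perms⁻ : ∀ {n} (v : Vec A n) {π} → π ∈ perms v → Permutation v π
  ∈-perms⁻ []      (here refl) = []
  ∈-perms⁻ (x ∷ v) π∈ with find (∈-concatMap⁻ (insertions x) {xs = perms v} π∈)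
  ... | u , u∈ , π∈′ = ∈-insertions⁻ u π∈′ ∷ ∈-perms⁻ v u∈

  insertion-All : ∀ {P : A → Set} {n x} {v : Vec A n} {u} → Insertion x v u → P x → VecAll.All P v → VecAll.All P u
  insertion-All here        px pv        = px ∷ pv
  insertion-All (there ins) px (py ∷ pv) = py ∷ insertion-All ins px pv

  insertion-count : ∀ {P : A → Set} (P? : Decidable P) {n x} {v : Vec A n} {u} → Insertion x v u →
                    Vec.count P? u ≡ Vec.count P? (x ∷ v)
  insertion-count P? here                      = refl
  insertion-count P? {x = x} (there {y = y} ins) with does (P? y) | does (P? x) | insertion-count P? ins
  ... | true  | true  | eq = cong suc eq
  ... | true  | false | eq = cong suc eq
  ... | false | true  | eq = eq
  ... | false | false | eq = eq

  permutation-All : ∀ {P : A → Set} {n} {v π : Vec A n} → Permutation v π → VecAll.All P v → VecAll.All P π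
  permutation-All []        []               = []
  permutation-All (ins ∷ p) (px ∷ pv) = insertion-All ins px (permutation-All p pv)

  insertion-AllPairs : ∀ {R : A → A → Set} → (∀ {x y} → R x y → R y x) → ∀ {n x} {v : Vec A n} {u} →
                       Insertion x v u → VecAll.All (R x) v → VecPairs.AllPairs R v → VecPairs.AllPairs R u
  insertion-AllPairs sym here        rx        rv        = rx ∷ rv
  insertion-AllPairs sym (there ins) (rxy ∷ rx) (ry ∷ rv) =
    insertion-All ins (sym rxy) ry ∷ insertion-AllPairs sym ins rx rv

  permutation-Unique : ∀ {n} {v π : Vec A n} → Permutation v π → VecUnique.Unique v → VecUnique.Unique π
  permutation-Unique []        []        = []
  permutation-Unique (ins ∷ p) (x∉ ∷ uv) =
    insertion-AllPairs (λ x≢y → x≢y ∘ sym) ins (permutation-All p x∉) (permutation-Unique p uv)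

  insertion-∈ : ∀ {n x} {v : Vec A n} {u} → Insertion x v u → ∀ {y} → y VecMem.∈ (x ∷ v) → y VecMem.∈ u
  insertion-∈ here        y∈                               = y∈
  insertion-∈ (there ins) (VecAny.here eq)                 = VecAny.there (insertion-∈ ins (VecAny.here eq))
  insertion-∈ (there ins) (VecAny.there (VecAny.here eq))  = VecAny.here eq
  insertion-∈ (there ins) (VecAny.there (VecAny.there y∈)) = VecAny.there (insertion-∈ ins (VecAny.there y∈))

  permutation-∈ : ∀ {n} {v π : Vec A n} → Permutation v π → ∀ {y} → y VecMem.∈ v → y VecMem.∈ π
  permutation-∈ (ins ∷ p) (VecAny.here eq)  = insertion-∈ ins (VecAny.here eq)
  permutation-∈ (ins ∷ p) (VecAny.there y∈) = insertion-∈ ins (VecAny.there (permutation-∈ p y∈))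

  permutation-count : ∀ {P : A → Set} (P? : Decidable P) {n} {v π : Vec A n} → Permutation v π →
                      Vec.count P? π ≡ Vec.count P? v
  permutation-count P? []        = refl
  permutation-count P? {v = x ∷ v} (_∷_ {v = u} ins p) =
    trans (insertion-count P? ins) (cong (if does (P? x) then suc else id) (permutation-count P? p))

  Linked⇒AllPairs : ∀ {R : A → A → Set} → (∀ {x y z} → R x y → R y z → R x z) →
                    ∀ {n} {v : Vec A n} → VecLinked.Linked R v → VecPairs.AllPairs R v
  Linked⇒AllPairs tr []        = []
  Linked⇒AllPairs tr [-]       = [] ∷ []
  Linked⇒AllPairs {R} tr {v = x ∷ y ∷ v} (rxy ∷ l) with Linked⇒AllPairs tr l
  ... | ry ∷ rv = (rxy ∷ VecAll.map (tr rxy) ry) ∷ ry ∷ rv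

  AllPairs-total : ∀ {R : A → A → Set} {n} {v : Vec A n} → VecPairs.AllPairs R v →
                   ∀ {x y} → x VecMem.∈ v → y VecMem.∈ v → x ≢ y → R x y ⊎ R y x
  AllPairs-total (r ∷ rs) (VecAny.here refl) (VecAny.here refl) x≢y = contradiction refl x≢y
  AllPairs-total (r ∷ rs) (VecAny.here refl) (VecAny.there y∈)  x≢y = inj₁ (VecAll.lookup r y∈)
  AllPairs-total (r ∷ rs) (VecAny.there x∈)  (VecAny.here refl) x≢y = inj₂ (VecAll.lookup r x∈)
  AllPairs-total (r ∷ rs) (VecAny.there x∈)  (VecAny.there y∈)  x≢y = AllPairs-total rs x∈ y∈ x≢y

module Sorting {A : Set} {_≺_ : A → A → Set} (_≺?_ : ∀ x y → Dec (x ≺ y))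
  (≺-trans : ∀ {x y z} → x ≺ y → y ≺ z → x ≺ z) (≺-asym : ∀ {x y} → x ≺ y → ¬ y ≺ x)
  (≺-total : ∀ {x y} → x ≢ y → x ≺ y ⊎ y ≺ x) where

  sorted : ∀ {n} → Vec A n → ℕ
  sorted v = ⟦ linked? _≺?_ v ⟧

  sorted-∷ : ∀ {n} x y (v : Vec A n) → sorted (x ∷ y ∷ v) ≡ ⟦ x ≺? y ⟧ * sorted (y ∷ v)
  sorted-∷ x y v = ⟦⟧-× (x ≺? y) (linked? _≺?_ (y ∷ v))

  either : ∀ {x y} → x ≢ y → ⟦ x ≺? y ⟧ + ⟦ y ≺? x ⟧ ≡ 1
  either {x} {y} x≢y with x ≺? y | y ≺? x
  ... | yes x≺y | yes y≺x = contradiction y≺x (≺-asym x≺y)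
  ... | yes _   | no _    = refl
  ... | no _    | yes _   = refl
  ... | no x⊀y  | no y⊀x  = contradiction (≺-total x≢y) [ x⊀y , y⊀x ]′

  -- The summands place x directly after y and somewhere after z. Just one of x ≺ z and z ≺ x holds,
  -- and transitivity then yields the comparison that its summand lacks: y ≺ z in the first case, y
  -- ≺ x in the second.
  between : ∀ x y z → x ≢ z →
            ⟦ y ≺? x ⟧ * ⟦ x ≺? z ⟧ + ⟦ y ≺? z ⟧ * ⟦ z ≺? x ⟧ ≡ ⟦ y ≺? x ⟧ * ⟦ y ≺? z ⟧
  between x y z x≢z with x ≺? z | z ≺? x | y ≺? x | y ≺? z
  ... | yes x≺z | yes z≺x | _       | _       = contradiction z≺x (≺-asym x≺z)
  ... | no x⊀z  | no z⊀x  | _       | _       = contradiction (≺-total x≢z) [ x⊀z , z⊀x ]′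
  ... | yes x≺z | no _    | yes y≺x | no y⊀z  = contradiction (≺-trans y≺x x≺z) y⊀z
  ... | yes x≺z | no _    | yes y≺x | yes _   = refl
  ... | yes x≺z | no _    | no _    | yes _   = refl
  ... | yes x≺z | no _    | no _    | no _    = refl
  ... | no _    | yes z≺x | no y⊀x  | yes y≺z = contradiction (≺-trans y≺z z≺x) y⊀x
  ... | no _    | yes z≺x | yes _   | yes _   = refl
  ... | no _    | yes z≺x | yes _   | no _    = refl
  ... | no _    | yes z≺x | no _    | no _    = refl

  -- The letter y is carried along because whether an insertion keeps the list sorted depends on the
  -- letter in front of it.
  insertions-after : ∀ {n} x y (v : Vec A n) → VecAll.All (x ≢_) v →
                     ∑ (insertions x v) (λ u → sorted (y ∷ u)) ≡ ⟦ y ≺? x ⟧ * sorted (y ∷ v)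
  insertions-after x y []      _           = trans (ℕ.+-identityʳ _) (sorted-∷ y x [])
  insertions-after x y (z ∷ v) (x≢z ∷ x∉v) = begin
    sorted (y ∷ x ∷ z ∷ v) + ∑ (map (z ∷_) (insertions x v)) (λ u → sorted (y ∷ u))
      ≡⟨ cong₂ _+_ (trans (sorted-∷ y x (z ∷ v)) (cong (⟦ y ≺? x ⟧ *_) (sorted-∷ x z v)))
           (trans (∑-map (z ∷_) (insertions x v) _) (∑-cong (insertions x v) (sorted-∷ y z))) ⟩
    ⟦ y ≺? x ⟧ * (⟦ x ≺? z ⟧ * S) + ∑ (insertions x v) (λ u → ⟦ y ≺? z ⟧ * sorted (z ∷ u))
      ≡⟨ cong₂ _+_ (sym (ℕ.*-assoc ⟦ y ≺? x ⟧ _ S))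
           (trans (∑-*ˡ (insertions x v) ⟦ y ≺? z ⟧ _)
           (trans (cong (⟦ y ≺? z ⟧ *_) (insertions-after x z v x∉v)) (sym (ℕ.*-assoc ⟦ y ≺? z ⟧ _ S)))) ⟩
    ⟦ y ≺? x ⟧ * ⟦ x ≺? z ⟧ * S + ⟦ y ≺? z ⟧ * ⟦ z ≺? x ⟧ * S
      ≡⟨ sym (ℕ.*-distribʳ-+ S (⟦ y ≺? x ⟧ * ⟦ x ≺? z ⟧) _) ⟩
    (⟦ y ≺? x ⟧ * ⟦ x ≺? z ⟧ + ⟦ y ≺? z ⟧ * ⟦ z ≺? x ⟧) * S
      ≡⟨ cong (_* S) (between x y z x≢z) ⟩
    ⟦ y ≺? x ⟧ * ⟦ y ≺? z ⟧ * S
      ≡⟨ trans (ℕ.*-assoc ⟦ y ≺? x ⟧ _ S) (cong (⟦ y ≺? x ⟧ *_) (sym (sorted-∷ y z v))) ⟩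
    ⟦ y ≺? x ⟧ * sorted (y ∷ z ∷ v) ∎
    where
    open ≡-Reasoning
    S = sorted (z ∷ v)

  insertions-sorted : ∀ {n} x (v : Vec A n) → VecAll.All (x ≢_) v → ∑ (insertions x v) sorted ≡ sorted v
  insertions-sorted x []      _           = refl
  insertions-sorted x (z ∷ v) (x≢z ∷ x∉v) = begin
    sorted (x ∷ z ∷ v) + ∑ (map (z ∷_) (insertions x v)) sorted
      ≡⟨ cong₂ _+_ (sorted-∷ x z v) (trans (∑-map (z ∷_) (insertions x v) sorted) (insertions-after x z v x∉v)) ⟩
    ⟦ x ≺? z ⟧ * S + ⟦ z ≺? x ⟧ * S   ≡⟨ sym (ℕ.*-distribʳ-+ S ⟦ x ≺? z ⟧ _) ⟩
    (⟦ x ≺? z ⟧ + ⟦ z ≺? x ⟧) * S     ≡⟨ cong (_* S) (either x≢z) ⟩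
    1 * S                             ≡⟨ ℕ.*-identityˡ S ⟩
    S                                 ∎
    where
    open ≡-Reasoning
    S = sorted (z ∷ v)

  perms-sorted : ∀ {n} (v : Vec A n) → VecUnique.Unique v → ∑ (perms v) sorted ≡ 1
  perms-sorted []      _         = refl
  perms-sorted (x ∷ v) (x∉v ∷ u) =
    trans (∑-concatMap (insertions x) (perms v) sorted)
    (trans (∑-cong-∈ (perms v) (λ {π} π∈ → insertions-sorted x π (permutation-All (∈-perms⁻ v π∈) x∉v)))
           (perms-sorted v u))

  -- A sum of brackets equal to 1 has a nonzero term.
  ∃-sorted : ∀ {n} (v : Vec A n) → VecUnique.Unique v → ∃[ π ] π ∈ perms v × VecLinked.Linked _≺_ π
  ∃-sorted v u = search (perms v) (ℕ.≤-reflexive (sym (perms-sorted v u)))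
    where
    search : ∀ L → 0 < ∑ L sorted → ∃[ π ] π ∈ L × VecLinked.Linked _≺_ π
    search (π ∷ L) pos with linked? _≺?_ π
    ... | yes l = π , here refl , l
    ... | no _  = let (π′ , π∈ , l) = search L pos in π′ , there π∈ , l

-- Schur functions in the fundamental basis

lookup-extensional : ∀ {A : Set} {n} {u v : Vec A n} → (∀ i → lookup u i ≡ lookup v i) → u ≡ v
lookup-extensional {u = u} {v} eq =
  trans (sym (Vec.tabulate∘lookup u)) (trans (Vec.tabulate-cong eq) (Vec.tabulate∘lookup v))

∈-words : ∀ {N m} (w : Vec (Fin N) m) → w ∈ words N m
∈-words []      = here refl
∈-words (x ∷ w) = ∈-cartesianProductWith⁺ _∷_ (∈-allFin x) (∈-words w)

words-unique : ∀ N m → Unique (words N m)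
words-unique N zero    = [] ∷ []
words-unique N (suc m) = Unique.cartesianProductWith⁺ _∷_ Vec.∷-injective (Unique.allFin⁺ N) (words-unique N m)

allFin-unique : ∀ n → VecUnique.Unique (Vec.allFin n)
allFin-unique n = VecUnique.tabulate⁺ id

count-map : ∀ {A B : Set} {P : B → Set} (P? : ∀ x → Dec (P x)) (f : A → B) {n} (v : Vec A n) →
            Vec.count P? (Vec.map f v) ≡ Vec.count (λ x → P? (f x)) v
count-map P? f []      = refl
count-map P? f (x ∷ v) = cong (if does (P? (f x)) then suc else id) (count-map P? f v)

-- Composition with π permutes the words of length m and keeps their exponents: it is the change of
-- summation variable that turns words sorted by π into compatible words.
module Reorder {m} {π : Vec (Fin m) m} (perm : Permutation (Vec.allFin m) π) where

  reorder : ∀ {A : Set} → Vec A m → Vec A m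
  reorder w = Vec.map (lookup w) π

  π-unique : VecUnique.Unique π
  π-unique = permutation-Unique perm (allFin-unique m)

  ∈π : ∀ e → e VecMem.∈ π
  ∈π e = permutation-∈ perm (VecMem.∈-allFin⁺ e)

  index : Fin m → Fin m
  index e = VecAny.index (∈π e)

  π-index : ∀ e → lookup π (index e) ≡ e
  π-index e = sym (VecAny.lookup-index (∈π e))

  index-π : ∀ j → index (lookup π j) ≡ j
  index-π j = VecUnique.lookup-injective π-unique _ _ (π-index (lookup π j))

  reorder-injective : ∀ {A : Set} {u v : Vec A m} → reorder u ≡ reorder v → u ≡ v
  reorder-injective {u = u} {v} eq = lookup-extensional λ e → begin
    lookup u e                        ≡⟨ cong (lookup u) (sym (π-index e)) ⟩
    lookup u (lookup π (index e))     ≡⟨ sym (Vec.lookup-map (index e) (lookup u) π) ⟩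
    lookup (reorder u) (index e)      ≡⟨ cong (λ w → lookup w (index e)) eq ⟩
    lookup (reorder v) (index e)      ≡⟨ Vec.lookup-map (index e) (lookup v) π ⟩
    lookup v (lookup π (index e))     ≡⟨ cong (lookup v) (π-index e) ⟩
    lookup v e                        ∎
    where open ≡-Reasoning

  reorder-surjective : ∀ {A : Set} (u : Vec A m) → reorder (Vec.tabulate (lookup u ∘ index)) ≡ u
  reorder-surjective u = lookup-extensional λ j →
    trans (Vec.lookup-map j _ π)
    (trans (Vec.lookup∘tabulate (lookup u ∘ index) (lookup π j)) (cong (lookup u) (index-π j)))

  reorder-words : ∀ N → map reorder (words N m) ↭ words N m
  reorder-words N = ∼bag⇒↭ (unique∧set⇒bag
    (Unique.map⁺ reorder-injective (words-unique N m)) (words-unique N m)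
    (λ {u} → mk⇔ (λ _ → ∈-words u)
         (λ _ → subst (_∈ map reorder (words N m)) (reorder-surjective u) (∈-map⁺ reorder (∈-words (Vec.tabulate (lookup u ∘ index)))))))

  exponents-reorder : ∀ {N} (w : Vec (Fin N) m) → exponents (reorder w) ≡ exponents w
  exponents-reorder w = Vec.tabulate-cong λ v → begin
    Vec.count (v Fin.≟_) (Vec.map (lookup w) π)                ≡⟨ count-map (v Fin.≟_) (lookup w) π ⟩
    Vec.count (λ e → v Fin.≟ lookup w e) π                     ≡⟨ permutation-count _ perm ⟩
    Vec.count (λ e → v Fin.≟ lookup w e) (Vec.allFin m)        ≡⟨ sym (count-map (v Fin.≟_) (lookup w) (Vec.allFin m)) ⟩
    Vec.count (v Fin.≟_) (Vec.map (lookup w) (Vec.allFin m))   ≡⟨ cong (Vec.count (v Fin.≟_)) (Vec.map-lookup-allFin w) ⟩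
    Vec.count (v Fin.≟_) w                                     ∎
    where open ≡-Reasoning

monomial : ∀ {N m} → Vec (Fin N) m → Vec ℕ N → ℕ
monomial w α = ⟦ Vec.≡-dec ℕ._≟_ (exponents w) α ⟧

generating-∑ : ∀ m (P : ∀ {N} → Vec (Fin N) m → Set) (P? : ∀ {N} (w : Vec (Fin N) m) → Dec (P w)) {N} (α : Vec ℕ N) →
               generating m P P? α ≡ ∑ (words N m) (λ w → ⟦ P? w ⟧ * monomial w α)
generating-∑ m P P? {N} α =
  trans (length-filter (λ w → P? w ×-dec Vec.≡-dec ℕ._≟_ (exponents w) α) (words N m))
        (∑-cong (words N m) λ w → ⟦⟧-× (P? w) (Vec.≡-dec ℕ._≟_ (exponents w) α))

module Compatible {X : Set} {_◁_ : X → X → Set} (_◁?_ : ∀ x y → Dec (x ◁ y))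
  (◁-asym : ∀ {x y} → x ◁ y → ¬ y ◁ x) (◁-total : ∀ {x y} → x ≢ y → x ◁ y ⊎ y ◁ x)
  {N : ℕ} (val : X → Fin N) where

  _≺_ : X → X → Set
  x ≺ y = val x Fin.< val y ⊎ (val x ≡ val y × x ◁ y)

  _≺?_ : ∀ x y → Dec (x ≺ y)
  x ≺? y = (val x Fin.<? val y) ⊎-dec ((val x Fin.≟ val y) ×-dec (x ◁? y))

  desc : ∀ {n} → Vec X n → Subset (n ∸ 1)
  desc = descentsOf (λ x y → does (x ◁? y))

  ≺⇒ : ∀ {x y} → x ≺ y → val x Fin.≤ val y × (does (y ◁? x) ≡ true → val x Fin.< val y)
  ≺⇒ (inj₁ x<y) = ℕ.<⇒≤ x<y , λ _ → x<y
  ≺⇒ {x} {y} (inj₂ (x≡y , x◁y)) = ℕ.≤-reflexive (cong toℕ x≡y) , strict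
    where
    strict : does (y ◁? x) ≡ true → val x Fin.< val y
    strict eq with y ◁? x
    ... | yes y◁x = contradiction y◁x (◁-asym x◁y)

  ≺⇐ : ∀ {x y} → x ≢ y → val x Fin.≤ val y → (does (y ◁? x) ≡ true → val x Fin.< val y) → x ≺ y
  ≺⇐ {x} {y} x≢y x≤y strict with y ◁? x
  ... | yes _   = inj₁ (strict refl)
  ... | no ¬y◁x with val x Fin.≟ val y
  ... | yes x≡y = inj₂ (x≡y , [ id , (λ y◁x → contradiction y◁x ¬y◁x) ]′ (◁-total x≢y))
  ... | no x≢y′ = inj₁ (Fin.≤∧≢⇒< x≤y x≢y′)

  -- Compatibility and sortedness agree pair by pair: a tie between neighbours is allowed exactly
  -- when ◁ puts the first before the second, that is, away from the descents.
  compatible⇒linked : ∀ {n} (v : Vec X n) → VecUnique.Unique v → IsCompatible n (desc v) (Vec.map val v) → VecLinked.Linked _≺_ v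
  compatible⇒linked []          _                 c = []
  compatible⇒linked (x ∷ [])    _                 c = [-]
  compatible⇒linked (x ∷ y ∷ v) ((x≢y ∷ _) ∷ uv) c =
    ≺⇐ x≢y (proj₁ (c zero)) (λ eq → proj₂ (c zero) (subst (λ b → zero ∈ˢ (b ∷ desc (y ∷ v))) (sym eq) here))
    ∷ compatible⇒linked (y ∷ v) uv (λ j → proj₁ (c (suc j)) , proj₂ (c (suc j)) ∘ there)

  linked⇒compatible : ∀ {n} (v : Vec X n) → VecLinked.Linked _≺_ v → IsCompatible n (desc v) (Vec.map val v)
  linked⇒compatible (x ∷ y ∷ v) (x≺y ∷ l) zero    =
    proj₁ (≺⇒ x≺y) , λ zero∈ → proj₂ (≺⇒ x≺y) (Vec.[]=⇒lookup zero∈)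
  linked⇒compatible (x ∷ y ∷ v) (x≺y ∷ l) (suc j) =
    let (≤ , <) = linked⇒compatible (y ∷ v) l j in ≤ , λ { (there j∈) → < j∈ }

  module _ (◁-trans : ∀ {x y z} → x ◁ y → y ◁ z → x ◁ z) where

    ≺-trans : ∀ {x y z} → x ≺ y → y ≺ z → x ≺ z
    ≺-trans (inj₁ x<y)         (inj₁ y<z)         = inj₁ (ℕ.<-trans x<y y<z)
    ≺-trans {x} (inj₁ x<y)         (inj₂ (y≡z , _))   = inj₁ (subst (val x Fin.<_) y≡z x<y)
    ≺-trans {z = z} (inj₂ (x≡y , _))   (inj₁ y<z)     = inj₁ (subst (Fin._< val z) (sym x≡y) y<z)
    ≺-trans (inj₂ (x≡y , x◁y)) (inj₂ (y≡z , y◁z)) = inj₂ (trans x≡y y≡z , ◁-trans x◁y y◁z)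

    ≺-asym : ∀ {x y} → x ≺ y → ¬ y ≺ x
    ≺-asym (inj₁ x<y)         (inj₁ y<x)         = ℕ.<-asym x<y y<x
    ≺-asym (inj₁ x<y)         (inj₂ (y≡x , _))   = ℕ.<-irrefl (cong toℕ (sym y≡x)) x<y
    ≺-asym (inj₂ (x≡y , _))   (inj₁ y<x)         = ℕ.<-irrefl (cong toℕ (sym x≡y)) y<x
    ≺-asym (inj₂ (_ , x◁y))   (inj₂ (_ , y◁x))   = ◁-asym x◁y y◁x

    ≺-total : ∀ {x y} → x ≢ y → x ≺ y ⊎ y ≺ x
    ≺-total {x} {y} x≢y with Fin.<-cmp (val x) (val y)
    ... | tri< x<y _ _ = inj₁ (inj₁ x<y)
    ... | tri> _ _ y<x = inj₂ (inj₁ y<x)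
    ... | tri≈ _ x≡y _ = Sum.map (λ x◁y → inj₂ (x≡y , x◁y)) (λ y◁x → inj₂ (sym x≡y , y◁x)) (◁-total x≢y)

diagram-unique : ∀ ν → Unique (diagram ν)
diagram-unique ν = Unique.concat⁺
  (All.map⁺ (All.universal (λ b → Unique.map⁺ (λ { refl → refl }) (Unique.upTo⁺ (part ν b))) _))
  (AllPairs.map⁺ (AllPairs.map disjoint (Unique.upTo⁺ (length (parts ν)))))
  where
  disjoint : ∀ {b b′} → b ≢ b′ → ∀ {x} → ¬ (x ∈ map (_, b) (upTo (part ν b)) × x ∈ map (_, b′) (upTo (part ν b′)))
  disjoint b≢b′ (x∈ , x∈′) with ∈-map⁻ _ x∈ | ∈-map⁻ _ x∈′
  ... | _ , _ , refl | _ , _ , eq = b≢b′ (proj₂ (,-injective eq))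

module SchurExpansion (ν : Partition) where

  private
    m = length (diagram ν)
    _◁ν_ = _◁_ ν
    _⊏ν_ = _⊏ᵈ_ ν

  key-injective : ∀ {p q : Fin m} → rowᵈ ν p ≡ rowᵈ ν q → colᵈ ν p ≡ colᵈ ν q → p ≡ q
  key-injective {p} {q} r c = lookup-injective (diagram-unique ν) p q (cong₂ _,_ c r)
    where
    lookup-injective : ∀ {A : Set} {xs : List A} → Unique xs → ∀ i j → List.lookup xs i ≡ List.lookup xs j → i ≡ j
    lookup-injective (x∉ ∷ u) zero    zero    eq = refl
    lookup-injective (x∉ ∷ u) zero    (suc j) eq = contradiction eq (All.lookup x∉ (∈-lookup j))
    lookup-injective (x∉ ∷ u) (suc i) zero    eq = contradiction (sym eq) (All.lookup x∉ (∈-lookup i))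
    lookup-injective (x∉ ∷ u) (suc i) (suc j) eq = cong suc (lookup-injective u i j eq)

  ◁-trans : ∀ {p q s} → p ◁ν q → q ◁ν s → p ◁ν s
  ◁-trans (inj₁ a)       (inj₁ b)       = inj₁ (ℕ.<-trans b a)
  ◁-trans (inj₁ a)       (inj₂ (b , _)) = inj₁ (subst (_< _) b a)
  ◁-trans (inj₂ (a , _)) (inj₁ b)       = inj₁ (subst (_ <_) (sym a) b)
  ◁-trans (inj₂ (a , c)) (inj₂ (b , e)) = inj₂ (trans a b , ℕ.<-trans c e)

  ◁-asym : ∀ {p q} → p ◁ν q → ¬ q ◁ν p
  ◁-asym (inj₁ a)       (inj₁ b)       = ℕ.<-asym a b
  ◁-asym (inj₁ a)       (inj₂ (b , _)) = ℕ.<-irrefl b a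
  ◁-asym (inj₂ (a , _)) (inj₁ b)       = ℕ.<-irrefl a b
  ◁-asym (inj₂ (_ , c)) (inj₂ (_ , e)) = ℕ.<-asym c e

  ◁-total : ∀ {p q} → p ≢ q → p ◁ν q ⊎ q ◁ν p
  ◁-total {p} {q} p≢q with ℕ.<-cmp (rowᵈ ν p) (rowᵈ ν q)
  ... | tri< r _ _ = inj₂ (inj₁ r)
  ... | tri> _ _ r = inj₁ (inj₁ r)
  ... | tri≈ _ r _ with ℕ.<-cmp (colᵈ ν p) (colᵈ ν q)
  ... | tri< c _ _ = inj₁ (inj₂ (r , c))
  ... | tri> _ _ c = inj₂ (inj₂ (sym r , c))
  ... | tri≈ _ c _ = contradiction (key-injective r c) p≢q

  open module C {N} (w : Vec (Fin N) m) = Compatible (_◁?_ ν) ◁-asym ◁-total (lookup w)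
  open module S {N} (w : Vec (Fin N) m) = Sorting (_≺?_ w) (≺-trans w ◁-trans) (≺-asym w ◁-trans) (≺-total w ◁-trans)

  -- A cell to the left of p in its row could follow p only at equal values, where ◁ forbids it; a
  -- cell below p in its column has a strictly smaller value.
  ssyt⇒extension : ∀ {N} (w : Vec (Fin N) m) {n} {v : Vec (Fin m) n} → VecPairs.AllPairs (_≺_ w) v → IsSSYT ν w →
                   VecPairs.AllPairs (λ p q → ¬ q ⊏ν p) v
  ssyt⇒extension w sorted ssyt = VecPairs.map (λ {p} {q} p≺q → λ
    { (inj₁ (r , c)) → not-row p q p≺q (proj₁ (ssyt q p) r c) r c
    ; (inj₂ (c , r)) → not-col p q p≺q (proj₂ (ssyt q p) c r) }) sorted
    where
    not-row : ∀ p q → _≺_ w p q → lookup w q Fin.≤ lookup w p → rowᵈ ν q ≡ rowᵈ ν p → ¬ colᵈ ν q < colᵈ ν p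
    not-row p q (inj₁ p<q)           q≤p r c = ℕ.<⇒≱ p<q q≤p
    not-row p q (inj₂ (_ , inj₁ r′)) q≤p r c = ℕ.<-irrefl r r′
    not-row p q (inj₂ (_ , inj₂ (_ , c′))) q≤p r c = ℕ.<-asym c c′
    not-col : ∀ p q → _≺_ w p q → ¬ lookup w q Fin.< lookup w p
    not-col p q (inj₁ p<q)       q<p = ℕ.<-asym p<q q<p
    not-col p q (inj₂ (p≡q , _)) q<p = ℕ.<-irrefl (cong toℕ (sym p≡q)) q<p

  extension⇒ssyt : ∀ {N} (w : Vec (Fin N) m) {v : Vec (Fin m) m} → (∀ e → e VecMem.∈ v) →
                   VecPairs.AllPairs (_≺_ w) v → VecPairs.AllPairs (λ p q → ¬ q ⊏ν p) v → IsSSYT ν w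
  extension⇒ssyt w ∈v sorted ext p q =
    (λ r c → row-≤ (precedes (λ { refl → ℕ.<-irrefl refl c }) (inj₁ (r , c)))) ,
    (λ c r → col-< (precedes (λ { refl → ℕ.<-irrefl refl r }) (inj₂ (c , r))) r)
    where
    precedes : p ≢ q → p ⊏ν q → _≺_ w p q
    -- As v contains all cells, one of p and q comes first in it; if q did, the linear extension
    -- would be violated.
    precedes p≢q p⊏q = [ proj₁ , (λ { (_ , q⊏̸p) → contradiction p⊏q q⊏̸p }) ]′
      (AllPairs-total (VecPairs.zip (sorted , ext)) (∈v p) (∈v q) p≢q)
    row-≤ : _≺_ w p q → lookup w p Fin.≤ lookup w q
    row-≤ (inj₁ p<q)       = ℕ.<⇒≤ p<q
    row-≤ (inj₂ (p≡q , _)) = ℕ.≤-reflexive (cong toℕ p≡q)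
    col-< : _≺_ w p q → rowᵈ ν p < rowᵈ ν q → lookup w p Fin.< lookup w q
    col-< (inj₁ p<q)                  r = p<q
    col-< (inj₂ (_ , inj₁ r′))        r = contradiction r′ (ℕ.<-asym r)
    col-< (inj₂ (_ , inj₂ (r′ , _)))  r = contradiction r (ℕ.<-irrefl r′)

  desc′ : Vec (Fin m) m → Subset (m ∸ 1)
  desc′ = descentsOf (λ p q → does (_◁?_ ν p q))

  -- For fixed π, the words that π sorts become, when read along π, the words compatible with its
  -- descent set.
  Q-reorder : ∀ {π} → Permutation (Vec.allFin m) π → ∀ {N} (α : Vec ℕ N) →
              ∑ (words N m) (λ w → sorted w π * monomial w α) ≡ Q m (desc′ π) α
  Q-reorder {π} perm {N} α = sym (begin
    Q m (desc′ π) α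
      ≡⟨ generating-∑ m (IsCompatible m (desc′ π)) (isCompatible? m (desc′ π)) α ⟩
    ∑ (words N m) (λ w → ⟦ isCompatible? m (desc′ π) w ⟧ * monomial w α)
      ≡⟨ sym (∑-↭ _ (reorder-words N)) ⟩
    ∑ (map reorder (words N m)) (λ w → ⟦ isCompatible? m (desc′ π) w ⟧ * monomial w α)
      ≡⟨ ∑-map reorder (words N m) _ ⟩
    ∑ (words N m) (λ w → ⟦ isCompatible? m (desc′ π) (reorder w) ⟧ * monomial (reorder w) α)
      ≡⟨ ∑-cong (words N m) (λ w → cong₂ _*_
           (⟦⟧-⇔ (isCompatible? m (desc′ π) (reorder w)) (linked? (_≺?_ w) π)
             (mk⇔ (compatible⇒linked w π π-unique) (linked⇒compatible w π)))
           (cong (λ e → ⟦ Vec.≡-dec ℕ._≟_ e α ⟧) (exponents-reorder w))) ⟩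
    ∑ (words N m) (λ w → sorted w π * monomial w α) ∎)
    where
    open ≡-Reasoning
    open Reorder perm

  -- Every w is sorted by exactly one π, its standardisation, and w is semistandard exactly when
  -- that π is a linear extension. Exchanging the sums groups the semistandard fillings by
  -- standardisation.
  schur-expansion : ∀ {N} (α : Vec ℕ N) → schur ν α ≡ ∑ (tableauDescents ν) (λ D → Q m D α)
  schur-expansion {N} α = begin
    schur ν α
      ≡⟨ generating-∑ m (IsSSYT ν) (isSSYT? ν) α ⟩
    ∑ W (λ w → ⟦ isSSYT? ν w ⟧ * monomial w α)
      ≡⟨ ∑-cong W (λ w → begin
           ⟦ isSSYT? ν w ⟧ * monomial w α
             ≡⟨ sym (ℕ.*-identityʳ _) ⟩
           ⟦ isSSYT? ν w ⟧ * monomial w α * 1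
             ≡⟨ cong (⟦ isSSYT? ν w ⟧ * monomial w α *_) (sym (perms-sorted w (Vec.allFin m) (allFin-unique m))) ⟩
           ⟦ isSSYT? ν w ⟧ * monomial w α * ∑ Π (sorted w)
             ≡⟨ sym (∑-*ˡ Π (⟦ isSSYT? ν w ⟧ * monomial w α) (sorted w)) ⟩
           ∑ Π (λ π → ⟦ isSSYT? ν w ⟧ * monomial w α * sorted w π)
             ≡⟨ ∑-cong-∈ Π (λ {π} π∈ → exchange w π (∈-perms⁻ _ π∈)) ⟩
           ∑ Π (λ π → ⟦ isLinearExtension? ν π ⟧ * (sorted w π * monomial w α)) ∎) ⟩
    ∑ W (λ w → ∑ Π (λ π → ⟦ isLinearExtension? ν π ⟧ * (sorted w π * monomial w α)))
      ≡⟨ ∑-swap W Π _ ⟩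
    ∑ Π (λ π → ∑ W (λ w → ⟦ isLinearExtension? ν π ⟧ * (sorted w π * monomial w α)))
      ≡⟨ ∑-cong-∈ Π (λ {π} π∈ → trans (∑-*ˡ W ⟦ isLinearExtension? ν π ⟧ _)
           (cong (⟦ isLinearExtension? ν π ⟧ *_) (Q-reorder (∈-perms⁻ _ π∈) α))) ⟩
    ∑ Π (λ π → ⟦ isLinearExtension? ν π ⟧ * Q m (desc′ π) α)
      ≡⟨ sym (∑-filter (isLinearExtension? ν) Π _) ⟩
    ∑ (filter (isLinearExtension? ν) Π) (λ π → Q m (desc′ π) α)
      ≡⟨ sym (∑-map desc′ (filter (isLinearExtension? ν) Π) (λ D → Q m D α)) ⟩
    ∑ (tableauDescents ν) (λ D → Q m D α) ∎
    where
    open ≡-Reasoning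
    W = words N m
    Π = perms (Vec.allFin m)
    exchange : ∀ w π → Permutation (Vec.allFin m) π →
               ⟦ isSSYT? ν w ⟧ * monomial w α * sorted w π ≡ ⟦ isLinearExtension? ν π ⟧ * (sorted w π * monomial w α)
    exchange w π perm with linked? (_≺?_ w) π
    ... | no _  = trans (ℕ.*-zeroʳ (⟦ isSSYT? ν w ⟧ * monomial w α)) (sym (ℕ.*-zeroʳ ⟦ isLinearExtension? ν π ⟧))
    ... | yes l = trans (ℕ.*-identityʳ _) (cong₂ _*_
      (⟦⟧-⇔ (isSSYT? ν w) (isLinearExtension? ν π)
        (mk⇔ (ssyt⇒extension w s) (extension⇒ssyt w (Reorder.∈π perm) s)))
      (sym (ℕ.+-identityʳ _)))
      where s = Linked⇒AllPairs (≺-trans w ◁-trans) l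

schur-shape : ∀ {m} (σ : Shape m) {N} (α : Vec ℕ N) → schur (Shape.ν σ) α ≡ ∑ (tableaux σ) (λ D → Q m D α)
schur-shape (shape ν refl _) = SchurExpansion.schur-expansion ν

-- Cells, contents and entries

injective⇒surjective : ∀ {m n} (f : Fin n → Fin m) → m ≤ n → (∀ {x y} → f x ≡ f y → x ≡ y) →
                       ∀ y → ∃[ x ] f x ≡ y
injective⇒surjective {zero}  f _   _   ()
injective⇒surjective {suc m} {n} f m<n inj y with Fin.any? (λ x → f x Fin.≟ y)
... | yes hit = hit
... | no miss = contradiction (Fin.injective⇒≤ {f = λ x → punchOut (y≢f x)} λ {x} {x′} eq →
                                 inj (Fin.punchOut-injective (y≢f x) (y≢f x′) eq)) (ℕ.<⇒≱ m<n)
  where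
  y≢f : ∀ x → y ≢ f x
  y≢f x eq = miss (x , sym eq)

-- Being a section, g is injective, so by counting it is onto, and f inverts it on its values.
surjective⇒injective : ∀ {m n} (f : Fin m → Fin n) → m ≤ n → (g : Fin n → Fin m) → (∀ y → f (g y) ≡ y) →
                       ∀ x → g (f x) ≡ x
surjective⇒injective f m≤n g fg x with injective⇒surjective g m≤n (λ {y} {y′} eq → trans (sym (fg y)) (trans (cong f eq) (fg y′))) x
... | y , refl = cong g (fg y)

AllPairs-lookup : ∀ {A : Set} {R : A → A → Set} {xs} → AllPairs R xs → ∀ {i j} → i Fin.< j →
                  R (List.lookup xs i) (List.lookup xs j)
AllPairs-lookup (r ∷ rs) {zero}  {suc j} _         = All.lookup r (∈-lookup j)
AllPairs-lookup (r ∷ rs) {suc i} {suc j} (s≤s i<j) = AllPairs-lookup rs i<j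

nth-antitone : ∀ {ps} → Linked ℕ._≥_ ps → ∀ {b b′} → b ≤ b′ → nth ps b′ ≤ nth ps b
nth-antitone []      {b′ = b′}               _         = z≤n
nth-antitone {_ ∷ _}      l  {zero}  {zero}   _         = ℕ.≤-refl
nth-antitone {_ ∷ []}     l  {zero}  {suc b′} _         = z≤n
nth-antitone {_ ∷ _ ∷ _} (p≥q ∷ l) {zero} {suc b′} _    = ℕ.≤-trans (nth-antitone l {0} {b′} z≤n) p≥q
nth-antitone {_ ∷ _}      l  {suc b} {suc b′} (s≤s b≤)  = nth-antitone (Linked.tail l) b≤

part-antitone : ∀ ν {b b′} → b ≤ b′ → part ν b′ ≤ part ν b
part-antitone ν = nth-antitone (decreasing ν)

difference-< : ∀ {a b c d} → a + d < c + b → + a ℤ.- + b ℤ.< + c ℤ.- + d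
difference-< {a} {b} {c} {d} lt = subst₂ ℤ._<_ (shift a d b) (trans (cong (ℤ._- (+ b ℤ.+ + d)) (ℤ.+-comm (+ c) (+ b))) (shift′ b c d))
  (ℤ.+-monoˡ-< (ℤ.- (+ b ℤ.+ + d)) (ℤ.+<+ lt))
  where
  open +-*-Solver
  shift : ∀ a d b → + (a + d) ℤ.- (+ b ℤ.+ + d) ≡ + a ℤ.- + b
  shift a d b = solve 3 (λ a d b → a :+ d :- (b :+ d) := a :- b) refl (+ a) (+ d) (+ b)
  shift′ : ∀ b c d → + b ℤ.+ + c ℤ.- (+ b ℤ.+ + d) ≡ + c ℤ.- + d
  shift′ b c d = solve 3 (λ b c d → b :+ c :- (b :+ d) := c :- d) refl (+ b) (+ c) (+ d)

difference-≡ : ∀ {a b c d} → + a ℤ.- + b ≡ + c ℤ.- + d → a + d ≡ c + b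
difference-≡ {a} {b} {c} {d} eq with ℕ.<-cmp (a + d) (c + b)
... | tri< lt _ _ = contradiction eq (ℤ.<⇒≢ (difference-< {a} {b} {c} {d} lt))
... | tri≈ _ e _  = e
... | tri> _ _ gt = contradiction (sym eq) (ℤ.<⇒≢ (difference-< {c} {d} {a} {b} gt))

cancelʳ-≤ : ∀ z x y → x ℤ.+ z ℤ.≤ y ℤ.+ z → x ℤ.≤ y
cancelʳ-≤ z x y le = subst₂ ℤ._≤_ (simplify x) (simplify y) (ℤ.+-monoˡ-≤ (ℤ.- z) le)
  where
  open +-*-Solver
  simplify : ∀ x → x ℤ.+ z ℤ.- z ≡ x
  simplify x = solve 2 (λ x z → x :+ z :- z := x) refl x z

module _ (k : ℕ) where

  *-next-≤ : ∀ {c c′} → c ℤ.< c′ → + k ℤ.* c ℤ.+ + k ℤ.≤ + k ℤ.* c′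
  *-next-≤ {c} {c′} c<c′ = begin
    + k ℤ.* c ℤ.+ + k     ≡⟨ ℤ.+-comm (+ k ℤ.* c) (+ k) ⟩
    + k ℤ.+ + k ℤ.* c     ≡⟨ sym (ℤ.*-suc (+ k) c) ⟩
    + k ℤ.* ℤ.suc c       ≤⟨ ℤ.*-monoˡ-≤-nonNeg (+ k) (ℤ.i<j⇒suc[i]≤j c<c′) ⟩
    + k ℤ.* c′            ∎
    where open ℤ.≤-Reasoning

  digits-< : ∀ {c c′ i i′} → i < k → c ℤ.< c′ → + k ℤ.* c ℤ.+ + i ℤ.< + k ℤ.* c′ ℤ.+ + i′
  digits-< {c} {c′} {i} {i′} i<k c<c′ = begin-strict
    + k ℤ.* c ℤ.+ + i     <⟨ ℤ.+-monoʳ-< (+ k ℤ.* c) (ℤ.+<+ i<k) ⟩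
    + k ℤ.* c ℤ.+ + k     ≤⟨ *-next-≤ c<c′ ⟩
    + k ℤ.* c′            ≡⟨ sym (ℤ.+-identityʳ _) ⟩
    + k ℤ.* c′ ℤ.+ + 0    ≤⟨ ℤ.+-monoʳ-≤ (+ k ℤ.* c′) (ℤ.+≤+ z≤n) ⟩
    + k ℤ.* c′ ℤ.+ + i′   ∎
    where open ℤ.≤-Reasoning

  -- Uniqueness of division by k with remainder: the content is the quotient of the shifted content,
  -- the component the remainder.
  digits-≡ : ∀ {c c′ i i′} → i < k → i′ < k → + k ℤ.* c ℤ.+ + i ≡ + k ℤ.* c′ ℤ.+ + i′ → c ≡ c′ × i ≡ i′
  digits-≡ {c} {c′} {i} {i′} i<k i′<k eq with ℤ.<-cmp c c′
  ... | tri< lt _ _    = contradiction eq (ℤ.<⇒≢ (digits-< i<k lt))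
  ... | tri> _ _ gt    = contradiction (sym eq) (ℤ.<⇒≢ (digits-< i′<k gt))
  ... | tri≈ _ refl _  = refl , ℤ.+-injective (∙-cancelˡ (+ k ℤ.* c) (+ i) (+ i′) eq)

distance-≤ : ∀ {x y k} → x ℤ.≤ y → y ℤ.≤ x ℤ.+ + k → ∣ x ℤ.- y ∣ ≤ k
distance-≤ {x} {y} {k} x≤y y≤x+k = ℤ.drop‿+≤+ (begin
  + ∣ x ℤ.- y ∣             ≡⟨ cong +_ (ℤ.∣i-j∣≡∣j-i∣ x y) ⟩
  + ∣ y ℤ.- x ∣             ≡⟨ ℤ.0≤i⇒+∣i∣≡i (ℤ.i≤j⇒0≤j-i x≤y) ⟩
  y ℤ.- x                   ≤⟨ ℤ.+-monoˡ-≤ (ℤ.- x) y≤x+k ⟩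
  x ℤ.+ + k ℤ.- x           ≡⟨ solve 2 (λ x k → x :+ k :- x := k) refl x (+ k) ⟩
  + k                       ∎)
  where
  open ℤ.≤-Reasoning
  open +-*-Solver

distance-≥ : ∀ {x y k} → x ℤ.≤ y → ∣ x ℤ.- y ∣ ≤ k → y ℤ.≤ x ℤ.+ + k
distance-≥ {x} {y} {k} x≤y d≤k = begin
  y                         ≡⟨ solve 2 (λ x y → y := x :+ (y :- x)) refl x y ⟩
  x ℤ.+ (y ℤ.- x)           ≡⟨ cong (ℤ._+_ x) (sym (ℤ.0≤i⇒+∣i∣≡i (ℤ.i≤j⇒0≤j-i x≤y))) ⟩
  x ℤ.+ + ∣ y ℤ.- x ∣       ≡⟨ cong (λ d → x ℤ.+ + d) (ℤ.∣i-j∣≡∣j-i∣ y x) ⟩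
  x ℤ.+ + ∣ x ℤ.- y ∣       ≤⟨ ℤ.+-monoʳ-≤ x (ℤ.+≤+ d≤k) ⟩
  x ℤ.+ + k                 ∎
  where
  open ℤ.≤-Reasoning
  open +-*-Solver

module Cells {k : ℕ} (𝛍 : Fin k → SkewShape) where

  sc : Cell 𝛍 → ℤ
  sc = shiftedContent 𝛍

  cell-≡ : ∀ {x y : Cell 𝛍} → comp x ≡ comp y → col x ≡ col y → row x ≡ row y → x ≡ y
  cell-≡ {cell i a b l u} {cell _ _ _ l′ u′} refl refl refl
    with refl ← ℕ.≤-irrelevant l l′ | refl ← ℕ.≤-irrelevant u u′ = refl

  lookup-position : ∀ x → List.lookup (readingOrder 𝛍) (position 𝛍 x) ≡ x
  lookup-position x = sym (Any.lookup-index (∈-readingOrder 𝛍 x))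

  position-injective : ∀ {x y} → position 𝛍 x ≡ position 𝛍 y → x ≡ y
  position-injective {x} {y} eq =
    trans (sym (lookup-position x)) (trans (cong (List.lookup (readingOrder 𝛍)) eq) (lookup-position y))

  _≟ᶜ_ : ∀ (x y : Cell 𝛍) → Dec (x ≡ y)
  x ≟ᶜ y = map′ position-injective (cong (position 𝛍)) (position 𝛍 x Fin.≟ position 𝛍 y)

  _≺_ : Cell 𝛍 → Cell 𝛍 → Set
  x ≺ y = position 𝛍 x Fin.< position 𝛍 y

  ≺⇒≢ : ∀ {x y} → x ≺ y → x ≢ y
  ≺⇒≢ x≺y refl = ℕ.<-irrefl refl x≺y

  ≺-total : ∀ {x y} → x ≢ y → x ≺ y ⊎ y ≺ x
  ≺-total {x} {y} x≢y with Fin.<-cmp (position 𝛍 x) (position 𝛍 y)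
  ... | tri< l _ _ = inj₁ l
  ... | tri≈ _ e _ = contradiction (position-injective e) x≢y
  ... | tri> _ _ g = inj₂ g

  Precedes : Cell 𝛍 → Cell 𝛍 → Set
  Precedes x y = sc x ℤ.≤ sc y × (sc x ≡ sc y → col x ≤ col y)

  reading-sorted : AllPairs Precedes (readingOrder 𝛍)
  reading-sorted = Linked.Linked⇒AllPairs (λ {x} {y} {z} → precedes-trans x y z) (Linked.map (λ {x} {y} → weaken x y) (sort-↗ 𝛍 (cells 𝛍)))
    where
    precedes-trans : ∀ x y z → Precedes x y → Precedes y z → Precedes x z
    precedes-trans x y z (p , q) (p′ , q′) = ℤ.≤-trans p p′ , λ eq →
      let x≡y = ℤ.≤-antisym p (ℤ.≤-trans p′ (ℤ.≤-reflexive (sym eq)))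
      in ℕ.≤-trans (q x≡y) (q′ (trans (sym x≡y) eq))
    weaken : ∀ x y → (sc x ℤ.≤ sc y × ¬ sc x ≡ sc y) ⊎ (sc x ≡ sc y × col x ≤ col y) → Precedes x y
    weaken x y (inj₁ (p , ne)) = p , λ eq → contradiction eq ne
    weaken x y (inj₂ (eq , c)) = ℤ.≤-reflexive eq , λ _ → c

  ≺⇒precedes : ∀ {x y} → x ≺ y → Precedes x y
  ≺⇒precedes {x} {y} x≺y = subst₂ Precedes (lookup-position x) (lookup-position y) (AllPairs-lookup reading-sorted x≺y)

  -- Skew shapes are convex: the other two corners of the rectangle spanned by
  -- two of their cells belong to them.
  southeast northwest : ∀ (x y : Cell 𝛍) → comp x ≡ comp y → col x ≤ col y → row x ≤ row y → Cell 𝛍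
  southeast x y i≡ a≤ b≤ = cell (comp x) (col y) (row x) (ℕ.≤-trans (∉inner x) a≤)
    (ℕ.<-≤-trans (subst (λ i → col y < part (outer (𝛍 i)) (row y)) (sym i≡) (∈outer y)) (part-antitone (outer (𝛍 (comp x))) b≤))
  northwest x y i≡ a≤ b≤ = cell (comp x) (col x) (row y)
    (ℕ.≤-trans (part-antitone (inner (𝛍 (comp x))) b≤) (∉inner x))
    (ℕ.≤-<-trans a≤ (subst (λ i → col y < part (outer (𝛍 i)) (row y)) (sym i≡) (∈outer y)))

  same-sc : ∀ x y → sc x ≡ sc y → comp x ≡ comp y × content 𝛍 x ≡ content 𝛍 y
  same-sc x y eq = let (c≡ , i≡) = digits-≡ k {content 𝛍 x} {content 𝛍 y} (Fin.toℕ<n (comp x)) (Fin.toℕ<n (comp y)) eq in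
    Fin.toℕ-injective i≡ , c≡

  -- Within one component the shifted content moves in steps of k.
  content-gap : ∀ x y → content 𝛍 x ℤ.< content 𝛍 y → comp x ≡ comp y → sc x ℤ.+ + k ℤ.≤ sc y
  content-gap x y c<c′ i≡ = begin
    + k ℤ.* content 𝛍 x ℤ.+ + toℕ (comp x) ℤ.+ + k    ≡⟨ solve 3 (λ a b c → a :+ b :+ c := a :+ c :+ b) refl (+ k ℤ.* content 𝛍 x) (+ toℕ (comp x)) (+ k) ⟩
    + k ℤ.* content 𝛍 x ℤ.+ + k ℤ.+ + toℕ (comp x)    ≤⟨ ℤ.+-monoˡ-≤ (+ toℕ (comp x)) (*-next-≤ k c<c′) ⟩
    + k ℤ.* content 𝛍 y ℤ.+ + toℕ (comp x)            ≡⟨ cong (λ i → + k ℤ.* content 𝛍 y ℤ.+ + toℕ i) i≡ ⟩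
    sc y                                              ∎
    where
    open ℤ.≤-Reasoning
    open +-*-Solver

  _⊏ʳ_ _⊏ᶜ_ : Cell 𝛍 → Cell 𝛍 → Set
  x ⊏ʳ y = comp x ≡ comp y × row x ≡ row y × col x < col y
  x ⊏ᶜ y = comp x ≡ comp y × col x ≡ col y × row x < row y

  -- Weaker than lying in one row or column: only the component and the inequality of contents are
  -- kept, which is what the distance argument can refute.
  data Comparable (x y : Cell 𝛍) : Set where
    _,_ : comp x ≡ comp y → content 𝛍 x ℤ.< content 𝛍 y ⊎ content 𝛍 y ℤ.< content 𝛍 x → Comparable x y

  Comparable-sym : ∀ {x y} → Comparable x y → Comparable y x
  Comparable-sym (i≡ , c) = sym i≡ , Sum.swap c

  ⊏ʳ⇒content : ∀ {x y} → x ⊏ʳ y → content 𝛍 x ℤ.< content 𝛍 y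
  ⊏ʳ⇒content {x} {y} (i≡ , b≡ , a<) = difference-< {col x} {row x} {col y} {row y}
    (subst (λ b → col x + row y < col y + b) (sym b≡) (ℕ.+-monoˡ-< (row y) a<))

  ⊏ᶜ⇒content : ∀ {x y} → x ⊏ᶜ y → content 𝛍 y ℤ.< content 𝛍 x
  ⊏ᶜ⇒content {x} {y} (i≡ , a≡ , b<) = difference-< {col y} {row y} {col x} {row x}
    (subst (λ a → a + row x < col x + row y) a≡ (ℕ.+-monoʳ-< (col x) b<))

  data _⊏_ (x y : Cell 𝛍) : Set where
    inRow : x ⊏ʳ y → x ⊏ y
    inCol : x ⊏ᶜ y → x ⊏ y

  ⊏⇒Comparable : ∀ {x y} → x ⊏ y → Comparable x y
  ⊏⇒Comparable {x} {y} (inRow r) = proj₁ r , inj₁ (⊏ʳ⇒content {x} {y} r)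
  ⊏⇒Comparable {x} {y} (inCol c) = proj₁ c , inj₂ (⊏ᶜ⇒content {x} {y} c)

  distance : Cell 𝛍 → Cell 𝛍 → ℕ
  distance x y = ∣ sc x ℤ.- sc y ∣

  distance-sym : ∀ x y → distance x y ≡ distance y x
  distance-sym x y = ℤ.∣i-j∣≡∣j-i∣ (sc x) (sc y)

  distance-≤ˡ : ∀ {x y z} → sc x ℤ.≤ sc y → sc y ℤ.≤ sc z → distance x y ≤ distance x z
  distance-≤ˡ {x} {y} {z} x≤y y≤z = distance-≤ x≤y
    (ℤ.≤-trans y≤z (distance-≥ (ℤ.≤-trans x≤y y≤z) ℕ.≤-refl))

  distance-≤ʳ : ∀ {x y z} → sc x ℤ.≤ sc y → sc y ℤ.≤ sc z → distance y z ≤ distance x z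
  distance-≤ʳ {x} {y} {z} x≤y y≤z = distance-≤ y≤z
    (ℤ.≤-trans (distance-≥ (ℤ.≤-trans x≤y y≤z) ℕ.≤-refl) (ℤ.+-monoˡ-≤ (+ distance x z) x≤y))

  pairwise-≤ : ∀ {x y z b} → distance x y ≤ b → distance y z ≤ b → distance x z ≤ b →
               ∀ {u v} → u ∈ x ∷ y ∷ z ∷ [] → v ∈ x ∷ y ∷ z ∷ [] → distance u v ≤ b
  pairwise-≤ {x} {y} {z} {b} xy yz xz = λ
    { (here refl)                 (here refl)                 → self x
    ; (here refl)                 (there (here refl))         → xy
    ; (here refl)                 (there (there (here refl))) → xz
    ; (there (here refl))         (here refl)                 → subst (_≤ b) (distance-sym x y) xy
    ; (there (here refl))         (there (here refl))         → self y
    ; (there (here refl))         (there (there (here refl))) → yz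
    ; (there (there (here refl))) (here refl)                 → subst (_≤ b) (distance-sym x z) xz
    ; (there (there (here refl))) (there (here refl))         → subst (_≤ b) (distance-sym y z) yz
    ; (there (there (here refl))) (there (there (here refl))) → self z
    }
    where
    self : ∀ u → distance u u ≤ b
    self u = subst (_≤ b) (sym (cong ∣_∣ (ℤ.+-inverseʳ (sc u)))) z≤n

  adjacent-distance : ∀ x y → comp x ≡ comp y → content 𝛍 y ≡ ℤ.suc (content 𝛍 x) → distance x y ≤ k
  adjacent-distance x y i≡ c≡ = distance-≤
    (ℤ.≤-trans (ℤ.i≤i+j (sc x) (+ k)) (ℤ.≤-reflexive (sym eq))) (ℤ.≤-reflexive eq)
    where
    open +-*-Solver
    eq : sc y ≡ sc x ℤ.+ + k
    eq rewrite c≡ | i≡ = solve 3 (λ k c i → k :* (con (+ 1) :+ c) :+ i := k :* c :+ i :+ k) refl (+ k) (content 𝛍 x) (+ toℕ (comp y))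

  module _ {n : ℕ} (T : SYT 𝛍 n) where

    entry-< : ∀ {x y} → x ⊏ y → filling T x Fin.< filling T y
    entry-< {x} {y} (inRow (i≡ , b≡ , a<)) = row-increasing T x y i≡ b≡ a<
    entry-< {x} {y} (inCol (i≡ , a≡ , b<)) = col-increasing T x y i≡ a≡ b<

    filling-injective : ∀ {x y} → filling T x ≡ filling T y → x ≡ y
    filling-injective = proj₁ (bijective T)

    filling-cellOf : ∀ e → filling T (cellOf T e) ≡ e
    filling-cellOf e = proj₂ (proj₂ (bijective T) e) refl

    cellOf-filling : ∀ {x e} → filling T x ≡ e → cellOf T e ≡ x
    cellOf-filling {x} {e} eq = filling-injective (trans (filling-cellOf e) (sym eq))

    cellOf-injective : ∀ {e f} → cellOf T e ≡ cellOf T f → e ≡ f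
    cellOf-injective {e} {f} eq = trans (sym (filling-cellOf e)) (trans (cong (filling T) eq) (filling-cellOf f))

    entry-monotone : ∀ {x y} → comp x ≡ comp y → col x ≤ col y → row x ≤ row y → x ≢ y → filling T x Fin.< filling T y
    entry-monotone {x} {y} i≡ a≤ b≤ x≢y with ℕ.m≤n⇒m<n∨m≡n a≤ | ℕ.m≤n⇒m<n∨m≡n b≤
    ... | inj₂ a≡ | inj₂ b≡ = contradiction (cell-≡ i≡ a≡ b≡) x≢y
    ... | inj₂ a≡ | inj₁ b< = entry-< (inCol (i≡ , a≡ , b<))
    ... | inj₁ a< | inj₂ b≡ = entry-< (inRow (i≡ , b≡ , a<))
    ... | inj₁ a< | inj₁ b< = ℕ.<-trans
      (entry-< {x} {southeast x y i≡ a≤ b≤} (inRow (refl , refl , a<))) (entry-< (inCol (i≡ , refl , b<)))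

    -- The entries of the other two corners of the rectangle lie strictly between.
    diagonal-gap : ∀ x y → comp x ≡ comp y → content 𝛍 x ≡ content 𝛍 y → col x < col y →
                   3 + toℕ (filling T x) ≤ toℕ (filling T y)
    diagonal-gap x y i≡ c≡ a< = distinct-between (entry-< {x} {u} (inRow (refl , refl , a<))) (entry-< {u} {y} (inCol (i≡ , refl , b<)))
      (entry-< {x} {v} (inCol (refl , refl , b<))) (entry-< {v} {y} (inRow (i≡ , refl , a<)))
      (λ eq → ℕ.<-irrefl (cong col (sym (filling-injective (Fin.toℕ-injective eq)))) a<)
      where
      b< : row x < row y
      b< = ℕ.+-cancelˡ-< (col x) _ _ (subst (col x + row x <_) (sym (difference-≡ {col x} {row x} {col y} {row y} c≡)) (ℕ.+-monoˡ-< (row x) a<))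
      u = southeast x y i≡ (ℕ.<⇒≤ a<) (ℕ.<⇒≤ b<)
      v = northwest x y i≡ (ℕ.<⇒≤ a<) (ℕ.<⇒≤ b<)
      distinct-between : ∀ {p q s t} → p < q → q < t → p < s → s < t → q ≢ s → 3 + p ≤ t
      distinct-between {p} {q} {s} {t} p<q q<t p<s s<t q≢s with ℕ.<-cmp q s
      ... | tri< q<s _ _ = ℕ.≤-trans (s≤s (ℕ.≤-trans (s≤s p<q) q<s)) s<t
      ... | tri≈ _ q≡s _ = contradiction q≡s q≢s
      ... | tri> _ _ s<q = ℕ.≤-trans (s≤s (ℕ.≤-trans (s≤s p<s) s<q)) q<t

    same-sc-gap : ∀ x y → x ≺ y → sc x ≡ sc y → 3 + toℕ (filling T x) ≤ toℕ (filling T y)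
    same-sc-gap x y x≺y eq = diagonal-gap x y i≡ c≡ (ℕ.≤∧≢⇒< (proj₂ (≺⇒precedes x≺y) eq) a≢)
      where
      i≡ = proj₁ (same-sc x y eq)
      c≡ = proj₂ (same-sc x y eq)
      a≢ : col x ≢ col y
      a≢ a≡ = ≺⇒≢ x≺y (cell-≡ i≡ a≡ (sym (ℕ.+-cancelˡ-≡ (col x) (row y) (row x)
        (trans (difference-≡ {col x} {row x} {col y} {row y} c≡) (cong (_+ row x) (sym a≡))))))

    -- If the cells were not adjacent, the neighbour of x towards y would belong to the skew shape
    -- and its entry would lie strictly between two consecutive numbers. For adjacent cells the
    -- contents differ by 1, and the shifted contents by k.
    consecutive-distance : ∀ {x y} → x ⊏ y → toℕ (filling T y) ≡ suc (toℕ (filling T x)) → distance x y ≤ k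
    consecutive-distance {x} {y} (inRow (i≡ , b≡ , a<)) e≡ with ℕ.m≤n⇒m<n∨m≡n a<
    ... | inj₂ a≡ = adjacent-distance x y i≡ (subst₂ (λ a b → + a ℤ.- + b ≡ ℤ.suc (content 𝛍 x)) a≡ b≡
            (ℤ.+-assoc (+ 1) (+ col x) (ℤ.- + row x)))
    ... | inj₁ a< = contradiction
            (ℕ.≤-trans (s≤s (entry-< {x} {z} (inRow (refl , refl , ℕ.≤-refl)))) (entry-< {z} {y} (inRow (i≡ , b≡ , a<))))
            (ℕ.<-irrefl (sym e≡))
      where
      z : Cell 𝛍
      z = cell (comp x) (suc (col x)) (row x) (ℕ.m≤n⇒m≤1+n (∉inner x))
            (ℕ.<-trans a< (subst₂ (λ i b → col y < part (outer (𝛍 i)) b) (sym i≡) (sym b≡) (∈outer y)))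
    consecutive-distance {x} {y} (inCol (i≡ , a≡ , b<)) e≡ with ℕ.m≤n⇒m<n∨m≡n b<
    ... | inj₂ b≡ = subst (_≤ k) (distance-sym y x) (adjacent-distance y x (sym i≡)
            (subst₂ (λ a b → content 𝛍 x ≡ ℤ.suc (+ a ℤ.- + b)) a≡ b≡
            (solve 2 (λ a b → a :- b := con (+ 1) :+ (a :- (con (+ 1) :+ b))) refl (+ col x) (+ row x))))
      where open +-*-Solver
    ... | inj₁ b< = contradiction
            (ℕ.≤-trans (s≤s (entry-< {x} {z} (inCol (refl , refl , ℕ.≤-refl)))) (entry-< {z} {y} (inCol (i≡ , a≡ , b<))))
            (ℕ.<-irrefl (sym e≡))
      where
      z : Cell 𝛍
      z = cell (comp x) (col x) (suc (row x))
            (ℕ.≤-trans (part-antitone (inner (𝛍 (comp x))) (ℕ.n≤1+n (row x))) (∉inner x))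
            (ℕ.<-≤-trans (subst₂ (λ i a → a < part (outer (𝛍 i)) (row y)) (sym i≡) (sym a≡) (∈outer y))
              (part-antitone (outer (𝛍 (comp x))) (ℕ.<⇒≤ b<)))

    -- If m were comparable to l, it would have the shifted content of h, so m
    -- and h would lie on one diagonal.
    middle-incomparable : ∀ {l m h} → l ≺ m → m ≺ h → distance l h ≤ k →
                          toℕ (filling T l) ≤ 2 + toℕ (filling T m) → toℕ (filling T h) ≤ 2 + toℕ (filling T m) →
                          toℕ (filling T m) ≤ 2 + toℕ (filling T l) →
                          ¬ Comparable l m × ¬ Comparable m h
    middle-incomparable {l} {m} {h} l≺m m≺h close l≤m h≤m m≤l = left , right
      where
      l≤ = proj₁ (≺⇒precedes l≺m)
      m≤ = proj₁ (≺⇒precedes m≺h)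
      h≤l+k : sc h ℤ.≤ sc l ℤ.+ + k
      h≤l+k = distance-≥ (ℤ.≤-trans l≤ m≤) close
      content-< : ∀ x y → Comparable x y → sc x ℤ.≤ sc y → sc x ℤ.+ + k ℤ.≤ sc y
      content-< x y (i≡ , inj₁ c<) _   = content-gap x y c< i≡
      content-< x y (i≡ , inj₂ c>) x≤y = contradiction
        (digits-< k {content 𝛍 y} {content 𝛍 x} (Fin.toℕ<n (comp y)) c>) (ℤ.≤⇒≯ x≤y)
      left : ¬ Comparable l m
      left cmp = ℕ.<⇒≱ (same-sc-gap m h m≺h (ℤ.≤-antisym m≤ (ℤ.≤-trans h≤l+k (content-< l m cmp l≤)))) h≤m
      right : ¬ Comparable m h
      right cmp = ℕ.<⇒≱ (same-sc-gap l m l≺m (ℤ.≤-antisym l≤ m≤l′)) m≤l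
        where
        m≤l′ : sc m ℤ.≤ sc l
        m≤l′ = cancelʳ-≤ (+ k) (sc m) (sc l) (ℤ.≤-trans (content-< m h cmp m≤) h≤l+k)

    -- For k ≤ 2 the shifted contents of l, m, h are c, c+1, c+2, so k = 2.
    ends-comparable : k ≤ 2 → ∀ {l m h} → l ≺ m → m ≺ h → distance l h ≤ k →
                      toℕ (filling T h) ≤ 2 + toℕ (filling T m) → toℕ (filling T m) ≤ 2 + toℕ (filling T l) →
                      comp l ≡ comp h × col h + row l ≡ suc (col l + row h)
    ends-comparable k≤2 {l} {m} {h} l≺m m≺h close h≤m m≤l =
      Fin.toℕ-injective (sym (proj₂ digits)) ,
      difference-≡ {col h} {row h} {suc (col l)} {row l} (trans (proj₁ digits) (sym (ℤ.+-assoc (+ 1) (+ col l) (ℤ.- + row l))))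
      where
      open +-*-Solver
      l< : sc l ℤ.< sc m
      l< = ℤ.≤∧≢⇒< (proj₁ (≺⇒precedes l≺m)) λ eq → ℕ.<⇒≱ (same-sc-gap l m l≺m eq) m≤l
      m< : sc m ℤ.< sc h
      m< = ℤ.≤∧≢⇒< (proj₁ (≺⇒precedes m≺h)) λ eq → ℕ.<⇒≱ (same-sc-gap m h m≺h eq) h≤m
      h≥ : sc l ℤ.+ + 2 ℤ.≤ sc h
      h≥ = ℤ.≤-trans (ℤ.≤-reflexive (solve 1 (λ x → x :+ con (+ 2) := con (+ 1) :+ (con (+ 1) :+ x)) refl (sc l)))
             (ℤ.≤-trans (ℤ.suc-mono (ℤ.i<j⇒suc[i]≤j l<)) (ℤ.i<j⇒suc[i]≤j m<))
      h≤ : sc h ℤ.≤ sc l ℤ.+ + k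
      h≤ = distance-≥ (ℤ.<⇒≤ (ℤ.<-trans l< m<)) close
      k≡2 : + k ≡ + 2
      k≡2 = ℤ.≤-antisym (ℤ.+≤+ k≤2) (cancelʳ-≤ (sc l) (+ 2) (+ k) (subst₂ ℤ._≤_ (ℤ.+-comm (sc l) (+ 2)) (ℤ.+-comm (sc l) (+ k)) (ℤ.≤-trans h≥ h≤)))
      h≡ : sc h ≡ sc l ℤ.+ + k
      h≡ = ℤ.≤-antisym h≤ (subst (λ z → sc l ℤ.+ z ℤ.≤ sc h) (sym k≡2) h≥)
      digits : content 𝛍 h ≡ ℤ.suc (content 𝛍 l) × toℕ (comp h) ≡ toℕ (comp l)
      digits = digits-≡ k {content 𝛍 h} {ℤ.suc (content 𝛍 l)} (Fin.toℕ<n (comp h)) (Fin.toℕ<n (comp l)) (trans h≡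
        (solve 3 (λ k c i → k :* c :+ i :+ k := k :* (con (+ 1) :+ c) :+ i) refl (+ k) (content 𝛍 l) (+ toℕ (comp l))))

-- The operators on cells

module Rotations {X : Set} {_≺_ : X → X → Set} (_≺?_ : ∀ x y → Dec (x ≺ y))
  {Near : X → X → Set} (near? : ∀ x y → Dec (Near x y))
  (≺-asym : ∀ {x y} → x ≺ y → ¬ y ≺ x) (≺-total : ∀ {x y} → x ≢ y → x ≺ y ⊎ y ≺ x) where

  lt close : X → X → Bool
  lt x y    = does (x ≺? y)
  close x y = does (near? x y)

  -- The graph of `rotate`, with one constructor for each relative order and distance case. The
  -- order of the three places is explicit in it, so inverses and transport along monotone maps are
  -- found constructor by constructor.
  data Rotation (a b c : X) : X × X × X → Set where
    fixed↑ : a ≺ b → b ≺ c → Rotation a b c (a , b , c)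
    fixed↓ : c ≺ b → b ≺ a → Rotation a b c (a , b , c)
    near₁  : a ≺ c → c ≺ b → Near a b → Rotation a b c (c , a , b)
    far₁   : a ≺ c → c ≺ b → ¬ Near a b → Rotation a b c (b , a , c)
    near₂  : c ≺ a → a ≺ b → Near c b → Rotation a b c (b , c , a)
    far₂   : c ≺ a → a ≺ b → ¬ Near c b → Rotation a b c (a , c , b)
    near₃  : b ≺ a → a ≺ c → Near b c → Rotation a b c (b , c , a)
    far₃   : b ≺ a → a ≺ c → ¬ Near b c → Rotation a b c (a , c , b)
    near₄  : b ≺ c → c ≺ a → Near b a → Rotation a b c (c , a , b)
    far₄   : b ≺ c → c ≺ a → ¬ Near b a → Rotation a b c (b , a , c)

  data Ends (a b c : X) : X × X → Set where
    ends₁ : a ≺ c → c ≺ b → Near a b → Ends a b c (a , b)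
    ends₂ : c ≺ a → a ≺ b → Near c b → Ends a b c (c , b)
    ends₃ : b ≺ a → a ≺ c → Near b c → Ends a b c (b , c)
    ends₄ : b ≺ c → c ≺ a → Near b a → Ends a b c (b , a)

  flip : ∀ {x y} → x ≢ y → ¬ x ≺ y → y ≺ x
  flip x≢y x⊀y = [ (λ x≺y → contradiction x≺y x⊀y) , id ]′ (≺-total x≢y)

  rotation : ∀ {a b c} → a ≢ b → b ≢ c → a ≢ c → Rotation a b c (rotate lt close a b c)
  rotation {a} {b} {c} a≢b b≢c a≢c with a ≺? b | b ≺? c
  ... | yes a≺b | yes b≺c = fixed↑ a≺b b≺c
  ... | no a⊀b  | no b⊀c  = fixed↓ (flip b≢c b⊀c) (flip a≢b a⊀b)
  ... | yes a≺b | no b⊀c with a ≺? c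
  ...   | yes a≺c with near? a b
  ...     | yes n = near₁ a≺c (flip b≢c b⊀c) n
  ...     | no f  = far₁ a≺c (flip b≢c b⊀c) f
  rotation {a} {b} {c} a≢b b≢c a≢c | yes a≺b | no b⊀c | no a⊀c with near? c b
  ...     | yes n = near₂ (flip a≢c a⊀c) a≺b n
  ...     | no f  = far₂ (flip a≢c a⊀c) a≺b f
  rotation {a} {b} {c} a≢b b≢c a≢c | no a⊀b | yes b≺c with a ≺? c
  ...   | yes a≺c with near? b c
  ...     | yes n = near₃ (flip a≢b a⊀b) a≺c n
  ...     | no f  = far₃ (flip a≢b a⊀b) a≺c f
  rotation {a} {b} {c} a≢b b≢c a≢c | no a⊀b | yes b≺c | no a⊀c with near? b a
  ...     | yes n = near₄ b≺c (flip a≢c a⊀c) n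
  ...     | no f  = far₄ b≺c (flip a≢c a⊀c) f

  module _ (≺-trans : ∀ {x y z} → x ≺ y → y ≺ z → x ≺ z) where

    rotate-unique : ∀ {a b c t} → Rotation a b c t → rotate lt close a b c ≡ t
    rotate-unique {a} {b} {c} (fixed↑ p q)
      rewrite dec-true (a ≺? b) p | dec-true (b ≺? c) q = refl
    rotate-unique {a} {b} {c} (fixed↓ p q)
      rewrite dec-false (a ≺? b) (≺-asym q) | dec-false (b ≺? c) (≺-asym p) = refl
    rotate-unique {a} {b} {c} (near₁ p q n)
      rewrite dec-true (a ≺? b) (≺-trans p q) | dec-false (b ≺? c) (≺-asym q) | dec-true (a ≺? c) p | dec-true (near? a b) n = refl
    rotate-unique {a} {b} {c} (far₁ p q n)
      rewrite dec-true (a ≺? b) (≺-trans p q) | dec-false (b ≺? c) (≺-asym q) | dec-true (a ≺? c) p | dec-false (near? a b) n = refl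
    rotate-unique {a} {b} {c} (near₂ p q n)
      rewrite dec-true (a ≺? b) q | dec-false (b ≺? c) (≺-asym (≺-trans p q)) | dec-false (a ≺? c) (≺-asym p) | dec-true (near? c b) n = refl
    rotate-unique {a} {b} {c} (far₂ p q n)
      rewrite dec-true (a ≺? b) q | dec-false (b ≺? c) (≺-asym (≺-trans p q)) | dec-false (a ≺? c) (≺-asym p) | dec-false (near? c b) n = refl
    rotate-unique {a} {b} {c} (near₃ p q n)
      rewrite dec-false (a ≺? b) (≺-asym p) | dec-true (b ≺? c) (≺-trans p q) | dec-true (a ≺? c) q | dec-true (near? b c) n = refl
    rotate-unique {a} {b} {c} (far₃ p q n)
      rewrite dec-false (a ≺? b) (≺-asym p) | dec-true (b ≺? c) (≺-trans p q) | dec-true (a ≺? c) q | dec-false (near? b c) n = refl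
    rotate-unique {a} {b} {c} (near₄ p q n)
      rewrite dec-false (a ≺? b) (≺-asym (≺-trans p q)) | dec-true (b ≺? c) p | dec-false (a ≺? c) (≺-asym q) | dec-true (near? b a) n = refl
    rotate-unique {a} {b} {c} (far₄ p q n)
      rewrite dec-false (a ≺? b) (≺-asym (≺-trans p q)) | dec-true (b ≺? c) p | dec-false (a ≺? c) (≺-asym q) | dec-false (near? b a) n = refl

  -- A move permutes entries among the same three places, so the outer pair and its closeness do not
  -- change; the two 3-cycles invert each other and a swap inverts itself.
  rotation-inverse : ∀ {a b c a′ b′ c′} → Rotation a b c (a′ , b′ , c′) → Rotation a′ b′ c′ (a , b , c)
  rotation-inverse (fixed↑ p q)  = fixed↑ p q
  rotation-inverse (fixed↓ p q)  = fixed↓ p q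
  rotation-inverse (near₁ p q n) = near₃ p q n
  rotation-inverse (far₁ p q n)  = far₄ p q n
  rotation-inverse (near₂ p q n) = near₄ p q n
  rotation-inverse (far₂ p q n)  = far₃ p q n
  rotation-inverse (near₃ p q n) = near₁ p q n
  rotation-inverse (far₃ p q n)  = far₂ p q n
  rotation-inverse (near₄ p q n) = near₂ p q n
  rotation-inverse (far₄ p q n)  = far₁ p q n

  ends-sound : ∀ {a b c e} → a ≢ b → b ≢ c → a ≢ c → ends lt close a b c ≡ just e → Ends a b c e
  ends-sound {a} {b} {c} a≢b b≢c a≢c eq with a ≺? b | b ≺? c
  ... | yes a≺b | no b⊀c with a ≺? c
  ...   | yes a≺c with near? a b | eq
  ...     | yes n | refl = ends₁ a≺c (flip b≢c b⊀c) n
  ends-sound {a} {b} {c} a≢b b≢c a≢c eq | yes a≺b | no b⊀c | no a⊀c with near? c b | eq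
  ...     | yes n | refl = ends₂ (flip a≢c a⊀c) a≺b n
  ends-sound {a} {b} {c} a≢b b≢c a≢c eq | no a⊀b | yes b≺c with a ≺? c
  ...   | yes a≺c with near? b c | eq
  ...     | yes n | refl = ends₃ (flip a≢b a⊀b) a≺c n
  ends-sound {a} {b} {c} a≢b b≢c a≢c eq | no a⊀b | yes b≺c | no a⊀c with near? b a | eq
  ...     | yes n | refl = ends₄ b≺c (flip a≢c a⊀c) n

map₃ : ∀ {X Y : Set} → (X → Y) → X × X × X → Y × Y × Y
map₃ f (a , b , c) = f a , f b , f c

module _ {X Y : Set} (f : X → Y) where

  module _ {_≺ˣ_ : X → X → Set} (_≺ˣ?_ : ∀ x y → Dec (x ≺ˣ y)) {Nearˣ : X → X → Set} (nearˣ? : ∀ x y → Dec (Nearˣ x y))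
    (asymˣ : ∀ {x y} → x ≺ˣ y → ¬ y ≺ˣ x) (totalˣ : ∀ {x y} → x ≢ y → x ≺ˣ y ⊎ y ≺ˣ x)
    {_≺ʸ_ : Y → Y → Set} (_≺ʸ?_ : ∀ x y → Dec (x ≺ʸ y)) {Nearʸ : Y → Y → Set} (nearʸ? : ∀ x y → Dec (Nearʸ x y))
    (asymʸ : ∀ {x y} → x ≺ʸ y → ¬ y ≺ʸ x) (totalʸ : ∀ {x y} → x ≢ y → x ≺ʸ y ⊎ y ≺ʸ x)
    (≺-map : ∀ {x y} → x ≺ˣ y → f x ≺ʸ f y)
    (near-map : ∀ {x y z} → x ≺ˣ y → y ≺ˣ z → Nearˣ x z → Nearʸ (f x) (f z))
    (far-map : ∀ {x y z} → x ≺ˣ y → y ≺ˣ z → ¬ Nearˣ x z → ¬ Nearʸ (f x) (f z)) where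

    private
      module RX = Rotations _≺ˣ?_ nearˣ? asymˣ totalˣ
      module RY = Rotations _≺ʸ?_ nearʸ? asymʸ totalʸ

    -- Nearness has to be preserved only for pairs that enclose a third element. This matters
    -- because a far vector does not record the nearness of neighbouring places.
    rotation-map : ∀ {a b c t} → RX.Rotation a b c t → RY.Rotation (f a) (f b) (f c) (map₃ f t)
    rotation-map (RX.fixed↑ p q)  = RY.fixed↑ (≺-map p) (≺-map q)
    rotation-map (RX.fixed↓ p q)  = RY.fixed↓ (≺-map p) (≺-map q)
    rotation-map (RX.near₁ p q n) = RY.near₁ (≺-map p) (≺-map q) (near-map p q n)
    rotation-map (RX.far₁ p q n)  = RY.far₁ (≺-map p) (≺-map q) (far-map p q n)
    rotation-map (RX.near₂ p q n) = RY.near₂ (≺-map p) (≺-map q) (near-map p q n)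
    rotation-map (RX.far₂ p q n)  = RY.far₂ (≺-map p) (≺-map q) (far-map p q n)
    rotation-map (RX.near₃ p q n) = RY.near₃ (≺-map p) (≺-map q) (near-map p q n)
    rotation-map (RX.far₃ p q n)  = RY.far₃ (≺-map p) (≺-map q) (far-map p q n)
    rotation-map (RX.near₄ p q n) = RY.near₄ (≺-map p) (≺-map q) (near-map p q n)
    rotation-map (RX.far₄ p q n)  = RY.far₄ (≺-map p) (≺-map q) (far-map p q n)

  move-map : ∀ {ltˣ closeˣ : X → X → Bool} {ltʸ closeʸ : Y → Y → Bool} {r} (j : Fin (suc r)) (v : Vec X (3 + r)) →
             (∀ {a b c : Fin (3 + r)} → toℕ a ≡ toℕ j → toℕ b ≡ 1 + toℕ j → toℕ c ≡ 2 + toℕ j →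
               rotate ltʸ closeʸ (f (lookup v a)) (f (lookup v b)) (f (lookup v c)) ≡
               map₃ f (rotate ltˣ closeˣ (lookup v a) (lookup v b) (lookup v c))) →
             move ltʸ closeʸ j (Vec.map f v) ≡ Vec.map f (move ltˣ closeˣ j v)
  move-map zero (a ∷ b ∷ c ∷ v) natural rewrite natural {zero} {suc zero} {suc (suc zero)} refl refl refl = refl
  move-map {r = suc r} (suc j) (a ∷ v) natural = cong (f a ∷_)
    (move-map j v λ p q s → natural (cong suc p) (cong suc q) (cong suc s))

move-tabulate : ∀ {X : Set} {lt close : X → X → Bool} {r} (j : Fin (suc r)) (f g : Fin (3 + r) → X) →
                (∀ {a b c} → toℕ a ≡ toℕ j → toℕ b ≡ 1 + toℕ j → toℕ c ≡ 2 + toℕ j →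
                  rotate lt close (f a) (f b) (f c) ≡ (g a , g b , g c)) →
                (∀ e → toℕ e ≢ toℕ j → toℕ e ≢ 1 + toℕ j → toℕ e ≢ 2 + toℕ j → g e ≡ f e) →
                move lt close j (tabulate f) ≡ tabulate g
move-tabulate zero f g rotated outside
  rewrite rotated {zero} {suc zero} {suc (suc zero)} refl refl refl =
  cong (λ v → _ ∷ _ ∷ _ ∷ v)
    (tabulate-cong λ e → sym (outside (suc (suc (suc e))) (λ ()) (λ ()) (λ ())))
  where open import Data.Vec.Properties using (tabulate-cong)
move-tabulate {r = suc r} (suc j) f g rotated outside = cong₂ _∷_
  (sym (outside zero (λ ()) (λ ()) (λ ())))
  (move-tabulate j (f ∘ suc) (g ∘ suc)
    (λ p q s → rotated (cong suc p) (cong suc q) (cong suc s))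
    (λ e p q s → outside (suc e) (p ∘ suc-injective) (q ∘ suc-injective) (s ∘ suc-injective)))
  where open import Data.Nat.Properties using (suc-injective)

endsAt-lookup : ∀ {X : Set} {lt close : X → X → Bool} {r} (j : Fin (suc r)) (v : Vec X (3 + r)) {a b c} →
                toℕ a ≡ toℕ j → toℕ b ≡ 1 + toℕ j → toℕ c ≡ 2 + toℕ j →
                endsAt lt close j v ≡ ends lt close (lookup v a) (lookup v b) (lookup v c)
endsAt-lookup zero (x ∷ y ∷ z ∷ v) {zero} {suc zero} {suc (suc zero)} refl refl refl = refl
endsAt-lookup {r = suc r} (suc j) (x ∷ v) {suc a} {suc b} {suc c} p q s =
  endsAt-lookup j v (suc-injective p) (suc-injective q) (suc-injective s)
  where open import Data.Nat.Properties using (suc-injective)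

sorted-unique : ∀ {A : Set} {R : A → A → Set} → (∀ {x y} → R x y → ¬ R y x) → ∀ {xs ys} →
                AllPairs R xs → AllPairs R ys → (∀ {z} → z ∈ xs → z ∈ ys) → (∀ {z} → z ∈ ys → z ∈ xs) → xs ≡ ys
sorted-unique asym []       []       to from = refl
sorted-unique asym []       (s ∷ ss) to from with from (here refl)
... | ()
sorted-unique asym (r ∷ rs) []       to from with to (here refl)
... | ()
sorted-unique {R = R} asym {x ∷ xs} {y ∷ ys} (r ∷ rs) (s ∷ ss) to from with to (here refl)
... | there x∈ys = heads (from (here refl))
  where
  heads : y ∈ x ∷ xs → x ∷ xs ≡ y ∷ ys
  heads (here refl) = contradiction (All.lookup s x∈ys) (λ ryy → asym ryy ryy)
  heads (there y∈)  = contradiction (All.lookup r y∈) (asym (All.lookup s x∈ys))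
... | here refl = cong (x ∷_) (sorted-unique asym rs ss (λ z∈ → tail r z∈ (to (there z∈))) (λ z∈ → tail s z∈ (from (there z∈))))
  where
  tail : ∀ {z zs ws} → All (R x) zs → z ∈ zs → z ∈ x ∷ ws → z ∈ ws
  tail r z∈ (here refl) = contradiction (All.lookup r z∈) (λ rxx → asym rxx rxx)
  tail r z∈ (there z∈′) = z∈′

lookup-fromList : ∀ {A : Set} (xs : List A) p → lookup (fromList xs) p ≡ List.lookup xs p
lookup-fromList (x ∷ xs) zero    = refl
lookup-fromList (x ∷ xs) (suc p) = lookup-fromList xs p

filter-map : ∀ {A B : Set} {P : B → Set} (P? : ∀ y → Dec (P y)) (f : A → B) xs →
             filter P? (map f xs) ≡ map f (filter (λ x → P? (f x)) xs)
filter-map P? f []       = refl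
filter-map P? f (x ∷ xs) with does (P? (f x))
... | true  = cong (f x ∷_) (filter-map P? f xs)
... | false = filter-map P? f xs

record Maps {n} (ρ : List (Fin n × Fin n)) (l₁ l₂ l₃ m₁ m₂ m₃ : Fin n) : Set where
  constructor maps
  field
    at₁ : substitute ρ l₁ ≡ m₁
    at₂ : substitute ρ l₂ ≡ m₂
    at₃ : substitute ρ l₃ ≡ m₃
    off : ∀ v → v ≢ l₁ → v ≢ l₂ → v ≢ l₃ → substitute ρ v ≡ v

module Letters {n} (i : Interior n) {l₁ l₂ l₃ : Fin n} (l₁≢l₂ : l₁ ≢ l₂) (l₂≢l₃ : l₂ ≢ l₃) (l₁≢l₃ : l₁ ≢ l₃) where

  private
    l : List (Fin n)
    l = l₁ ∷ l₂ ∷ l₃ ∷ []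
    same : ∀ (v : Fin n) → does (v Fin.≟ v) ≡ true
    same v = dec-true (v Fin.≟ v) refl
    diff : ∀ {u v : Fin n} → u ≢ v → does (u Fin.≟ v) ≡ false
    diff {u} {v} = dec-false (u Fin.≟ v)

  swapped : Maps ((l₁ , l₃) ∷ (l₃ , l₁) ∷ []) l₁ l₂ l₃ l₃ l₂ l₁
  swapped = maps e₁ e₂ e₃ e
    where
    ρ : List (Fin n × Fin n)
    ρ = (l₁ , l₃) ∷ (l₃ , l₁) ∷ []
    e₁ : substitute ρ l₁ ≡ l₃
    e₁ rewrite same l₁ = refl
    e₂ : substitute ρ l₂ ≡ l₂
    e₂ rewrite diff (l₁≢l₂ ∘ sym) | diff l₂≢l₃ = refl
    e₃ : substitute ρ l₃ ≡ l₁
    e₃ rewrite diff (l₁≢l₃ ∘ sym) | same l₃ = refl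
    e : ∀ v → v ≢ l₁ → v ≢ l₂ → v ≢ l₃ → substitute ρ v ≡ v
    e v v₁ v₂ v₃ rewrite diff v₁ | diff v₃ = refl

  d-first : self# i ≡ l₁ → Maps (dRule i l) l₁ l₂ l₃ l₃ l₂ l₁
  d-first refl rewrite same l₁ = swapped

  d-last : self# i ≡ l₃ → Maps (dRule i l) l₁ l₂ l₃ l₃ l₂ l₁
  d-last refl rewrite diff l₁≢l₃ | same l₃ = swapped

  d̃-first : self# i ≡ l₁ → Maps (d̃Rule i l) l₁ l₂ l₃ l₂ l₃ l₁
  d̃-first refl rewrite same l₁ = maps e₁ e₂ e₃ e
    where
    ρ : List (Fin n × Fin n)
    ρ = (l₁ , l₂) ∷ (l₂ , l₃) ∷ (l₃ , l₁) ∷ []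
    e₁ : substitute ρ l₁ ≡ l₂
    e₁ rewrite same l₁ = refl
    e₂ : substitute ρ l₂ ≡ l₃
    e₂ rewrite diff (l₁≢l₂ ∘ sym) | same l₂ = refl
    e₃ : substitute ρ l₃ ≡ l₁
    e₃ rewrite diff (l₁≢l₃ ∘ sym) | diff (l₂≢l₃ ∘ sym) | same l₃ = refl
    e : ∀ v → v ≢ l₁ → v ≢ l₂ → v ≢ l₃ → substitute ρ v ≡ v
    e v v₁ v₂ v₃ rewrite diff v₁ | diff v₂ | diff v₃ = refl

  d̃-last : self# i ≡ l₃ → Maps (d̃Rule i l) l₁ l₂ l₃ l₃ l₁ l₂
  d̃-last refl rewrite diff l₁≢l₃ | same l₃ = maps e₁ e₂ e₃ e
    where
    ρ : List (Fin n × Fin n)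
    ρ = (l₁ , l₃) ∷ (l₂ , l₁) ∷ (l₃ , l₂) ∷ []
    e₁ : substitute ρ l₁ ≡ l₃
    e₁ rewrite same l₁ = refl
    e₂ : substitute ρ l₂ ≡ l₁
    e₂ rewrite diff (l₁≢l₂ ∘ sym) | same l₂ = refl
    e₃ : substitute ρ l₃ ≡ l₂
    e₃ rewrite diff (l₁≢l₃ ∘ sym) | diff (l₂≢l₃ ∘ sym) | same l₃ = refl
    e : ∀ v → v ≢ l₁ → v ≢ l₂ → v ≢ l₃ → substitute ρ v ≡ v
    e v v₁ v₂ v₃ rewrite diff v₁ | diff v₂ | diff v₃ = refl

  d-middle : self# i ≡ l₂ → Maps (dRule i l) l₁ l₂ l₃ l₁ l₂ l₃
  d-middle refl rewrite diff l₁≢l₂ | diff (l₂≢l₃ ∘ sym) = maps refl refl refl λ _ _ _ _ → refl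

  d̃-middle : self# i ≡ l₂ → Maps (d̃Rule i l) l₁ l₂ l₃ l₁ l₂ l₃
  d̃-middle refl rewrite diff l₁≢l₂ | diff (l₂≢l₃ ∘ sym) = maps refl refl refl λ _ _ _ _ → refl

toℕ-pred# : ∀ {n} (i : Interior n) → 2 + toℕ (pred# i) ≡ idx i
toℕ-pred# (interior (suc (suc i)) (s≤s (s≤s z≤n)) i<n) = cong (λ m → ℕ.suc (ℕ.suc m)) (Fin.toℕ-fromℕ< _)

toℕ-self# : ∀ {n} (i : Interior n) → toℕ (self# i) ≡ suc (toℕ (pred# i))
toℕ-self# (interior (suc (suc i)) (s≤s (s≤s z≤n)) i<n) = trans (Fin.toℕ-fromℕ< _) (cong ℕ.suc (sym (Fin.toℕ-fromℕ< _)))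

toℕ-succ# : ∀ {n} (i : Interior n) → toℕ (succ# i) ≡ suc (suc (toℕ (pred# i)))
toℕ-succ# (interior (suc (suc i)) (s≤s (s≤s z≤n)) i<n) = trans (Fin.toℕ-fromℕ< _) (cong (λ m → ℕ.suc (ℕ.suc m)) (sym (Fin.toℕ-fromℕ< _)))

-- Reading words of standard fillings and the effect of `D` on three cells

module Tableaux {k n : ℕ} (𝛍 : Fin k → SkewShape) (size≡n : size 𝛍 ≡ n) where

  open Cells 𝛍 public

  _≺?_ : ∀ x y → Dec (x ≺ y)
  x ≺? y = position 𝛍 x Fin.<? position 𝛍 y

  Near : Cell 𝛍 → Cell 𝛍 → Set
  Near x y = distance x y ≤ k

  near? : ∀ x y → Dec (Near x y)
  near? x y = distance x y ℕ.≤? k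

  ≺-trans : ∀ {x y z} → x ≺ y → y ≺ z → x ≺ z
  ≺-trans = ℕ.<-trans

  ≺-asym : ∀ {x y} → x ≺ y → ¬ y ≺ x
  ≺-asym = ℕ.<-asym

  open Rotations _≺?_ near? (λ {x} {y} → ≺-asym {x} {y}) ≺-total public

  rotateᶜ : Cell 𝛍 → Cell 𝛍 → Cell 𝛍 → Cell 𝛍 × Cell 𝛍 × Cell 𝛍
  rotateᶜ = rotate lt close

  N = length (readingOrder 𝛍)

  N≡n : N ≡ n
  N≡n = trans (↭-length (sort-↭ 𝛍 (cells 𝛍))) size≡n

  module _ (T : SYT 𝛍 n) where

    lookup-readingWord : ∀ p → lookup (readingWord T) p ≡ filling T (List.lookup (readingOrder 𝛍) p)
    lookup-readingWord p = trans (Vec.lookup-map p (filling T) (fromList (readingOrder 𝛍)))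
                                 (cong (filling T) (lookup-fromList (readingOrder 𝛍) p))

    lookup-position-word : ∀ x → lookup (readingWord T) (position 𝛍 x) ≡ filling T x
    lookup-position-word x = trans (lookup-readingWord (position 𝛍 x)) (cong (filling T) (lookup-position x))

    -- A list of n cells that contains all n cells has no repetitions.
    position-lookup : ∀ p → position 𝛍 (List.lookup (readingOrder 𝛍) p) ≡ p
    position-lookup p = trans (cong (position 𝛍) (sym (cellOf-filling T {x = x} refl)))
      (surjective⇒injective (λ p → filling T (List.lookup (readingOrder 𝛍) p)) (ℕ.≤-reflexive N≡n)
        (λ e → position 𝛍 (cellOf T e))
        (λ e → trans (cong (filling T) (lookup-position (cellOf T e))) (filling-cellOf T e)) p)
      where x = List.lookup (readingOrder 𝛍) p

    readingOrder-sorted : AllPairs _≺_ (readingOrder 𝛍)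
    readingOrder-sorted = subst (AllPairs _≺_) (List.tabulate-lookup (readingOrder 𝛍))
      (AllPairs.tabulate⁺-< λ {p} {q} p<q → subst₂ Fin._<_ (sym (position-lookup p)) (sym (position-lookup q)) p<q)

    leftOf⇒≺ : ∀ {u v} → LeftOf (readingWord T) u v → cellOf T u ≺ cellOf T v
    leftOf⇒≺ (p , q , p<q , p≡u , q≡v) = subst₂ Fin._<_ (at p p≡u) (at q q≡v) p<q
      where
      at : ∀ p {u} → lookup (readingWord T) p ≡ u → p ≡ position 𝛍 (cellOf T u)
      at p eq = trans (sym (position-lookup p))
        (cong (position 𝛍) (sym (cellOf-filling T (trans (sym (lookup-readingWord p)) eq))))

    ≺⇒leftOf : ∀ {u v} → cellOf T u ≺ cellOf T v → LeftOf (readingWord T) u v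
    ≺⇒leftOf {u} {v} u≺v = _ , _ , u≺v , at u , at v
      where
      at : ∀ u → lookup (readingWord T) (position 𝛍 (cellOf T u)) ≡ u
      at u = trans (lookup-position-word (cellOf T u)) (filling-cellOf T u)

    lookup-Des : ∀ j → lookup (Des T) j ≡ does (cellOf T (upper j) ≺? cellOf T (lower j))
    lookup-Des j = trans (Vec.lookup∘tabulate _ j)
      (trans (cong (λ s → does (s Sign.≟ Sign.-)) (Vec.lookup∘tabulate _ j)) sign)
      where
      lower≢upper : lower j ≢ upper j
      lower≢upper = go j
        where
        go : ∀ {n} (j : Fin (n ∸ 1)) → lower {n} j ≢ upper j
        go {suc n} j eq = ℕ.1+n≢n (trans (sym (cong toℕ eq)) (Fin.toℕ-inject₁ j))
      sign : does ((if does (leftOf? (readingWord T) (lower j) (upper j)) then Sign.+ else Sign.-) Sign.≟ Sign.-) ≡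
             does (cellOf T (upper j) ≺? cellOf T (lower j))
      sign with leftOf? (readingWord T) (lower j) (upper j)
      ... | yes l = sym (dec-false (cellOf T (upper j) ≺? cellOf T (lower j)) (≺-asym {cellOf T (lower j)} {cellOf T (upper j)} (leftOf⇒≺ l)))
      ... | no ¬l = sym (dec-true (cellOf T (upper j) ≺? cellOf T (lower j))
        (flip (lower≢upper ∘ cellOf-injective T) (¬l ∘ ≺⇒leftOf)))

  module _ (i : Interior n) (T : SYT 𝛍 n) where

    private
      open DecMembership (Fin._≟_ {n}) using () renaming (_∈?_ to _∈ˡ?_)
      triple : List (Fin n)
      triple = pred# i ∷ self# i ∷ succ# i ∷ []

    predᶜ selfᶜ succᶜ : Cell 𝛍
    predᶜ = cellOf T (pred# i)
    selfᶜ = cellOf T (self# i)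
    succᶜ = cellOf T (succ# i)

    cells₃ : List (Cell 𝛍)
    cells₃ = predᶜ ∷ selfᶜ ∷ succᶜ ∷ []

    ∈-triple⁺ : ∀ {x} → x ∈ cells₃ → filling T x ∈ triple
    ∈-triple⁺ (here refl)                 = here (filling-cellOf T _)
    ∈-triple⁺ (there (here refl))         = there (here (filling-cellOf T _))
    ∈-triple⁺ (there (there (here refl))) = there (there (here (filling-cellOf T _)))

    ∈-triple⁻ : ∀ {x} → filling T x ∈ triple → x ∈ cells₃
    ∈-triple⁻ (here eq)                 = here (sym (cellOf-filling T eq))
    ∈-triple⁻ (there (here eq))         = there (here (sym (cellOf-filling T eq)))
    ∈-triple⁻ (there (there (here eq))) = there (there (here (sym (cellOf-filling T eq))))

    -- Filtering keeps the reading order, and a strictly sorted list is determined by the set of its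
    -- elements.
    subword-sorted : ∀ {x y z} → x ≺ y → y ≺ z → x ∷ y ∷ z ∷ [] ↭ cells₃ →
                     subword i (readingWord T) ≡ filling T x ∷ filling T y ∷ filling T z ∷ []
    subword-sorted {x} {y} {z} x≺y y≺z perm = begin
      filter (_∈ˡ? triple) (toList (Vec.map (filling T) (fromList (readingOrder 𝛍))))
        ≡⟨ cong (filter (_∈ˡ? triple)) (trans (Vec.toList-map (filling T) (fromList (readingOrder 𝛍)))
             (cong (map (filling T)) (Vec.toList∘fromList (readingOrder 𝛍)))) ⟩
      filter (_∈ˡ? triple) (map (filling T) (readingOrder 𝛍))
        ≡⟨ filter-map (_∈ˡ? triple) (filling T) (readingOrder 𝛍) ⟩
      map (filling T) (filter P? (readingOrder 𝛍))
        ≡⟨ cong (map (filling T)) (sorted-unique (λ {x} {y} → ≺-asym {x} {y})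
             (AllPairs.filter⁺ P? (readingOrder-sorted T))
             ((x≺y ∷ ≺-trans {x} {y} {z} x≺y y≺z ∷ []) ∷ (y≺z ∷ []) ∷ [] ∷ [])
             (λ c∈ → ∈-resp-↭ (↭-sym perm) (∈-triple⁻ (proj₂ (∈-filter⁻ P? {xs = readingOrder 𝛍} c∈))))
             (λ {c} c∈ → ∈-filter⁺ P? (∈-readingOrder 𝛍 c) (∈-triple⁺ (∈-resp-↭ perm c∈)))) ⟩
      filling T x ∷ filling T y ∷ filling T z ∷ [] ∎
      where
      open ≡-Reasoning
      P? : ∀ x → Dec (filling T x ∈ triple)
      P? x = filling T x ∈ˡ? triple

    diameter = dist₃ T (pred# i) (self# i) (succ# i)

    D-far : k < diameter → ∀ x → D i T x ≡ substitute (dRule i (subword i (readingWord T))) (filling T x)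
    D-far far x rewrite dec-true (k ℕ.<? diameter) far =
      trans (Vec.lookup-map (position 𝛍 x) (substitute ρ) (readingWord T)) (cong (substitute ρ) (lookup-position-word T x))
      where ρ = dRule i (subword i (readingWord T))

    D-near : ¬ k < diameter → ∀ x → D i T x ≡ substitute (d̃Rule i (subword i (readingWord T))) (filling T x)
    D-near near x rewrite dec-false (k ℕ.<? diameter) near =
      trans (Vec.lookup-map (position 𝛍 x) (substitute ρ) (readingWord T)) (cong (substitute ρ) (lookup-position-word T x))
      where ρ = d̃Rule i (subword i (readingWord T))

    module _ {x y z} (x≺y : x ≺ y) (y≺z : y ≺ z) (perm : x ∷ y ∷ z ∷ [] ↭ cells₃) where

      private
        x≺z : x ≺ z
        x≺z = ≺-trans {x} {y} {z} x≺y y≺z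
        x≤y = proj₁ (≺⇒precedes x≺y)
        y≤z = proj₁ (≺⇒precedes y≺z)
        ∈-xyz : ∀ {c} → c ∈ cells₃ → c ∈ x ∷ y ∷ z ∷ []
        ∈-xyz = ∈-resp-↭ (↭-sym perm)
        open Letters i {filling T x} {filling T y} {filling T z}
          (≺⇒≢ x≺y ∘ filling-injective T) (≺⇒≢ y≺z ∘ filling-injective T) (≺⇒≢ x≺z ∘ filling-injective T) public

      Acts : (m₁ m₂ m₃ : Fin n) → Set
      Acts m₁ m₂ m₃ = D i T x ≡ m₁ × D i T y ≡ m₂ × D i T z ≡ m₃ ×
                      (∀ c → ¬ c ∈ cells₃ → D i T c ≡ filling T c)

      maps⇒acts : ∀ {ρ m₁ m₂ m₃} → (∀ c → D i T c ≡ substitute ρ (filling T c)) →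
                  Maps ρ (filling T x) (filling T y) (filling T z) m₁ m₂ m₃ → Acts m₁ m₂ m₃
      maps⇒acts eq (maps e₁ e₂ e₃ e) = trans (eq x) e₁ , trans (eq y) e₂ , trans (eq z) e₃ , λ c c∉ →
        trans (eq c) (e (filling T c)
          (λ p → c∉ (∈-resp-↭ perm (here (filling-injective T p))))
          (λ p → c∉ (∈-resp-↭ perm (there (here (filling-injective T p)))))
          (λ p → c∉ (∈-resp-↭ perm (there (there (here (filling-injective T p)))))))

      -- Shifted content weakly increases in reading order, so the outer two cells attain the
      -- maximal distance, whichever of the three entries they hold.
      diameter≡ : diameter ≡ distance x z
      diameter≡ = ℕ.≤-antisym
        (ℕ.⊔-lub (ℕ.⊔-lub (inside p s) (inside s u)) (inside p u))
        (pairwise-≤ d₁≤ d₂≤ (ℕ.m≤n⊔m (d₁ ⊔ d₂) d₃)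
          (∈-resp-↭ perm (here refl)) (∈-resp-↭ perm (there (there (here refl)))))
        where
        inside : ∀ {u v} → u ∈ x ∷ y ∷ z ∷ [] → v ∈ x ∷ y ∷ z ∷ [] → distance u v ≤ distance x z
        inside = pairwise-≤ (distance-≤ˡ {x} {y} {z} x≤y y≤z) (distance-≤ʳ {x} {y} {z} x≤y y≤z) ℕ.≤-refl
        p = ∈-xyz (here refl)
        s = ∈-xyz (there (here refl))
        u = ∈-xyz (there (there (here refl)))
        d₁ = distance predᶜ selfᶜ
        d₂ = distance selfᶜ succᶜ
        d₃ = distance predᶜ succᶜ
        d₁≤ : d₁ ≤ diameter
        d₁≤ = ℕ.≤-trans (ℕ.m≤m⊔n d₁ d₂) (ℕ.m≤m⊔n (d₁ ⊔ d₂) d₃)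
        d₂≤ : d₂ ≤ diameter
        d₂≤ = ℕ.≤-trans (ℕ.m≤n⊔m d₁ d₂) (ℕ.m≤m⊔n (d₁ ⊔ d₂) d₃)

      letters = subword-sorted x≺y y≺z perm

      acts-far : ∀ {m₁ m₂ m₃} → ¬ Near x z →
                 Maps (dRule i (filling T x ∷ filling T y ∷ filling T z ∷ [])) (filling T x) (filling T y) (filling T z) m₁ m₂ m₃ →
                 Acts m₁ m₂ m₃
      acts-far far = maps⇒acts λ c → trans (D-far (subst (k <_) (sym diameter≡) (ℕ.≰⇒> far)) c)
        (cong (λ l → substitute (dRule i l) (filling T c)) letters)

      acts-near : ∀ {m₁ m₂ m₃} → Near x z →
                  Maps (d̃Rule i (filling T x ∷ filling T y ∷ filling T z ∷ [])) (filling T x) (filling T y) (filling T z) m₁ m₂ m₃ →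
                  Acts m₁ m₂ m₃
      acts-near near = maps⇒acts λ c → trans (D-near (λ far → ℕ.<⇒≱ (subst (k <_) diameter≡ far) near) c)
        (cong (λ l → substitute (d̃Rule i l) (filling T c)) letters)

      acts-middle : self# i ≡ filling T y → Acts (filling T x) (filling T y) (filling T z)
      acts-middle eq with near? x z
      ... | yes near = acts-near near (d̃-middle eq)
      ... | no far   = acts-far far (d-middle eq)

    p#≢s# : pred# i ≢ self# i
    p#≢s# eq = ℕ.1+n≢n (sym (trans (cong toℕ eq) (toℕ-self# i)))

    s#≢u# : self# i ≢ succ# i
    s#≢u# eq = ℕ.1+n≢n (sym (trans (sym (toℕ-self# i)) (trans (cong toℕ eq) (toℕ-succ# i))))

    p#≢u# : pred# i ≢ succ# i
    p#≢u# eq = ℕ.<⇒≢ (ℕ.m≤n⇒m≤1+n ℕ.≤-refl) (trans (cong toℕ eq) (toℕ-succ# i))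

    cellOf-≢ : ∀ {e f} → e ≢ f → cellOf T e ≢ cellOf T f
    cellOf-≢ e≢f = e≢f ∘ cellOf-injective T

    rotationᵀ : Rotation predᶜ selfᶜ succᶜ (rotateᶜ predᶜ selfᶜ succᶜ)
    rotationᵀ = rotation (cellOf-≢ p#≢s#) (cellOf-≢ s#≢u#) (cellOf-≢ p#≢u#)

    record Rotated (f : Cell 𝛍 → Fin n) (t : Cell 𝛍 × Cell 𝛍 × Cell 𝛍) : Set where
      constructor rotatedBy
      field
        at-pred : f (proj₁ t) ≡ pred# i
        at-self : f (proj₁ (proj₂ t)) ≡ self# i
        at-succ : f (proj₂ (proj₂ t)) ≡ succ# i
        off     : ∀ c → ¬ c ∈ cells₃ → f c ≡ filling T c

    private
      P S U : Cell 𝛍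
      P = predᶜ
      S = selfᶜ
      U = succᶜ
      P≡ : filling T P ≡ pred# i
      P≡ = filling-cellOf T _
      S≡ : filling T S ≡ self# i
      S≡ = filling-cellOf T _
      U≡ : filling T U ≡ succ# i
      U≡ = filling-cellOf T _
      infixr 4 _∙_
      _∙_ : ∀ {c e f} → D i T c ≡ e → e ≡ f → D i T c ≡ f
      _∙_ = trans
      -- The names of these permutations spell the reading order of the cells of i-1, i and i+1.
      -- Where S comes last or first, the rules for i as last or first letter apply.
      psu : P ∷ S ∷ U ∷ [] ↭ P ∷ S ∷ U ∷ []
      psu = ↭-refl
      usp : U ∷ S ∷ P ∷ [] ↭ P ∷ S ∷ U ∷ []
      usp = ↭-trans (swap U S ↭-refl) (↭-trans (prep S (swap U P ↭-refl)) (swap S P ↭-refl))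
      pus : P ∷ U ∷ S ∷ [] ↭ P ∷ S ∷ U ∷ []
      pus = prep P (swap U S ↭-refl)
      ups : U ∷ P ∷ S ∷ [] ↭ P ∷ S ∷ U ∷ []
      ups = ↭-trans (swap U P ↭-refl) pus
      spu : S ∷ P ∷ U ∷ [] ↭ P ∷ S ∷ U ∷ []
      spu = swap S P ↭-refl
      sup : S ∷ U ∷ P ∷ [] ↭ P ∷ S ∷ U ∷ []
      sup = ↭-trans (prep S (swap U P ↭-refl)) spu

    rotated : ∀ {t} → Rotation P S U t → Rotated (D i T) t
    rotated (fixed↑ p q) = let (e₁ , e₂ , e₃ , e) = acts-middle p q psu (sym S≡)
      in rotatedBy (e₁ ∙ P≡) (e₂ ∙ S≡) (e₃ ∙ U≡) e
    rotated (fixed↓ p q) = let (e₁ , e₂ , e₃ , e) = acts-middle p q usp (sym S≡)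
      in rotatedBy (e₃ ∙ P≡) (e₂ ∙ S≡) (e₁ ∙ U≡) e
    rotated (near₁ p q c) = let (e₁ , e₂ , e₃ , e) = acts-near p q pus c (d̃-last p q pus (sym S≡))
      in rotatedBy (e₂ ∙ P≡) (e₁ ∙ S≡) (e₃ ∙ U≡) e
    rotated (far₁ p q c) = let (e₁ , e₂ , e₃ , e) = acts-far p q pus c (d-last p q pus (sym S≡))
      in rotatedBy (e₃ ∙ P≡) (e₁ ∙ S≡) (e₂ ∙ U≡) e
    rotated (near₂ p q c) = let (e₁ , e₂ , e₃ , e) = acts-near p q ups c (d̃-last p q ups (sym S≡))
      in rotatedBy (e₃ ∙ P≡) (e₁ ∙ S≡) (e₂ ∙ U≡) e
    rotated (far₂ p q c) = let (e₁ , e₂ , e₃ , e) = acts-far p q ups c (d-last p q ups (sym S≡))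
      in rotatedBy (e₂ ∙ P≡) (e₁ ∙ S≡) (e₃ ∙ U≡) e
    rotated (near₃ p q c) = let (e₁ , e₂ , e₃ , e) = acts-near p q spu c (d̃-first p q spu (sym S≡))
      in rotatedBy (e₁ ∙ P≡) (e₃ ∙ S≡) (e₂ ∙ U≡) e
    rotated (far₃ p q c) = let (e₁ , e₂ , e₃ , e) = acts-far p q spu c (d-first p q spu (sym S≡))
      in rotatedBy (e₂ ∙ P≡) (e₃ ∙ S≡) (e₁ ∙ U≡) e
    rotated (near₄ p q c) = let (e₁ , e₂ , e₃ , e) = acts-near p q sup c (d̃-first p q sup (sym S≡))
      in rotatedBy (e₂ ∙ P≡) (e₃ ∙ S≡) (e₁ ∙ U≡) e
    rotated (far₄ p q c) = let (e₁ , e₂ , e₃ , e) = acts-far p q sup c (d-first p q sup (sym S≡))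
      in rotatedBy (e₁ ∙ P≡) (e₃ ∙ S≡) (e₂ ∙ U≡) e

  infix 4 _≈_
  _≈_ : SYT 𝛍 n → SYT 𝛍 n → Set
  T ≈ U = ∀ x → filling T x ≡ filling U x

  ≈⇒cellOf : ∀ {T U} → T ≈ U → ∀ e → cellOf T e ≡ cellOf U e
  ≈⇒cellOf {T} {U} T≈U e = cellOf-filling T (trans (T≈U (cellOf U e)) (filling-cellOf U e))

  cellOf⇒≈ : ∀ {T U} → (∀ e → cellOf T e ≡ cellOf U e) → T ≈ U
  cellOf⇒≈ {T} {U} eq x = trans (sym (cong (filling T) (trans (eq (filling U x)) (cellOf-filling U refl)))) (filling-cellOf T (filling U x))

  triple : Interior n → SYT 𝛍 n → Cell 𝛍 × Cell 𝛍 × Cell 𝛍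
  triple i T = predᶜ i T , selfᶜ i T , succᶜ i T

  rotateᵗ : Cell 𝛍 × Cell 𝛍 × Cell 𝛍 → Cell 𝛍 × Cell 𝛍 × Cell 𝛍
  rotateᵗ (a , b , c) = rotateᶜ a b c

-- Standardness, involutivity and commutation of the operators

module Operators {k n : ℕ} (𝛍 : Fin k → SkewShape) (size≡n : size 𝛍 ≡ n) where

  open Tableaux 𝛍 size≡n public

  module _ (i : Interior n) (T : SYT 𝛍 n) where

    private
      P S U : Cell 𝛍
      P = predᶜ i T
      S = selfᶜ i T
      U = succᶜ i T
      PSU : List (Cell 𝛍)
      PSU = P ∷ S ∷ U ∷ []
      t : ℕ
      t = toℕ (pred# i)
      open DecMembership _≟ᶜ_ using (_∈?_)
      fP : toℕ (filling T P) ≡ t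
      fP = cong toℕ (filling-cellOf T (pred# i))
      fS : toℕ (filling T S) ≡ 1 + t
      fS = trans (cong toℕ (filling-cellOf T (self# i))) (toℕ-self# i)
      fU : toℕ (filling T U) ≡ 2 + t
      fU = trans (cong toℕ (filling-cellOf T (succ# i))) (toℕ-succ# i)

      InWindow : ℕ → Set
      InWindow v = t ≤ v × v ≤ 2 + t

      inside : ∀ {c} → c ∈ PSU → InWindow (toℕ (filling T c))
      inside (here refl)                 = ℕ.≤-reflexive (sym fP) , ℕ.≤-trans (ℕ.≤-reflexive fP) (ℕ.m≤n+m t 2)
      inside (there (here refl))         = ℕ.≤-trans (ℕ.m≤n+m t 1) (ℕ.≤-reflexive (sym fS)) , ℕ.≤-trans (ℕ.≤-reflexive fS) (ℕ.n≤1+n (1 + t))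
      inside (there (there (here refl))) = ℕ.≤-trans (ℕ.m≤n+m t 2) (ℕ.≤-reflexive (sym fU)) , ℕ.≤-reflexive fU

      outside : ∀ {c} → ¬ c ∈ PSU → toℕ (filling T c) < t ⊎ 2 + t < toℕ (filling T c)
      outside {c} c∉ with ℕ.<-cmp (toℕ (filling T c)) (1 + t)
      ... | tri≈ _ eq _ = contradiction (there (here (filling-injective T (Fin.toℕ-injective (trans eq (sym fS)))))) c∉
      ... | tri< (s≤s lt) _ _ with ℕ.m≤n⇒m<n∨m≡n lt
      ...   | inj₁ lt′ = inj₁ lt′
      ...   | inj₂ eq  = contradiction (here (filling-injective T (Fin.toℕ-injective (trans eq (sym fP))))) c∉
      outside {c} c∉ | tri> _ _ gt with ℕ.m≤n⇒m<n∨m≡n gt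
      ...   | inj₁ gt′ = inj₂ gt′
      ...   | inj₂ eq  = contradiction (there (there (here (filling-injective T (Fin.toℕ-injective (trans (sym eq) (sym fU))))))) c∉

      Monotone : ℕ → ℕ → ℕ → Set
      Monotone vP vS vU = InWindow vP × InWindow vS × InWindow vU ×
                          (P ⊏ S → vP < vS) × (S ⊏ U → vS < vU) × (P ⊏ U → vP < vU)

      -- The three cells keep values in the window t, ..., t+2, which `T` avoids elsewhere, so every
      -- comparison with another cell survives. Only the three pairs inside remain to be compared.
      order : (f : Cell 𝛍 → Fin n) → ∀ {vP vS vU} → toℕ (f P) ≡ vP → toℕ (f S) ≡ vS → toℕ (f U) ≡ vU → Monotone vP vS vU →
              (∀ c → ¬ c ∈ PSU → f c ≡ filling T c) → ∀ {x y} → x ⊏ y → f x Fin.< f y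
      order f refl refl refl (wP , wS , wU , PS , SU , PU) off {x} {y} x⊏y = cases (x ∈? PSU) (y ∈? PSU)
        where
        window : ∀ {c} → c ∈ PSU → InWindow (toℕ (f c))
        window (here refl)                 = wP
        window (there (here refl))         = wS
        window (there (there (here refl))) = wU
        below : y ∈ PSU → toℕ (filling T x) < t ⊎ 2 + t < toℕ (filling T x) → toℕ (filling T x) < t
        below y∈ (inj₁ lt) = lt
        below y∈ (inj₂ gt) = contradiction (ℕ.<-trans gt (ℕ.<-≤-trans (entry-< T x⊏y) (proj₂ (inside y∈)))) (ℕ.<-irrefl refl)
        above : x ∈ PSU → toℕ (filling T y) < t ⊎ 2 + t < toℕ (filling T y) → 2 + t < toℕ (filling T y)
        above x∈ (inj₁ lt) = contradiction (ℕ.<-trans (ℕ.≤-<-trans (proj₁ (inside x∈)) (entry-< T x⊏y)) lt) (ℕ.<-irrefl refl)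
        above x∈ (inj₂ gt) = gt
        reversed : ∀ {u v} {A : Set} → toℕ (filling T v) ≤ toℕ (filling T u) → u ⊏ v → A
        reversed v≤u u⊏v = contradiction (entry-< T u⊏v) (ℕ.≤⇒≯ v≤u)
        both : ∀ {u v} → u ∈ PSU → v ∈ PSU → u ⊏ v → f u Fin.< f v
        both (here refl) (here refl)                                 = reversed ℕ.≤-refl
        both (here refl) (there (here refl))                         = PS
        both (here refl) (there (there (here refl)))                 = PU
        both (there (here refl)) (here refl)                         = reversed (subst₂ _≤_ (sym fP) (sym fS) (ℕ.n≤1+n t))
        both (there (here refl)) (there (here refl))                 = reversed ℕ.≤-refl
        both (there (here refl)) (there (there (here refl)))         = SU
        both (there (there (here refl))) (here refl)                 = reversed (subst₂ _≤_ (sym fP) (sym fU) (ℕ.m≤n+m t 2))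
        both (there (there (here refl))) (there (here refl))         = reversed (subst₂ _≤_ (sym fS) (sym fU) (ℕ.n≤1+n (1 + t)))
        both (there (there (here refl))) (there (there (here refl))) = reversed ℕ.≤-refl
        cases : Dec (x ∈ PSU) → Dec (y ∈ PSU) → f x Fin.< f y
        cases (no x∉)  (no y∉)  = subst₂ Fin._<_ (sym (off x x∉)) (sym (off y y∉)) (entry-< T x⊏y)
        cases (no x∉)  (yes y∈) = subst (Fin._< f y) (sym (off x x∉)) (ℕ.<-≤-trans (below y∈ (outside x∉)) (proj₁ (window y∈)))
        cases (yes x∈) (no y∉)  = subst (f x Fin.<_) (sym (off y y∉)) (ℕ.≤-<-trans (proj₂ (window x∈)) (above x∈ (outside y∉)))
        cases (yes x∈) (yes y∈) = both x∈ y∈ x⊏y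

      wt₀ : InWindow t
      wt₀ = ℕ.≤-refl , ℕ.m≤n+m t 2
      wt₁ : InWindow (1 + t)
      wt₁ = ℕ.m≤n+m t 1 , ℕ.n≤1+n (1 + t)
      wt₂ : InWindow (2 + t)
      wt₂ = ℕ.m≤n+m t 2 , ℕ.≤-refl
      0<1 : t < 1 + t
      0<1 = ℕ.n<1+n t
      1<2 : 1 + t < 2 + t
      1<2 = ℕ.n<1+n (1 + t)
      0<2 : t < 2 + t
      0<2 = ℕ.<-trans 0<1 1<2

      PS-far : ¬ Near P S → ∀ {A : Set} → P ⊏ S → A
      PS-far far P⊏S = contradiction (consecutive-distance T P⊏S (trans fS (cong suc (sym fP)))) far
      SU-far : ¬ Near S U → ∀ {A : Set} → S ⊏ U → A
      SU-far far S⊏U = contradiction (consecutive-distance T S⊏U (trans fU (cong suc (sym fS)))) far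
      far-sym : ∀ x y → ¬ Near x y → ¬ Near y x
      far-sym x y far near = far (subst (_≤ k) (distance-sym y x) near)

      close-entries : ∀ {x y} → x ∈ PSU → y ∈ PSU → toℕ (filling T x) ≤ 2 + toℕ (filling T y)
      close-entries x∈ y∈ = ℕ.≤-trans (proj₂ (inside x∈)) (ℕ.+-monoʳ-≤ 2 (proj₁ (inside y∈)))

      P∈ : P ∈ PSU
      P∈ = here refl
      S∈ : S ∈ PSU
      S∈ = there (here refl)
      U∈ : U ∈ PSU
      U∈ = there (there (here refl))

      incomparable : ∀ {l m h} → l ∈ PSU → m ∈ PSU → h ∈ PSU →
                     l ≺ m → m ≺ h → Near l h →
                     (∀ {A : Set} → l ⊏ m → A) × (∀ {A : Set} → m ⊏ l → A) × (∀ {A : Set} → m ⊏ h → A) × (∀ {A : Set} → h ⊏ m → A)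
      incomparable {l} {m} {h} l∈ m∈ h∈ l≺m m≺h near =
        (λ c → contradiction (⊏⇒Comparable c) (proj₁ inc)) , (λ c → contradiction (Comparable-sym (⊏⇒Comparable c)) (proj₁ inc)) ,
        (λ c → contradiction (⊏⇒Comparable c) (proj₂ inc)) , (λ c → contradiction (Comparable-sym (⊏⇒Comparable c)) (proj₂ inc))
        where
        inc = middle-incomparable T {l} {m} {h} l≺m m≺h near (close-entries l∈ m∈) (close-entries h∈ m∈) (close-entries m∈ l∈)

      val : ∀ {e} → e ≡ pred# i → toℕ e ≡ t
      val = cong toℕ
      val₁ : ∀ {e} → e ≡ self# i → toℕ e ≡ 1 + t
      val₁ eq = trans (cong toℕ eq) (toℕ-self# i)
      val₂ : ∀ {e} → e ≡ succ# i → toℕ e ≡ 2 + t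
      val₂ eq = trans (cong toℕ eq) (toℕ-succ# i)

    -- The 3-cycle of d̃ reverses exactly the two pairs that involve the middle cell, which is
    -- incomparable to the others. The swap of d reverses only the swapped pair, whose entries are
    -- consecutive and whose cells are more than k apart.
    rotated-increasing : ∀ f {t} → Rotation P S U t → Rotated i T f t → ∀ {x y} → x ⊏ y → f x Fin.< f y
    rotated-increasing f (fixed↑ p q) (rotatedBy e₁ e₂ e₃ e) = order f (val e₁) (val₁ e₂) (val₂ e₃)
      (wt₀ , wt₁ , wt₂ , (λ _ → 0<1) , (λ _ → 1<2) , (λ _ → 0<2)) e
    rotated-increasing f (fixed↓ p q) (rotatedBy e₁ e₂ e₃ e) = order f (val e₁) (val₁ e₂) (val₂ e₃)
      (wt₀ , wt₁ , wt₂ , (λ _ → 0<1) , (λ _ → 1<2) , (λ _ → 0<2)) e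
    rotated-increasing f (near₁ p q n) (rotatedBy e₁ e₂ e₃ e) = let (PU , _ , _ , SU) = incomparable P∈ U∈ S∈ p q n in
      order f (val₁ e₂) (val₂ e₃) (val e₁) (wt₁ , wt₂ , wt₀ , (λ _ → 1<2) , SU , PU) e
    rotated-increasing f (far₁ p q n) (rotatedBy e₁ e₂ e₃ e) =
      order f (val₁ e₂) (val e₁) (val₂ e₃) (wt₁ , wt₀ , wt₂ , PS-far n , (λ _ → 0<2) , (λ _ → 1<2)) e
    rotated-increasing f (near₂ p q n) (rotatedBy e₁ e₂ e₃ e) = let (_ , PU , PS , _) = incomparable U∈ P∈ S∈ p q n in
      order f (val₂ e₃) (val e₁) (val₁ e₂) (wt₂ , wt₀ , wt₁ , PS , (λ _ → 0<1) , PU) e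
    rotated-increasing f (far₂ p q n) (rotatedBy e₁ e₂ e₃ e) =
      order f (val e₁) (val₂ e₃) (val₁ e₂) (wt₀ , wt₂ , wt₁ , (λ _ → 0<2) , SU-far (far-sym U S n) , (λ _ → 0<1)) e
    rotated-increasing f (near₃ p q n) (rotatedBy e₁ e₂ e₃ e) = let (_ , PS , PU , _) = incomparable S∈ P∈ U∈ p q n in
      order f (val₂ e₃) (val e₁) (val₁ e₂) (wt₂ , wt₀ , wt₁ , PS , (λ _ → 0<1) , PU) e
    rotated-increasing f (far₃ p q n) (rotatedBy e₁ e₂ e₃ e) =
      order f (val e₁) (val₂ e₃) (val₁ e₂) (wt₀ , wt₂ , wt₁ , (λ _ → 0<2) , SU-far n , (λ _ → 0<1)) e
    rotated-increasing f (near₄ p q n) (rotatedBy e₁ e₂ e₃ e) = let (SU , _ , _ , PU) = incomparable S∈ U∈ P∈ p q n in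
      order f (val₁ e₂) (val₂ e₃) (val e₁) (wt₁ , wt₂ , wt₀ , (λ _ → 1<2) , SU , PU) e
    rotated-increasing f (far₄ p q n) (rotatedBy e₁ e₂ e₃ e) =
      order f (val₁ e₂) (val e₁) (val₂ e₃) (wt₁ , wt₀ , wt₂ , PS-far (far-sym S P n) , (λ _ → 0<2) , (λ _ → 1<2)) e

    private
      data Location (e : Fin n) : Set where
        is-pred : e ≡ pred# i → Location e
        is-self : e ≡ self# i → Location e
        is-succ : e ≡ succ# i → Location e
        is-none : ¬ cellOf T e ∈ PSU → Location e

      locate : ∀ e → Location e
      locate e with cellOf T e ∈? PSU
      ... | no ∉                           = is-none ∉
      ... | yes (here eq)                  = is-pred (cellOf-injective T eq)
      ... | yes (there (here eq))          = is-self (cellOf-injective T eq)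
      ... | yes (there (there (here eq)))  = is-succ (cellOf-injective T eq)

    module _ (f : Cell 𝛍 → Fin n) {t} (rot : Rotation P S U t) (fᵣ : Rotated i T f t) where

      rotated-preimage : ∀ e → ∃[ c ] f c ≡ e
      rotated-preimage e with locate e
      ... | is-pred refl = _ , Rotated.at-pred fᵣ
      ... | is-self refl = _ , Rotated.at-self fᵣ
      ... | is-succ refl = _ , Rotated.at-succ fᵣ
      ... | is-none ∉    = _ , trans (Rotated.off fᵣ _ ∉) (filling-cellOf T e)

      -- By counting: composed with `cellOf T`, the filling f is a self-map of Fin n that has a
      -- section.
      rotated-injective : ∀ x y → f x ≡ f y → x ≡ y
      rotated-injective x y eq = filling-injective T
        (trans (sym (source x)) (trans (cong (λ e → filling T (proj₁ (rotated-preimage e))) eq) (source y)))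
        where
        source : ∀ x → filling T (proj₁ (rotated-preimage (f x))) ≡ filling T x
        source x = subst (λ c → filling T (proj₁ (rotated-preimage (f c))) ≡ filling T x) (cellOf-filling T refl)
          (surjective⇒injective (λ e → f (cellOf T e)) ℕ.≤-refl (λ e → filling T (proj₁ (rotated-preimage e)))
            (λ e → trans (cong f (cellOf-filling T refl)) (proj₂ (rotated-preimage e))) (filling T x))

      rotated-standard : IsSYT 𝛍 f
      rotated-standard = record
        { bijective      = (λ {x} {y} → rotated-injective x y) , λ e → let (c , eq) = rotated-preimage e in c , λ { refl → eq }
        ; row-increasing = λ x y i≡ b≡ a< → rotated-increasing f rot fᵣ {x} {y} (inRow (i≡ , b≡ , a<))
        ; col-increasing = λ x y i≡ a≡ b< → rotated-increasing f rot fᵣ {x} {y} (inCol (i≡ , a≡ , b<))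
        }

    D-standard : IsSYT 𝛍 (D i T)
    D-standard = rotated-standard (D i T) (rotationᵀ i T) (rotated i T (rotationᵀ i T))

  φ : Interior n → SYT 𝛍 n → SYT 𝛍 n
  φ i T = syt (D i T) (D-standard i T)

  -- Together with `φ-off` this describes φ by the cells that the entries occupy. Congruence,
  -- involutivity and commutation are derived from this description, entry by entry, without
  -- returning to words.
  φ-triple : ∀ i T → triple i (φ i T) ≡ rotateᵗ (triple i T)
  φ-triple i T = cong₂ _,_ (at at-pred) (cong₂ _,_ (at at-self) (at at-succ))
    where
    open Rotated (rotated i T (rotationᵀ i T))
    at : ∀ {c e} → D i T c ≡ e → cellOf (φ i T) e ≡ c
    at = cellOf-filling (φ i T)

  φ-off : ∀ i T {e} → e ≢ pred# i → e ≢ self# i → e ≢ succ# i → cellOf (φ i T) e ≡ cellOf T e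
  φ-off i T {e} e≢p e≢s e≢u = cellOf-filling (φ i T)
    (trans (Rotated.off (rotated i T (rotationᵀ i T)) _ ∉) (filling-cellOf T e))
    where
    ∉ : ¬ cellOf T e ∈ predᶜ i T ∷ selfᶜ i T ∷ succᶜ i T ∷ []
    ∉ (here eq)                 = e≢p (cellOf-injective T eq)
    ∉ (there (here eq))         = e≢s (cellOf-injective T eq)
    ∉ (there (there (here eq))) = e≢u (cellOf-injective T eq)

  at-triple : ∀ i {T U} → triple i T ≡ triple i U → ∀ e →
              (e ≢ pred# i → e ≢ self# i → e ≢ succ# i → cellOf T e ≡ cellOf U e) → cellOf T e ≡ cellOf U e
  at-triple i {T} {U} eq e off with e Fin.≟ pred# i | e Fin.≟ self# i | e Fin.≟ succ# i
  ... | yes refl | _        | _        = cong proj₁ eq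
  ... | no _     | yes refl | _        = cong (proj₁ ∘ proj₂) eq
  ... | no _     | no _     | yes refl = cong (proj₂ ∘ proj₂) eq
  ... | no ≢p    | no ≢s    | no ≢u    = off ≢p ≢s ≢u

  φ-cong : ∀ i {T U} → T ≈ U → φ i T ≈ φ i U
  φ-cong i {T} {U} T≈U = cellOf⇒≈ {φ i T} {φ i U} λ e → at-triple i {φ i T} {φ i U}
    (trans (φ-triple i T) (trans (cong rotateᵗ (cong₂ _,_ (same _) (cong₂ _,_ (same _) (same _)))) (sym (φ-triple i U)))) e
    (λ p s u → trans (φ-off i T p s u) (trans (same e) (sym (φ-off i U p s u))))
    where
    same = ≈⇒cellOf {T} {U} T≈U

  rotate-involutive : ∀ {a b c} → a ≢ b → b ≢ c → a ≢ c → rotateᵗ (rotateᶜ a b c) ≡ (a , b , c)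
  rotate-involutive a≢b b≢c a≢c = rotate-unique (λ {x} {y} {z} → ≺-trans {x} {y} {z})
    (rotation-inverse (rotation a≢b b≢c a≢c))

  φ-involutive : ∀ i T → φ i (φ i T) ≈ T
  φ-involutive i T = cellOf⇒≈ {φ i (φ i T)} {T} λ e → at-triple i {φ i (φ i T)} {T}
    (trans (φ-triple i (φ i T)) (trans (cong rotateᵗ (φ-triple i T))
      (rotate-involutive (cellOf-≢ i T (p#≢s# i T)) (cellOf-≢ i T (s#≢u# i T)) (cellOf-≢ i T (p#≢u# i T))))) e
    (λ p s u → trans (φ-off i (φ i T) p s u) (φ-off i T p s u))

  private
    Disjoint : Interior n → Interior n → Set
    Disjoint i j = ∀ {e} → (e ≡ pred# i ⊎ e ≡ self# i ⊎ e ≡ succ# i) → e ≢ pred# j × e ≢ self# j × e ≢ succ# j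

    disjoint : ∀ i j → idx i + 3 ≤ idx j → Disjoint i j × Disjoint j i
    disjoint i j gap = (λ e∈ → (λ e≡ → apart e∈ (inj₁ e≡)) , (λ e≡ → apart e∈ (inj₂ (inj₁ e≡))) , λ e≡ → apart e∈ (inj₂ (inj₂ e≡))) ,
                       (λ e∈ → (λ e≡ → apart (inj₁ e≡) e∈) , (λ e≡ → apart (inj₂ (inj₁ e≡)) e∈) , λ e≡ → apart (inj₂ (inj₂ e≡)) e∈)
      where
      gap′ : toℕ (pred# i) + 3 ≤ toℕ (pred# j)
      gap′ = ℕ.+-cancelˡ-≤ 2 _ _ (subst₂ (λ a b → a + 3 ≤ b) (sym (toℕ-pred# i)) (sym (toℕ-pred# j)) gap)
      high : ∀ {e} → (e ≡ pred# i ⊎ e ≡ self# i ⊎ e ≡ succ# i) → toℕ e < 3 + toℕ (pred# i)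
      high (inj₁ refl)        = ℕ.m≤n+m _ 2
      high (inj₂ (inj₁ refl)) = subst (_< 3 + toℕ (pred# i)) (sym (toℕ-self# i)) (ℕ.m≤n+m _ 1)
      high (inj₂ (inj₂ refl)) = subst (_< 3 + toℕ (pred# i)) (sym (toℕ-succ# i)) ℕ.≤-refl
      low : ∀ {e} → (e ≡ pred# j ⊎ e ≡ self# j ⊎ e ≡ succ# j) → toℕ (pred# j) ≤ toℕ e
      low (inj₁ refl)        = ℕ.≤-refl
      low (inj₂ (inj₁ refl)) = subst (toℕ (pred# j) ≤_) (sym (toℕ-self# j)) (ℕ.n≤1+n _)
      low (inj₂ (inj₂ refl)) = subst (toℕ (pred# j) ≤_) (sym (toℕ-succ# j)) (ℕ.m≤n+m _ 2)
      apart : ∀ {e} {A : Set} → (e ≡ pred# i ⊎ e ≡ self# i ⊎ e ≡ succ# i) → (e ≡ pred# j ⊎ e ≡ self# j ⊎ e ≡ succ# j) → A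
      apart e∈ e∈′ = contradiction (ℕ.≤-trans (high e∈) (ℕ.≤-trans (subst (_≤ toℕ (pred# j)) (ℕ.+-comm (toℕ (pred# i)) 3) gap′) (low e∈′))) (ℕ.<-irrefl refl)

    φ-other : ∀ i j T → Disjoint i j → triple i (φ j T) ≡ triple i T
    φ-other i j T dis = cong₂ _,_ (off (inj₁ refl)) (cong₂ _,_ (off (inj₂ (inj₁ refl))) (off (inj₂ (inj₂ refl))))
      where
      off : ∀ {e} → (e ≡ pred# i ⊎ e ≡ self# i ⊎ e ≡ succ# i) → cellOf (φ j T) e ≡ cellOf T e
      off e∈ = let (p , s , u) = dis e∈ in φ-off j T p s u

    commute : ∀ i j T → Disjoint i j → Disjoint j i → φ i (φ j T) ≈ φ j (φ i T)
    commute i j T dᵢ dⱼ = cellOf⇒≈ {φ i (φ j T)} {φ j (φ i T)} λ e → at-triple i {φ i (φ j T)} {φ j (φ i T)}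
      (trans (φ-triple i (φ j T)) (trans (cong rotateᵗ (φ-other i j T dᵢ))
        (sym (trans (φ-other i j (φ i T) dᵢ) (φ-triple i T))))) e
      (λ p s u → trans (φ-off i (φ j T) p s u) (at-triple j {φ j T} {φ j (φ i T)}
         (trans (φ-triple j T) (trans (cong rotateᵗ (sym (φ-other j i T dⱼ))) (sym (φ-triple j (φ i T))))) e
         (λ p′ s′ u′ → trans (φ-off j T p′ s′ u′) (sym (trans (φ-off j (φ i T) p′ s′ u′) (φ-off i T p s u))))))

  φ-commute : ∀ i j → 3 ≤ ℕ.∣ idx i - idx j ∣ → ∀ T → φ i (φ j T) ≈ φ j (φ i T)
  φ-commute i j gap T = [ (λ i≤j → let dis = disjoint i j (far-indices i≤j gap) in commute i j T (proj₁ dis) (proj₂ dis))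
                        , (λ j≤i → let dis = disjoint j i (far-indices j≤i (subst (3 ≤_) (ℕ.∣-∣-comm (idx i) (idx j)) gap))
                                   in commute i j T (proj₂ dis) (proj₁ dis))
                        ]′ (ℕ.≤-total (idx i) (idx j))
    where
    far-indices : ∀ {a b} → a ≤ b → 3 ≤ ℕ.∣ a - b ∣ → a + 3 ≤ b
    far-indices {a} {b} a≤b gap = subst (a + 3 ≤_) (ℕ.m+[n∸m]≡n a≤b)
      (ℕ.+-monoʳ-≤ a (subst (3 ≤_) (ℕ.m≤n⇒∣m-n∣≡n∸m a≤b) gap))

  Des-cong : ∀ {T U} → T ≈ U → Des T ≡ Des U
  Des-cong {T} {U} T≈U = lookup-extensional λ j → trans (lookup-Des T j)
    (trans (cong₂ (λ x y → does (x ≺? y)) (≈⇒cellOf {T} {U} T≈U (upper j)) (≈⇒cellOf {T} {U} T≈U (lower j)))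
           (sym (lookup-Des U j)))

-- Transfer of the finite check to tableaux

≡ᵇ-true : ∀ {m n} → m ≡ n → (m ≡ᵇ n) ≡ true
≡ᵇ-true {m} refl with m ≡ᵇ m | ℕ.≡⇒≡ᵇ m m refl
... | true | _ = refl

≡ᵇ-false : ∀ {m n} → m ≢ n → (m ≡ᵇ n) ≡ false
≡ᵇ-false {m} {n} m≢n with m ≡ᵇ n | ℕ.≡ᵇ⇒≡ m n
... | true  | eq = contradiction (eq tt) m≢n
... | false | _  = refl

Injective : ∀ {X : Set} {n} → Vec X n → Set
Injective v = ∀ {i j} → lookup v i ≡ lookup v j → i ≡ j

before-true : ∀ {n} (v : Vec ℕ n) → Injective v → ∀ {i j} → i Fin.< j → before (lookup v i) (lookup v j) v ≡ true
before-true (z ∷ v) inj {zero} {suc j} _ rewrite ≡ᵇ-true {z} {z} refl = refl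
before-true (z ∷ v) inj {suc i} {suc j} (s≤s i<j)
  rewrite ≡ᵇ-false {z} {lookup v i} ((λ ()) ∘ inj {zero} {suc i})
        | ≡ᵇ-false {z} {lookup v j} ((λ ()) ∘ inj {zero} {suc j}) =
  before-true v (λ eq → suc-injective (inj eq)) i<j
  where open import Data.Fin.Properties using (suc-injective)

before-false : ∀ {n} (v : Vec ℕ n) → Injective v → ∀ {i j} → j Fin.< i → before (lookup v i) (lookup v j) v ≡ false
before-false (z ∷ v) inj {suc i} {zero} _
  rewrite ≡ᵇ-false {z} {lookup v i} ((λ ()) ∘ inj {zero} {suc i}) | ≡ᵇ-true {z} {z} refl = refl
before-false (z ∷ v) inj {suc i} {suc j} (s≤s j<i)
  rewrite ≡ᵇ-false {z} {lookup v i} ((λ ()) ∘ inj {zero} {suc i})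
        | ≡ᵇ-false {z} {lookup v j} ((λ ()) ∘ inj {zero} {suc j}) =
  before-false v (λ eq → suc-injective (inj eq)) j<i
  where open import Data.Fin.Properties using (suc-injective)

module Farthest {C : ℕ → ℕ → Set} (C? : ∀ p q → Dec (C p q))
  (C-mono : ∀ {p p′ q′ q} → p ≤ p′ → p′ < q′ → q′ ≤ q → C p q → C p′ q′) where

  -- The search starts at p + 1 + d and comes down. The default p + 1 claims no closeness but causes
  -- no harm, because nothing lies between neighbouring places.
  farthest : ℕ → ℕ → ℕ
  farthest p zero    = suc p
  farthest p (suc d) = if does (C? p (suc p + suc d)) then suc p + suc d else farthest p d

  farthest-lower : ∀ p d → p < farthest p d
  farthest-lower p zero    = ℕ.≤-refl
  farthest-lower p (suc d) with does (C? p (suc p + suc d))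
  ... | true  = ℕ.m≤m+n (suc p) (suc d)
  ... | false = farthest-lower p d

  farthest-upper : ∀ p d → farthest p d ≤ suc p + d
  farthest-upper p zero    = ℕ.≤-reflexive (sym (ℕ.+-identityʳ (suc p)))
  farthest-upper p (suc d) with does (C? p (suc p + suc d))
  ... | true  = ℕ.≤-refl
  ... | false = ℕ.≤-trans (farthest-upper p d) (ℕ.+-monoʳ-≤ (suc p) (ℕ.n≤1+n d))

  farthest-attained : ∀ p d → farthest p d ≡ suc p ⊎ C p (farthest p d)
  farthest-attained p zero    = inj₁ refl
  farthest-attained p (suc d) with C? p (suc p + suc d)
  ... | yes c = inj₂ c
  ... | no _  = farthest-attained p d

  farthest-maximal : ∀ p d {q} → q ≤ suc p + d → C p q → p < q → q ≤ farthest p d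
  farthest-maximal p zero    q≤ c p<q = ℕ.≤-trans q≤ (ℕ.≤-reflexive (ℕ.+-identityʳ (suc p)))
  farthest-maximal p (suc d) {q} q≤ c p<q with C? p (suc p + suc d)
  ... | yes _ = q≤
  ... | no ¬c with ℕ.m≤n⇒m<n∨m≡n q≤
  ...   | inj₂ refl = contradiction c ¬c
  ...   | inj₁ q<   = farthest-maximal p d (ℕ.s≤s⁻¹ (subst (q <_) (ℕ.+-suc (suc p) d) q<)) c p<q

  -- If p is close to some q > p + 1, then so is p + 1, because the interval shrinks. This makes the
  -- vector of reaches weakly increasing.
  farthest-step : ∀ p d → farthest p (suc d) ≤ farthest (suc p) d
  farthest-step p d with farthest-attained p (suc d)
  ... | inj₁ eq = ℕ.≤-trans (ℕ.≤-reflexive eq) (ℕ.≤-trans (ℕ.n≤1+n (suc p)) (farthest-lower (suc p) d))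
  ... | inj₂ c with ℕ.m≤n⇒m<n∨m≡n (farthest-lower p (suc d))
  ...   | inj₂ eq = ℕ.≤-trans (ℕ.≤-reflexive (sym eq)) (ℕ.≤-trans (ℕ.n≤1+n (suc p)) (farthest-lower (suc p) d))
  ...   | inj₁ lt = farthest-maximal (suc p) d
          (ℕ.≤-trans (farthest-upper p (suc d)) (ℕ.≤-reflexive (ℕ.+-suc (suc p) d)))
          (C-mono (ℕ.n≤1+n p) lt ℕ.≤-refl c) lt

  -- The second argument of `farthest` falls as p grows, so that all the searches start at the same
  -- last place.
  reaches : ∀ l → ℕ → Vec ℕ l
  reaches zero    p = []
  reaches (suc l) p = farthest p (suc l) ∷ reaches l (suc p)

  reaches-Far : ∀ {m} l p lo → suc p + l < m → lo ≤ farthest p l → Far m p lo (reaches l p)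
  reaches-Far zero    p lo _  _   = tt
  reaches-Far {m} (suc l) p lo <m lo≤ =
    lo≤ , farthest-lower p (suc l) , ℕ.≤-<-trans (farthest-upper p (suc l)) <m ,
    reaches-Far l (suc p) _ (subst (_< m) (ℕ.+-suc (suc p) l) <m) (farthest-step p l)

  lookup-reaches : ∀ l p j d → l ≡ j + suc d → nthᵛ (reaches l p) j ≡ farthest (p + j) (suc d)
  lookup-reaches (suc l) p zero    d refl = cong (λ p → farthest p (suc d)) (sym (ℕ.+-identityʳ p))
  lookup-reaches (suc l) p (suc j) d eq   =
    trans (lookup-reaches l (suc p) j d (ℕ.suc-injective eq)) (cong (λ p → farthest p (suc d)) (sym (ℕ.+-suc p j)))

  -- The gap between p and q excludes the default value of `farthest`.
  reaches-sound : ∀ r {p q} → p ≤ r → suc p < q → q ≤ nthᵛ (reaches (suc r) 0) p → C p q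
  reaches-sound r {p} {q} p≤r p<q q≤
    with subst (q ≤_) (lookup-reaches (suc r) 0 p (r ∸ p) (trans (cong suc (sym (ℕ.m+[n∸m]≡n p≤r))) (sym (ℕ.+-suc p (r ∸ p))))) q≤
       | farthest-attained p (suc (r ∸ p))
  ... | q≤f | inj₁ eq = contradiction (ℕ.<-≤-trans p<q (subst (q ≤_) eq q≤f)) (ℕ.<-irrefl refl)
  ... | q≤f | inj₂ c  = C-mono ℕ.≤-refl (ℕ.<-trans (ℕ.n<1+n p) p<q) q≤f c

  reaches-complete : ∀ r {p q} → p ≤ r → p < q → q < 3 + r → C p q → q ≤ nthᵛ (reaches (suc r) 0) p
  reaches-complete r {p} {q} p≤r p<q q< c =
    subst (q ≤_) (sym (lookup-reaches (suc r) 0 p (r ∸ p) (trans (cong suc (sym (ℕ.m+[n∸m]≡n p≤r))) (sym (ℕ.+-suc p (r ∸ p))))))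
      (farthest-maximal p (suc (r ∸ p)) (subst (q ≤_) bound (ℕ.s≤s⁻¹ q<)) c p<q)
    where
    bound : 2 + r ≡ suc p + suc (r ∸ p)
    bound = trans (cong (_+_ 2) (sym (ℕ.m+[n∸m]≡n p≤r))) (cong suc (sym (ℕ.+-suc p (r ∸ p))))

AllPairsᵛ-lookup : ∀ {A : Set} {R : A → A → Set} {n} {v : Vec A n} → VecPairs.AllPairs R v →
                   ∀ {i j} → i Fin.< j → R (lookup v i) (lookup v j)
AllPairsᵛ-lookup (r ∷ rs) {zero}  {suc j} _         = VecAll.lookup⁺ r j
  where import Data.Vec.Relation.Unary.All.Properties as VecAll
AllPairsᵛ-lookup (r ∷ rs) {suc i} {suc j} (s≤s i<j) = AllPairsᵛ-lookup rs i<j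

indexOf-lookup : ∀ {n l} (π : Vec (Fin n) l) → Injective π → ∀ j → indexOf (lookup π j) π ≡ toℕ j
indexOf-lookup (x ∷ π) inj zero rewrite ≡ᵇ-true {toℕ x} {toℕ x} refl = refl
indexOf-lookup (x ∷ π) inj (suc j)
  rewrite ≡ᵇ-false {toℕ (lookup π j)} {toℕ x} (λ eq → Fin.0≢1+n (sym (inj {suc j} {zero} (Fin.toℕ-injective eq)))) =
  cong suc (indexOf-lookup π (λ eq → Fin.suc-injective (inj eq)) j)

lookup-descents : ∀ {X : Set} {n} (lt : X → X → Bool) (v : Vec X (suc n)) j →
                  lookup (descents lt v) j ≡ lt (lookup v (suc j)) (lookup v (inject₁ j))
lookup-descents lt (a ∷ b ∷ v) zero    = refl
lookup-descents lt (a ∷ b ∷ v) (suc j) = lookup-descents lt (b ∷ v) j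

-- Classes of tableaux as orbits of states

module Classes {n : ℕ} {X : Set}
  {_≺_ : X → X → Set} (_≺?_ : ∀ x y → Dec (x ≺ y)) (≺-trans : ∀ {x y z} → x ≺ y → y ≺ z → x ≺ z)
  (≺-asym : ∀ {x y} → x ≺ y → ¬ y ≺ x) (≺-total : ∀ {x y} → x ≢ y → x ≺ y ⊎ y ≺ x)
  {Near : X → X → Set} (near? : ∀ x y → Dec (Near x y))
  (near-mono : ∀ {x x′ y′ y} → x ≡ x′ ⊎ x ≺ x′ → x′ ≺ y′ → y′ ≡ y ⊎ y′ ≺ y → Near x y → Near x′ y′)
  (A : Setoid 0ℓ 0ℓ)
  (Desc : Setoid.Carrier A → Subset (n ∸ 1)) (φ : Interior n → Setoid.Carrier A → Setoid.Carrier A)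
  (φ-cong : ∀ i {T U} → Setoid._≈_ A T U → Setoid._≈_ A (φ i T) (φ i U)) (φ-involutive : ∀ i T → Setoid._≈_ A (φ i (φ i T)) T)
  (cellOf : Setoid.Carrier A → Fin n → X) (cellOf-injective : ∀ T {e f} → cellOf T e ≡ cellOf T f → e ≡ f)
  (≈⇒cellOf : ∀ {T U} → Setoid._≈_ A T U → ∀ e → cellOf T e ≡ cellOf U e)
  (cellOf⇒≈ : ∀ {T U} → (∀ e → cellOf T e ≡ cellOf U e) → Setoid._≈_ A T U)
  (lookup-Desc : ∀ T j → lookup (Desc T) j ≡ does (cellOf T (upper j) ≺? cellOf T (lower j)))
  (φ-triple : ∀ i T → (cellOf (φ i T) (pred# i) , cellOf (φ i T) (self# i) , cellOf (φ i T) (succ# i)) ≡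
                      rotate (λ x y → does (x ≺? y)) (λ x y → does (near? x y))
                        (cellOf T (pred# i)) (cellOf T (self# i)) (cellOf T (succ# i)))
  (φ-off : ∀ i T {e} → e ≢ pred# i → e ≢ self# i → e ≢ succ# i → cellOf (φ i T) e ≡ cellOf T e) where

  open Setoid A using (_≈_) renaming (Carrier to C)
  open DualEquivalence {n} A Desc φ using ([_]; Lists; ΣQ; ClassSum)
  open Rotations _≺?_ near? ≺-asym ≺-total using (lt; close; rotate-unique)

  rotateᵗ : X × X × X → X × X × X
  rotateᵗ (a , b , c) = rotate lt close a b c

  module Window (h i : Interior n) (h≤i : idx h ≤ idx i) (T₀ : C) where

    -- The window consists of the entries h-1, ..., i+1, hence has 3 + r of them; the least is
    -- represented in `Fin n` by h-2.
    r base : ℕ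
    r    = idx i ∸ idx h
    base = idx h ∸ 2

    Size = 3 + r

    base+2 : base + 2 ≡ idx h
    base+2 = ℕ.m∸n+n≡m (1<idx h)

    r+h : r + idx h ≡ idx i
    r+h = ℕ.m∸n+n≡m h≤i

    abstract

      win : Fin Size → Fin n
      win e = fromℕ< {toℕ e + base} (begin-strict
        toℕ e + base        ≤⟨ ℕ.+-monoˡ-≤ base (ℕ.s≤s⁻¹ (Fin.toℕ<n e)) ⟩
        2 + r + base        ≡⟨ cong (_+ base) (ℕ.+-comm 2 r) ⟩
        r + 2 + base        ≡⟨ ℕ.+-assoc r 2 base ⟩
        r + (2 + base)      ≡⟨ cong (_+_ r) (trans (ℕ.+-comm 2 base) base+2) ⟩
        r + idx h           ≡⟨ r+h ⟩
        idx i               <⟨ idx<n i ⟩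
        n                   ∎)
        where open ℕ.≤-Reasoning

      toℕ-win : ∀ e → toℕ (win e) ≡ toℕ e + base
      toℕ-win e = Fin.toℕ-fromℕ< _

    win-injective : ∀ {e f} → win e ≡ win f → e ≡ f
    win-injective {e} {f} eq = Fin.toℕ-injective (ℕ.+-cancelʳ-≡ base (toℕ e) (toℕ f)
      (trans (sym (toℕ-win e)) (trans (cong toℕ eq) (toℕ-win f))))

    Offset : Interior n → Fin (suc r) → Set
    Offset j o = toℕ o + idx h ≡ idx j

    offset : ∀ j → idx h ≤ idx j → idx j ≤ idx i → ∃[ o ] Offset j o
    offset j h≤j j≤i = fromℕ< {idx j ∸ idx h} (s≤s (ℕ.∸-monoˡ-≤ (idx h) j≤i)) ,
      trans (cong (_+ idx h) (Fin.toℕ-fromℕ< _)) (ℕ.m∸n+n≡m h≤j)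

    at : Fin (suc r) → Interior n
    at o = interior (toℕ o + idx h) (ℕ.≤-trans (1<idx h) (ℕ.m≤n+m (idx h) (toℕ o)))
      (ℕ.≤-<-trans (subst (toℕ o + idx h ≤_) r+h (ℕ.+-monoˡ-≤ (idx h) (ℕ.s≤s⁻¹ (Fin.toℕ<n o)))) (idx<n i))

    at-lower : ∀ o → idx h ≤ idx (at o)
    at-lower o = ℕ.m≤n+m (idx h) (toℕ o)

    at-upper : ∀ o → idx (at o) ≤ idx i
    at-upper o = subst (toℕ o + idx h ≤_) r+h (ℕ.+-monoˡ-≤ (idx h) (ℕ.s≤s⁻¹ (Fin.toℕ<n o)))

    module _ j o (off : Offset j o) where

      pred#-offset : toℕ (pred# j) ≡ toℕ o + base
      pred#-offset = ℕ.+-cancelˡ-≡ 2 _ _ (trans (toℕ-pred# j) (trans (sym off)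
        (trans (cong (_+_ (toℕ o)) (sym base+2)) (trans (sym (ℕ.+-assoc (toℕ o) base 2)) (ℕ.+-comm (toℕ o + base) 2)))))

      win-pred# : ∀ {a} → toℕ a ≡ toℕ o → win a ≡ pred# j
      win-pred# {a} eq = Fin.toℕ-injective (trans (toℕ-win a) (trans (cong (_+ base) eq) (sym pred#-offset)))

      win-self# : ∀ {a} → toℕ a ≡ 1 + toℕ o → win a ≡ self# j
      win-self# {a} eq = Fin.toℕ-injective (trans (toℕ-win a) (trans (cong (_+ base) eq)
        (trans (cong suc (sym pred#-offset)) (sym (toℕ-self# j)))))

      win-succ# : ∀ {a} → toℕ a ≡ 2 + toℕ o → win a ≡ succ# j
      win-succ# {a} eq = Fin.toℕ-injective (trans (toℕ-win a) (trans (cong (_+ base) eq)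
        (trans (cong (λ t → 2 + t) (sym pred#-offset)) (sym (toℕ-succ# j)))))

      pred#-win : ∀ {e} → win e ≡ pred# j → toℕ e ≡ toℕ o
      pred#-win {e} eq = ℕ.+-cancelʳ-≡ base _ _ (trans (sym (toℕ-win e)) (trans (cong toℕ eq) pred#-offset))

      self#-win : ∀ {e} → win e ≡ self# j → toℕ e ≡ 1 + toℕ o
      self#-win {e} eq = ℕ.+-cancelʳ-≡ base _ _ (trans (sym (toℕ-win e)) (trans (cong toℕ eq)
        (trans (toℕ-self# j) (cong suc pred#-offset))))

      succ#-win : ∀ {e} → win e ≡ succ# j → toℕ e ≡ 2 + toℕ o
      succ#-win {e} eq = ℕ.+-cancelʳ-≡ base _ _ (trans (sym (toℕ-win e)) (trans (cong toℕ eq)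
        (trans (toℕ-succ# j) (cong (λ t → 2 + t) pred#-offset))))

    windowCells : C → Vec X Size
    windowCells U = tabulate (λ e → cellOf U (win e))

    windowCells-φ : ∀ {j o} → Offset j o → ∀ U → windowCells (φ j U) ≡ move lt close o (windowCells U)
    windowCells-φ {j} {o} off U = sym (move-tabulate o (λ e → cellOf U (win e)) (λ e → cellOf (φ j U) (win e))
      (λ {a} {b} {c} a≡ b≡ c≡ → trans
        (cong₂ (λ e t → rotateᵗ (cellOf U e , t)) (win-pred# j o off a≡) (cong₂ (λ e f → cellOf U e , cellOf U f) (win-self# j o off b≡) (win-succ# j o off c≡)))
        (trans (sym (φ-triple j U))
          (sym (cong₂ (λ e t → (cellOf (φ j U) e , t)) (win-pred# j o off a≡) (cong₂ (λ e f → cellOf (φ j U) e , cellOf (φ j U) f) (win-self# j o off b≡) (win-succ# j o off c≡))))))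
      (λ e a b c → φ-off j U (a ∘ pred#-win j o off) (b ∘ self#-win j o off) (c ∘ succ#-win j o off)))

    _≺ᵉ_ : Fin Size → Fin Size → Set
    e ≺ᵉ f = cellOf T₀ (win e) ≺ cellOf T₀ (win f)

    sorting : ∃[ π ] π ∈ perms (Vec.allFin Size) × VecLinked.Linked _≺ᵉ_ π
    sorting = Sorting.∃-sorted (λ e f → cellOf T₀ (win e) ≺? cellOf T₀ (win f)) ≺-trans ≺-asym
      (λ e≢f → ≺-total (e≢f ∘ win-injective ∘ cellOf-injective T₀)) (Vec.allFin Size) (allFin-unique Size)

    -- π is the reading word of the window, so wc lists the cells of the window in
    -- reading order; these cells are the same for the whole class of T₀.
    module Word (π : Vec (Fin Size) Size) (π∈perms : π ∈ perms (Vec.allFin Size)) (π-sorted : VecLinked.Linked _≺ᵉ_ π) where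

      open Reorder (∈-perms⁻ (Vec.allFin Size) π∈perms) using (index; π-index; index-π)

      wc : Fin Size → X
      wc p = cellOf T₀ (win (lookup π p))

      wc-sorted : ∀ {p q} → p Fin.< q → wc p ≺ wc q
      wc-sorted {p} {q} = AllPairsᵛ-lookup {R = _≺ᵉ_} (Linked⇒AllPairs {R = _≺ᵉ_} ≺-trans π-sorted) {p} {q}

      wc-injective : ∀ {p q} → wc p ≡ wc q → p ≡ q
      wc-injective {p} {q} eq = trans (sym (index-π p)) (trans (cong index (win-injective {lookup π p} {lookup π q} (cellOf-injective T₀ eq))) (index-π q))

      wc-sorted⁻ : ∀ {p q} → wc p ≺ wc q → p Fin.< q
      wc-sorted⁻ {p} {q} l with Fin.<-cmp p q
      ... | tri< p<q _ _  = p<q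
      ... | tri≈ _ refl _ = contradiction l (≺-asym l)
      ... | tri> _ _ q<p  = contradiction l (≺-asym (wc-sorted q<p))

      -- Nearness extended by falsehood to numbers that are not places of the window, so that
      -- reaches can be computed with plain numbers.
      NearAt : ℕ → ℕ → Set
      NearAt p q = ∃[ a ] ∃[ b ] toℕ a ≡ p × toℕ b ≡ q × Near (wc a) (wc b)

      nearAt? : ∀ p q → Dec (NearAt p q)
      nearAt? p q = Fin.any? λ a → Fin.any? λ b → (toℕ a ℕ.≟ p) ×-dec (toℕ b ℕ.≟ q) ×-dec near? (wc a) (wc b)
        where open import Relation.Nullary.Decidable using (_×-dec_)

      wc-≤ : ∀ {p q} → toℕ p ≤ toℕ q → wc p ≡ wc q ⊎ wc p ≺ wc q
      wc-≤ p≤q with ℕ.m≤n⇒m<n∨m≡n p≤q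
      ... | inj₁ p<q = inj₂ (wc-sorted p<q)
      ... | inj₂ p≡q = inj₁ (cong wc (Fin.toℕ-injective p≡q))

      nearAt-mono : ∀ {p p′ q′ q} → p ≤ p′ → p′ < q′ → q′ ≤ q → NearAt p q → NearAt p′ q′
      nearAt-mono p≤ p′<q′ q′≤ (a , b , refl , refl , near) =
        fromℕ< p′< , fromℕ< q′< , Fin.toℕ-fromℕ< p′< , Fin.toℕ-fromℕ< q′< ,
        near-mono (wc-≤ (subst (toℕ a ≤_) (sym (Fin.toℕ-fromℕ< p′<)) p≤))
                  (wc-sorted (subst₂ _<_ (sym (Fin.toℕ-fromℕ< p′<)) (sym (Fin.toℕ-fromℕ< q′<)) p′<q′))
                  (wc-≤ (subst (_≤ toℕ b) (sym (Fin.toℕ-fromℕ< q′<)) q′≤)) near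
        where
        q′< = ℕ.≤-<-trans q′≤ (Fin.toℕ<n b)
        p′< = ℕ.<-trans p′<q′ q′<

      open Farthest nearAt? nearAt-mono

      reach : Vec ℕ (suc r)
      reach = reaches (suc r) 0

      reach-Far : Far Size 0 0 reach
      reach-Far = reaches-Far (suc r) 0 0 ℕ.≤-refl z≤n

      near⇒reach : ∀ {p s q : Fin Size} → p Fin.< s → s Fin.< q → Near (wc p) (wc q) → toℕ q ≤ nthᵛ reach (toℕ p)
      near⇒reach {p} {s} {q} p<s s<q near = reaches-complete r
        -- Two places of the window lie above p, so p ≤ r and the vector has an entry for it.
        (ℕ.s≤s⁻¹ (ℕ.s≤s⁻¹ (ℕ.s≤s⁻¹ (ℕ.≤-trans (s≤s (ℕ.≤-trans (s≤s p<s) s<q)) (Fin.toℕ<n q)))))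
        (ℕ.<-trans p<s s<q) (Fin.toℕ<n q) (p , q , refl , refl , near)

      reach⇒near : ∀ {p s q : Fin Size} → p Fin.< s → s Fin.< q → toℕ q ≤ nthᵛ reach (toℕ p) → Near (wc p) (wc q)
      reach⇒near {p} {s} {q} p<s s<q q≤
        with reaches-sound r (ℕ.s≤s⁻¹ (ℕ.s≤s⁻¹ (ℕ.s≤s⁻¹ (ℕ.≤-trans (s≤s (ℕ.≤-trans (s≤s p<s) s<q)) (Fin.toℕ<n q))))) (ℕ.≤-trans (s≤s p<s) s<q) q≤
      ... | a , b , a≡ , b≡ , near = subst₂ (λ a b → Near (wc a) (wc b)) (Fin.toℕ-injective a≡) (Fin.toℕ-injective b≡) near

      nearᵉ? : ∀ p q → Dec (Near (wc p) (wc q))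
      nearᵉ? p q = near? (wc p) (wc q)

      open LocalSoundness r reach using (Class; Reach; start; step; Tame)
      open Local r reach using (State; act)

      private
        ᵉ-total : ∀ {p q : Fin Size} → p ≢ q → p Fin.< q ⊎ q Fin.< p
        ᵉ-total p≢q = Sum.map wc-sorted⁻ wc-sorted⁻ (≺-total (p≢q ∘ wc-injective))

        ℕ-total : ∀ {p q} → p ≢ q → p < q ⊎ q < p
        ℕ-total {p} {q} p≢q with ℕ.<-cmp p q
        ... | tri< p<q _ _ = inj₁ p<q
        ... | tri≈ _ p≡q _ = contradiction p≡q p≢q
        ... | tri> _ _ q<p = inj₂ q<p

        nearℕ? : ∀ p q → Dec (q ≤ nthᵛ reach p)
        nearℕ? p q = q ℕ.≤? nthᵛ reach p

        module RotF = Rotations Fin._<?_ nearᵉ? ℕ.<-asym ᵉ-total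
        module RotN = Rotations ℕ._<?_ nearℕ? ℕ.<-asym ℕ-total

        moveᶠ : Fin (suc r) → Vec (Fin Size) Size → Vec (Fin Size) Size
        moveᶠ = move RotF.lt RotF.close

        -- Words over `Fin Size` mediate between tableaux and the check: `wc` sends their letters to
        -- cells, `toℕ` to the numbers in states, and `rotate` commutes with both maps.
        rotate-wc : ∀ {a b c} → a ≢ b → b ≢ c → a ≢ c →
                    rotate lt close (wc a) (wc b) (wc c) ≡ map₃ wc (rotate RotF.lt RotF.close a b c)
        rotate-wc a≢b b≢c a≢c = rotate-unique ≺-trans
          (rotation-map wc Fin._<?_ nearᵉ? ℕ.<-asym ᵉ-total _≺?_ near? ≺-asym ≺-total wc-sorted
            (λ _ _ near → near) (λ _ _ far → far) (RotF.rotation a≢b b≢c a≢c))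

        rotate-toℕ : ∀ {a b c : Fin Size} → a ≢ b → b ≢ c → a ≢ c →
                     rotate RotN.lt RotN.close (toℕ a) (toℕ b) (toℕ c) ≡ map₃ toℕ (rotate RotF.lt RotF.close a b c)
        rotate-toℕ a≢b b≢c a≢c = RotN.rotate-unique ℕ.<-trans
          (rotation-map toℕ Fin._<?_ nearᵉ? ℕ.<-asym ᵉ-total ℕ._<?_ nearℕ? ℕ.<-asym ℕ-total id
            near⇒reach (λ p<s s<q far near → far (reach⇒near p<s s<q near)) (RotF.rotation a≢b b≢c a≢c))

      -- The correspondence between tableaux and states, as a relation. It is respected by the
      -- operators (`located-φ`) and is one-to-one up to ≈ (`located-functional`,
      -- `located-injective`); `outside` is what lets a state determine the whole tableau.
      record Located (U : C) (p : State) : Set where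
        field
          word    : Vec (Fin Size) Size
          places  : windowCells U ≡ Vec.map wc word
          state   : p ≡ Vec.map toℕ word
          outside : ∀ v → (∀ e → v ≢ win e) → cellOf U v ≡ cellOf T₀ v

        cellOf-word : ∀ e → cellOf U (win e) ≡ wc (lookup word e)
        cellOf-word e = trans (sym (Vec.lookup∘tabulate (λ e → cellOf U (win e)) e))
          (trans (cong (λ v → lookup v e) places) (Vec.lookup-map e wc word))

        word-injective : Injective word
        word-injective {e} {f} eq = win-injective (cellOf-injective U
          (trans (cellOf-word e) (trans (cong wc eq) (sym (cellOf-word f)))))

        lookup-state : ∀ e → lookup p e ≡ toℕ (lookup word e)
        lookup-state e = trans (cong (λ v → lookup v e) state) (Vec.lookup-map e toℕ word)

        state-injective : Injective p
        state-injective {e} {f} eq = word-injective (Fin.toℕ-injective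
          (trans (sym (lookup-state e)) (trans eq (lookup-state f))))

      open Located

      located-start : Located T₀ (inverse π)
      located-start = record
        { word    = tabulate index
        ; places  = trans (Vec.tabulate-cong (λ e → cong (cellOf T₀ ∘ win) (sym (π-index e)))) (Vec.tabulate-∘ wc index)
        ; state   = trans (sym (Vec.tabulate-∘ (λ e → indexOf e π) id))
            (trans (Vec.tabulate-cong (λ e → trans (cong (λ e → indexOf e π) (sym (π-index e))) (indexOf-lookup π π-injective (index e))))
                   (Vec.tabulate-∘ toℕ index))
        ; outside = λ _ _ → refl
        }
        where
        π-injective : Injective π
        π-injective {i} {j} eq = trans (sym (index-π i)) (trans (cong index eq) (index-π j))

      located-φ : ∀ {U p} j o → Offset j o → Located U p → Located (φ j U) (act o p)
      located-φ {U} {p} j o off at-p = record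
        { word    = moveᶠ o (word at-p)
        ; places  = trans (windowCells-φ {j} {o} off U) (trans (cong (move lt close o) (places at-p))
            (move-map wc o (word at-p) λ a b c → rotate-wc (≢₁₂ a b c) (≢₂₃ a b c) (≢₁₃ a b c)))
        ; state   = trans (cong (act o) (state at-p))
            (move-map toℕ o (word at-p) λ a b c → rotate-toℕ (≢₁₂ a b c) (≢₂₃ a b c) (≢₁₃ a b c))
        ; outside = λ v v∉ → trans (φ-off j U
            (λ eq → v∉ (atℕ 0 (s≤s z≤n)) (trans eq (sym (win-pred# j o off (toℕ-at 0 (s≤s z≤n))))))
            (λ eq → v∉ (atℕ 1 (s≤s (s≤s z≤n))) (trans eq (sym (win-self# j o off (toℕ-at 1 (s≤s (s≤s z≤n)))))))
            (λ eq → v∉ (atℕ 2 ℕ.≤-refl) (trans eq (sym (win-succ# j o off (toℕ-at 2 ℕ.≤-refl))))))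
            (outside at-p v v∉)
        }
        where
        bound : ∀ d → d < 3 → d + toℕ o < Size
        bound d d<3 = ℕ.<-≤-trans (ℕ.+-monoˡ-< (toℕ o) d<3) (ℕ.+-monoʳ-≤ 3 (ℕ.s≤s⁻¹ (Fin.toℕ<n o)))
        atℕ : ∀ d → d < 3 → Fin Size
        atℕ d d<3 = fromℕ< (bound d d<3)
        toℕ-at : ∀ d d<3 → toℕ (atℕ d d<3) ≡ d + toℕ o
        toℕ-at d d<3 = Fin.toℕ-fromℕ< (bound d d<3)
        ≢₁₂ : ∀ {a b c : Fin Size} → toℕ a ≡ toℕ o → toℕ b ≡ 1 + toℕ o → toℕ c ≡ 2 + toℕ o →
                   lookup (word at-p) a ≢ lookup (word at-p) b
        ≢₁₂ a b c eq = ℕ.1+n≢n (trans (sym b) (trans (cong toℕ (sym (word-injective at-p eq))) a))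
        ≢₂₃ : ∀ {a b c : Fin Size} → toℕ a ≡ toℕ o → toℕ b ≡ 1 + toℕ o → toℕ c ≡ 2 + toℕ o →
                    lookup (word at-p) b ≢ lookup (word at-p) c
        ≢₂₃ a b c eq = ℕ.1+n≢n (trans (sym c) (trans (cong toℕ (sym (word-injective at-p eq))) b))
        ≢₁₃ : ∀ {a b c : Fin Size} → toℕ a ≡ toℕ o → toℕ b ≡ 1 + toℕ o → toℕ c ≡ 2 + toℕ o →
                    lookup (word at-p) a ≢ lookup (word at-p) c
        ≢₁₃ a b c eq = ℕ.<⇒≢ (ℕ.m<n⇒m<1+n ℕ.≤-refl) (sym (trans (sym c) (trans (cong toℕ (sym (word-injective at-p eq))) a)))

      located-≈ : ∀ {U V p} → U ≈ V → Located U p → Located V p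
      located-≈ U≈V at-p = record
        { word    = word at-p
        ; places  = trans (Vec.tabulate-cong (λ e → sym (≈⇒cellOf U≈V (win e)))) (places at-p)
        ; state   = state at-p
        ; outside = λ v v∉ → trans (sym (≈⇒cellOf U≈V v)) (outside at-p v v∉)
        }

      located-functional : ∀ {U p q} → Located U p → Located U q → p ≡ q
      located-functional at-p at-q = trans (state at-p) (trans (cong (Vec.map toℕ) word≡) (sym (state at-q)))
        where
        word≡ : word at-p ≡ word at-q
        word≡ = lookup-extensional λ e → wc-injective (trans (sym (cellOf-word at-p e)) (cellOf-word at-q e))

      located-injective : ∀ {U V p} → Located U p → Located V p → U ≈ V
      located-injective {U} {V} at-p at-q = cellOf⇒≈ λ v → agree v (Fin.any? λ e → v Fin.≟ win e)
        where
        same-word : ∀ e → lookup (word at-p) e ≡ lookup (word at-q) e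
        same-word e = Fin.toℕ-injective (trans (sym (lookup-state at-p e)) (lookup-state at-q e))
        agree : ∀ v → Dec (∃[ e ] v ≡ win e) → cellOf U v ≡ cellOf V v
        agree v (yes (e , refl)) = trans (cellOf-word at-p e) (trans (cong wc (same-word e)) (sym (cellOf-word at-q e)))
        agree v (no v∉)          = trans (outside at-p v (λ e eq → v∉ (e , eq))) (sym (outside at-q v (λ e eq → v∉ (e , eq))))

      private
        E : C → C → Set
        E = EqClosure (λ U V → ∃[ j ] idx h ≤ idx j × idx j ≤ idx i × φ j U ≈ V)

        edge : ∀ {U V} o → φ (at o) U ≈ V → E U V
        edge o eq = Eq.return (at o , at-lower o , at-upper o , eq)

        E-trans : ∀ {U V W} → E U V → E V W → E U W
        E-trans = Eq.transitive _

        -- An operator of the window sends V and W to equivalent tableaux, so one step forward from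
        -- V and one step back lead to W.
        E-≈ : ∀ {U V W} → E U V → V ≈ W → E U W
        E-≈ {V = V} path V≈W = E-trans path (E-trans (edge zero (Setoid.refl A))
          (Eq.symmetric _ (edge zero (φ-cong (at zero) (Setoid.sym A V≈W)))))

      module _ (Γ : Class) (start∈ : inverse π ∈ Class.members Γ) where

        open Class Γ

        reach⇒∈ : ∀ {x} → Reach root x → x ∈ members
        reach⇒∈ start      = root∈
        reach⇒∈ (step o ρ) = closed o (reach⇒∈ ρ)

        -- A step of `Reach` is undone by applying the same move again.
        to-root : ∀ {x} → Reach root x → ∀ {U} → Located U x → ∃[ V ] Located V root × E U V
        to-root start              {U} at-x = U , at-x , ε
        to-root (step {y} o ρ)     {U} at-x =
          let (V , at-root , path) = to-root ρ (subst (Located (φ (at o) U)) (involutive o (reach⇒∈ ρ)) (located-φ (at o) o refl at-x))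
          in V , at-root , E-trans (edge o (Setoid.refl A)) path

        from-root : ∀ {x} → Reach root x → ∀ {U} → Located U root → ∃[ V ] Located V x × E U V
        from-root start      {U} at-root = U , at-root , ε
        from-root (step o ρ) {U} at-root =
          let (V , at-y , path) = from-root ρ at-root
          in φ (at o) V , located-φ (at o) o refl at-y , E-trans path (edge o (Setoid.refl A))

        representative : ∀ {x} → x ∈ members → ∃[ U ] Located U x × E T₀ U
        representative x∈ =
          let (V , at-root , path)  = to-root (reachable start∈) located-start
              (U , at-x    , path′) = from-root (reachable x∈) at-root
          in U , at-x , E-trans path path′

        located-class : ∀ {U V} → E U V → ∀ {x} → x ∈ members → Located U x → ∃[ y ] y ∈ members × Located V y
        located-class ε                                    x∈ at-x = _ , x∈ , at-x
        located-class (fwd (j , h≤j , j≤i , φU≈V) ◅ path) x∈ at-x =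
          let (o , off) = offset j h≤j j≤i
          in located-class path (closed o x∈) (located-≈ φU≈V (located-φ j o off at-x))
        located-class (bwd (j , h≤j , j≤i , φV≈U) ◅ path) x∈ at-x =
          let (o , off) = offset j h≤j j≤i
          in located-class path (closed o x∈)
               (located-≈ (Setoid.trans A (φ-cong j (Setoid.sym A φV≈U)) (φ-involutive j _)) (located-φ j o off at-x))

        Represents : C → State → Set
        Represents U x = Located U x × E T₀ U

        represent : ∀ L → (∀ {x} → x ∈ L → ∃[ U ] Represents U x) → ∃[ us ] Pointwise Represents us L
        represent []      rep = [] , []
        represent (x ∷ L) rep =
          let (us , pw) = represent L (rep ∘ there) in proj₁ (rep (here refl)) ∷ us , proj₂ (rep (here refl)) ∷ pw

        us : List C
        us = proj₁ (represent members representative)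

        us-represent : Pointwise Represents us members
        us-represent = proj₂ (represent members representative)

        represents-unique : ∀ {us L} → Pointwise Represents us L → AllPairs _≢_ L → AllPairs (λ U V → ¬ U ≈ V) us
        represents-unique []                  []        = []
        represents-unique ((at-x , _) ∷ pw) (x∉ ∷ uniq) = apart pw x∉ ∷ represents-unique pw uniq
          where
          apart : ∀ {us L} → Pointwise Represents us L → All (_ ≢_) L → All (λ V → ¬ _ ≈ V) us
          apart []                 []         = []
          apart ((at-y , _) ∷ pw) (x≢y ∷ x∉) =
            (λ U≈V → x≢y (located-functional (located-≈ U≈V at-x) at-y)) ∷ apart pw x∉

        -- Different states belong to inequivalent tableaux, and every tableau of the class is
        -- located at some member, where it coincides with the chosen representative.
        class-lists : Lists us ([ T₀ ] h i)
        class-lists = represents-unique us-represent unique , λ U → mk⇔ (to us-represent) (from U)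
          where
          open SetoidMembership A using () renaming (_∈_ to _∈ᴬ_)
          to : ∀ {us L U} → Pointwise Represents us L → U ∈ᴬ us → E T₀ U
          to ((_ , path) ∷ _) (here U≈V) = E-≈ path (Setoid.sym A U≈V)
          to (_ ∷ pw)         (there U∈) = to pw U∈
          hit : ∀ {us L U x} → Pointwise Represents us L → x ∈ L → Located U x → U ∈ᴬ us
          hit ((at-x , _) ∷ _) (here refl) at-x′ = here (located-injective at-x′ at-x)
          hit (_ ∷ pw)         (there x∈)  at-x′ = there (hit pw x∈ at-x′)
          from : ∀ U → E T₀ U → U ∈ᴬ us
          from U path = let (_ , x∈ , at-x) = located-class path start∈ located-start in hit us-represent x∈ at-x

        -- As `wc` is increasing, the reading order of cells is the order of their places; the shift
        -- by h-2 in `restrict` is the one in `win`.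
        located-descents : ∀ {U x} → Located U x → restrict h i h≤i (Desc U) ≡ descents _<ᵇ_ x
        located-descents {U} {x} at-x = lookup-extensional λ j → begin
          lookup (restrict h i h≤i (Desc U)) j
            ≡⟨ Vec.lookup∘tabulate (λ j → lookup (Desc U) (place j)) j ⟩
          lookup (Desc U) (place j)
            ≡⟨ lookup-Desc U (place j) ⟩
          does (cellOf U (upper (place j)) ≺? cellOf U (lower (place j)))
            ≡⟨ cong₂ (λ e f → does (cellOf U e ≺? cellOf U f)) (sym (win-upper j)) (sym (win-lower j)) ⟩
          does (cellOf U (win (suc j)) ≺? cellOf U (win (inject₁ j)))
            ≡⟨ cong₂ (λ a b → does (a ≺? b)) (cellOf-word at-x (suc j)) (cellOf-word at-x (inject₁ j)) ⟩
          does (wc (w (suc j)) ≺? wc (w (inject₁ j)))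
            ≡⟨ does-⇔ (mk⇔ wc-sorted⁻ wc-sorted) (wc (w (suc j)) ≺? wc (w (inject₁ j))) (toℕ (w (suc j)) ℕ.<? toℕ (w (inject₁ j))) ⟩
          (toℕ (w (suc j)) <ᵇ toℕ (w (inject₁ j)))
            ≡⟨ cong₂ _<ᵇ_ (sym (lookup-state at-x (suc j))) (sym (lookup-state at-x (inject₁ j))) ⟩
          (lookup x (suc j) <ᵇ lookup x (inject₁ j))
            ≡⟨ sym (lookup-descents _<ᵇ_ x j) ⟩
          lookup (descents _<ᵇ_ x) j ∎
          where
          open ≡-Reasoning
          open import Relation.Nullary.Decidable using (does-⇔)
          w = lookup (word at-x)
          place : Fin (2 + r) → Fin (n ∸ 1)
          place j = fromℕ< {toℕ j + base} (bound j)
            where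
            bound : (j : Fin (2 + r)) → toℕ j + base < n ∸ 1
            bound j = ℕ.<-≤-trans (subst (toℕ j + base <_) (trans (cong (_+ base) (ℕ.+-comm 2 r)) (trans (ℕ.+-assoc r 2 base)
              (trans (cong (_+_ r) (trans (ℕ.+-comm 2 base) base+2)) r+h))) (ℕ.+-monoˡ-< base (Fin.toℕ<n j))) (ℕ.∸-monoˡ-≤ 1 (idx<n i))
          toℕ-lower : ∀ {n} (j : Fin (n ∸ 1)) → toℕ (lower {n} j) ≡ toℕ j
          toℕ-lower {suc n} j = Fin.toℕ-inject₁ j
          toℕ-upper : ∀ {n} (j : Fin (n ∸ 1)) → toℕ (upper {n} j) ≡ suc (toℕ j)
          toℕ-upper {suc n} j = refl
          win-lower : ∀ j → win (inject₁ j) ≡ lower (place j)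
          win-lower j = Fin.toℕ-injective (trans (toℕ-win (inject₁ j)) (trans (cong (_+ base) (Fin.toℕ-inject₁ j))
            (sym (trans (toℕ-lower (place j)) (Fin.toℕ-fromℕ< _)))))
          win-upper : ∀ j → win (suc j) ≡ upper (place j)
          win-upper j = Fin.toℕ-injective (trans (toℕ-win (suc j)) (sym (trans (toℕ-upper (place j)) (cong suc (Fin.toℕ-fromℕ< _)))))

        ∑-class : ∀ (F : Subset (2 + r) → ℕ) → ∑ us (λ U → F (restrict h i h≤i (Desc U))) ≡ ∑ schurs (λ (c , σ) → c * ∑ (tableaux σ) F)
        ∑-class F = trans (pointwise us-represent) (trans (sym (∑-map (descents _<ᵇ_) members F)) (expansion F))
          where
          pointwise : ∀ {us L} → Pointwise Represents us L →
                      ∑ us (λ U → F (restrict h i h≤i (Desc U))) ≡ ∑ L (λ x → F (descents _<ᵇ_ x))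
          pointwise []                = refl
          pointwise ((at-x , _) ∷ pw) = cong₂ _+_ (cong F (located-descents at-x)) (pointwise pw)

        class-expansion : ∀ {N} (α : Vec ℕ N) → ΣQ h i h≤i us α ≡ ∑ schurs (λ (c , σ) → c * schur (Shape.ν σ) α)
        class-expansion α = trans (∑-class (λ D → Q (3 + r) D α))
          (∑-cong schurs (λ (c , σ) → cong (c *_) (sym (schur-shape σ α))))

        class-schurPositive : ClassSum h i h≤i T₀ SchurPositive
        class-schurPositive = us , class-lists , map (λ (c , σ) → c , Shape.ν σ) schurs , λ α →
          trans (class-expansion α) (sym (∑-map (λ (c , σ) → c , Shape.ν σ) schurs (λ (c , ν) → c * schur ν α)))

        class-isSchur : r ≡ 0 ⊎ Tame members → ClassSum h i h≤i T₀ (IsSchur (3 + r))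
        class-isSchur t = us , class-lists , single (tame⇒schur t)
          where
          single : ∃[ σ ] schurs ≡ (1 , σ) ∷ [] → IsSchur (3 + r) (ΣQ h i h≤i us)
          single (σ , eq) = Shape.ν σ , Shape.weight σ , λ α → trans (class-expansion α)
            (trans (cong (λ cs → ∑ cs (λ (c , σ) → c * schur (Shape.ν σ) α)) eq)
            (trans (ℕ.+-identityʳ (1 * schur (Shape.ν σ) α)) (ℕ.*-identityˡ (schur (Shape.ν σ) α))))

        -- What comparability of two cells in the shape means for fillings: all V agree on which of
        -- them holds the smaller entry.
        Ordered : C → Fin n → Fin n → Set
        Ordered U a c = (∀ V {e f} → cellOf V e ≡ cellOf U a → cellOf V f ≡ cellOf U c → e Fin.< f) ⊎
                        (∀ V {e f} → cellOf V e ≡ cellOf U a → cellOf V f ≡ cellOf U c → f Fin.< e)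

        -- The bounds by 2 hold for the entries of one triple. They keep neighbouring cells in the
        -- reading order off a common diagonal, where entries would grow by at least 3.
        Rigid : Set
        Rigid = ∀ U {a b c} → cellOf U a ≺ cellOf U b → cellOf U b ≺ cellOf U c → Near (cellOf U a) (cellOf U c) →
                toℕ c ≤ 2 + toℕ b → toℕ b ≤ 2 + toℕ a → Ordered U a c

        -- The ends seen in x are the outer cells of a triple in U. Rigidity fixes the order of
        -- their entries in every filling, in particular in the one located at y.
        tame-located : Rigid → ∀ {U V x y} o {p q} → Located U x → Located V y →
                       ∀ {a b c : Fin Size} → toℕ a ≡ toℕ o → toℕ b ≡ 1 + toℕ o → toℕ c ≡ 2 + toℕ o →
                       endsAt RotN.lt RotN.close o x ≡ just (p , q) → before p q y ≡ before p q x
        tame-located rigid {U} {V} {x} {y} o {p} {q} at-x at-y {a} {b} {c} a≡ b≡ c≡ eq =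
          cases (RotN.ends-sound (≢-at {s = 0} {1} a≡ b≡ (λ ())) (≢-at {s = 1} {2} b≡ c≡ (λ ())) (≢-at {s = 0} {2} a≡ c≡ (λ ()))
            (trans (sym (endsAt-lookup o x a≡ b≡ c≡)) eq))
          where
          ≢-at : ∀ {e f : Fin Size} {s t} → toℕ e ≡ s + toℕ o → toℕ f ≡ t + toℕ o → s ≢ t → lookup x e ≢ lookup x f
          ≢-at e≡ f≡ s≢t eq = s≢t (ℕ.+-cancelʳ-≡ (toℕ o) _ _ (trans (sym e≡) (trans (cong toℕ (state-injective at-x eq)) f≡)))
          InTriple : Fin Size → Set
          InTriple e = toℕ o ≤ toℕ e × toℕ e ≤ 2 + toℕ o
          a∈ : InTriple a
          a∈ = ℕ.≤-reflexive (sym a≡) , subst (_≤ 2 + toℕ o) (sym a≡) (ℕ.m≤n+m (toℕ o) 2)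
          b∈ : InTriple b
          b∈ = subst (toℕ o ≤_) (sym b≡) (ℕ.m≤n+m (toℕ o) 1) , subst (_≤ 2 + toℕ o) (sym b≡) (ℕ.n≤1+n (1 + toℕ o))
          c∈ : InTriple c
          c∈ = subst (toℕ o ≤_) (sym c≡) (ℕ.m≤n+m (toℕ o) 2) , ℕ.≤-reflexive c≡
          win-close : ∀ {e f} → InTriple e → InTriple f → toℕ (win e) ≤ 2 + toℕ (win f)
          win-close {e} {f} (_ , e≤) (o≤ , _) = subst₂ (λ s t → s ≤ 2 + t) (sym (toℕ-win e)) (sym (toℕ-win f))
            (ℕ.+-monoˡ-≤ base (ℕ.≤-trans e≤ (ℕ.+-monoʳ-≤ 2 o≤)))
          generic : ∀ {l m h} → InTriple l → InTriple m → InTriple h → lookup x l < lookup x m → lookup x m < lookup x h →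
                    lookup x h ≤ nthᵛ reach (lookup x l) →
                    before (lookup x l) (lookup x h) y ≡ before (lookup x l) (lookup x h) x
          generic {l} {m} {h} l∈ m∈ h∈ l<m m<h near = trans (constant at-y) (sym (constant at-x))
            where
            w = lookup (word at-x)
            wl<wm : w l Fin.< w m
            wl<wm = subst₂ _<_ (lookup-state at-x l) (lookup-state at-x m) l<m
            wm<wh : w m Fin.< w h
            wm<wh = subst₂ _<_ (lookup-state at-x m) (lookup-state at-x h) m<h
            cells-≺ : ∀ {e f} → w e Fin.< w f → cellOf U (win e) ≺ cellOf U (win f)
            cells-≺ {e} {f} lt = subst₂ _≺_ (sym (cellOf-word at-x e)) (sym (cellOf-word at-x f)) (wc-sorted lt)
            order : Ordered U (win l) (win h)
            order = rigid U (cells-≺ wl<wm) (cells-≺ wm<wh)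
              (subst₂ Near (sym (cellOf-word at-x l)) (sym (cellOf-word at-x h))
                (reach⇒near wl<wm wm<wh (subst₂ (λ s t → s ≤ nthᵛ reach t) (lookup-state at-x h) (lookup-state at-x l) near)))
              (win-close h∈ m∈) (win-close m∈ l∈)
            win-< : ∀ {e f} → win e Fin.< win f → e Fin.< f
            win-< {e} {f} lt = ℕ.+-cancelʳ-< base (toℕ e) (toℕ f) (subst₂ _<_ (toℕ-win e) (toℕ-win f) lt)
            -- The value is read off `order`, which speaks of all fillings at once, so it is the
            -- same at x and at y.
            constant : ∀ {W z} → Located W z → before (lookup x l) (lookup x h) z ≡ [ (λ _ → true) , (λ _ → false) ]′ order
            constant {W} {z} at-z = trans (cong₂ (λ s t → before s t z) (same (proj₂ e)) (same (proj₂ f))) (decide order)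
              where
              locate : ∀ p → ∃[ e ] lookup (word at-z) e ≡ p
              locate = injective⇒surjective (lookup (word at-z)) ℕ.≤-refl (word-injective at-z)
              e = locate (w l)
              f = locate (w h)
              same : ∀ {e l} → lookup (word at-z) e ≡ w l → lookup x l ≡ lookup z e
              same {e} {l} eq = trans (lookup-state at-x l) (trans (cong toℕ (sym eq)) (sym (lookup-state at-z e)))
              cell≡ : ∀ {e l} → lookup (word at-z) e ≡ w l → cellOf W (win e) ≡ cellOf U (win l)
              cell≡ {e} {l} eq = trans (cellOf-word at-z e) (trans (cong wc eq) (sym (cellOf-word at-x l)))
              decide : ∀ order → before (lookup z (proj₁ e)) (lookup z (proj₁ f)) z ≡ [ (λ _ → true) , (λ _ → false) ]′ order
              decide (inj₁ lt) = before-true z (state-injective at-z) (win-< (lt W (cell≡ (proj₂ e)) (cell≡ (proj₂ f))))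
              decide (inj₂ gt) = before-false z (state-injective at-z) (win-< (gt W (cell≡ (proj₂ e)) (cell≡ (proj₂ f))))
          cases : RotN.Ends (lookup x a) (lookup x b) (lookup x c) (p , q) → before p q y ≡ before p q x
          cases (RotN.ends₁ s t n) = generic a∈ c∈ b∈ s t n
          cases (RotN.ends₂ s t n) = generic c∈ a∈ b∈ s t n
          cases (RotN.ends₃ s t n) = generic b∈ a∈ c∈ s t n
          cases (RotN.ends₄ s t n) = generic b∈ c∈ a∈ s t n

        tame : Rigid → Tame members
        tame rigid o x∈ y∈ = tame-located rigid o (proj₁ (proj₂ (representative x∈))) (proj₁ (proj₂ (representative y∈)))
          (Fin.toℕ-fromℕ< (bound 0 (s≤s z≤n))) (Fin.toℕ-fromℕ< (bound 1 (s≤s (s≤s z≤n)))) (Fin.toℕ-fromℕ< (bound 2 ℕ.≤-refl))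
          where
          bound : ∀ d → d < 3 → d + toℕ o < Size
          bound d d<3 = ℕ.<-≤-trans (ℕ.+-monoˡ-< (toℕ o) d<3) (ℕ.+-monoʳ-≤ 3 (ℕ.s≤s⁻¹ (Fin.toℕ<n o)))

-- Finiteness of the set of standard fillings

module Enumeration {k n : ℕ} (𝛍 : Fin k → SkewShape) (size≡n : size 𝛍 ≡ n) where

  open Tableaux 𝛍 size≡n

  all-cells? : ∀ {P : Cell 𝛍 → Set} → (∀ x → Dec (P x)) → Dec (∀ x → P x)
  all-cells? P? = map′ (λ all x → All.lookup all (∈-cells 𝛍 x)) (λ p → All.tabulate (λ {x} _ → p x)) (All.all? P? (cells 𝛍))

  any-cell? : ∀ {P : Cell 𝛍 → Set} → (∀ x → Dec (P x)) → Dec (∃[ x ] P x)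
  any-cell? {P} P? = map′ Any.satisfied (λ (x , p) → Any.map (λ { refl → p }) (∈-cells 𝛍 x)) (Any.any? P? (cells 𝛍))

  standard? : ∀ (f : Cell 𝛍 → Fin n) → Dec (IsSYT 𝛍 f)
  standard? f = map′
    (λ ((inj , surj) , rows , cols) → record
      { bijective = (λ {x} {y} → inj x y) , (λ e → let (x , eq) = surj e in x , λ { refl → eq })
      ; row-increasing = rows ; col-increasing = cols })
    (λ s → ((λ x y → proj₁ (IsSYT.bijective s)) , λ e → let (x , eq) = proj₂ (IsSYT.bijective s) e in x , eq refl) ,
           IsSYT.row-increasing s , IsSYT.col-increasing s)
    (((all-cells? λ x → all-cells? λ y → (f x Fin.≟ f y) →-dec (x ≟ᶜ y)) ×-dec
      (Fin.all? λ e → any-cell? λ x → f x Fin.≟ e)) ×-dec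
     (all-cells? λ x → all-cells? λ y → (comp x Fin.≟ comp y) →-dec ((row x ℕ.≟ row y) →-dec ((col x ℕ.<? col y) →-dec (f x Fin.<? f y)))) ×-dec
     (all-cells? λ x → all-cells? λ y → (comp x Fin.≟ comp y) →-dec ((col x ℕ.≟ col y) →-dec ((row x ℕ.<? row y) →-dec (f x Fin.<? f y)))))

  standard-cong : ∀ {f g : Cell 𝛍 → Fin n} → (∀ x → f x ≡ g x) → IsSYT 𝛍 f → IsSYT 𝛍 g
  standard-cong {f} {g} f≗g s = record
    { bijective      = (λ {x} {y} eq → proj₁ (IsSYT.bijective s) (trans (f≗g x) (trans eq (sym (f≗g y))))) ,
                       λ e → let (x , eq) = proj₂ (IsSYT.bijective s) e in x , λ { refl → trans (sym (f≗g x)) (eq refl) }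
    ; row-increasing = λ x y i≡ b≡ a< → subst₂ Fin._<_ (f≗g x) (f≗g y) (IsSYT.row-increasing s x y i≡ b≡ a<)
    ; col-increasing = λ x y i≡ a≡ b< → subst₂ Fin._<_ (f≗g x) (f≗g y) (IsSYT.col-increasing s x y i≡ a≡ b<)
    }

  fillings : ∀ (f : Cell 𝛍 → Fin n) → Dec (IsSYT 𝛍 f) → List (SYT 𝛍 n)
  fillings f (yes s) = syt f s ∷ []
  fillings f (no _)  = []

  wordFilling : Vec (Fin n) N → Cell 𝛍 → Fin n
  wordFilling w x = lookup w (position 𝛍 x)

  tableauxList : List (SYT 𝛍 n)
  tableauxList = concatMap (λ w → fillings (wordFilling w) (standard? (wordFilling w))) (words n N)

  tableaux-complete : ∀ T → Any (T ≈_) tableauxList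
  tableaux-complete T = Any.concatMap⁺ (λ w → fillings (wordFilling w) (standard? (wordFilling w)))
    (lose (∈-words (readingWord T)) (found _ (standard? (wordFilling (readingWord T))) (λ x → sym (lookup-position-word T x))))
    where
    found : ∀ f (s? : Dec (IsSYT 𝛍 f)) → (∀ x → filling T x ≡ f x) → Any (T ≈_) (fillings f s?)
    found f (yes s) T≗f = here T≗f
    found f (no ¬s) T≗f = contradiction (standard-cong T≗f (standard T)) ¬s

abstract

  -- Each `refl` is the computation of all orbits for one size of window; it is sealed so that it is
  -- not repeated where the result is used.
  checked : ∀ r → r ≤ 3 → checkAll r ≡ true
  checked 0 _ = refl
  checked 1 _ = refl
  checked 2 _ = refl
  checked 3 _ = refl
  checked (suc (suc (suc (suc r)))) (s≤s (s≤s (s≤s ())))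

-- The two equivalences for a tuple of skew shapes

module Assembly {k n : ℕ} (𝛍 : Fin k → SkewShape) (size≡n : size 𝛍 ≡ n) where

  open Operators 𝛍 size≡n

  -- The shifted contents of an inner pair span a subinterval of those of the outer pair.
  near-mono : ∀ {x x′ y′ y} → x ≡ x′ ⊎ x ≺ x′ → x′ ≺ y′ → y′ ≡ y ⊎ y′ ≺ y → Near x y → Near x′ y′
  near-mono {x} {x′} {y′} {y} x≼x′ x′≺y′ y′≼y near =
    ℕ.≤-trans (distance-≤ˡ {x′} {y′} {y} x′≤y′ y′≤y)
      (ℕ.≤-trans (distance-≤ʳ {x} {x′} {y} (sc-≤ x x′ x≼x′) (ℤ.≤-trans x′≤y′ y′≤y)) near)
    where
    import Data.Integer.Base as ℤ
    import Data.Integer.Properties as ℤ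
    sc-≤ : ∀ x y → x ≡ y ⊎ x ≺ y → sc x ℤ.≤ sc y
    sc-≤ x y (inj₁ refl) = ℤ.≤-refl
    sc-≤ x y (inj₂ x≺y)  = proj₁ (≺⇒precedes x≺y)
    x′≤y′ = sc-≤ x′ y′ (inj₂ x′≺y′)
    y′≤y = sc-≤ y′ y y′≼y

  -- The content of h exceeds that of l by 1, so going from l to h the column changes by one more
  -- than the row. The two changes cannot have opposite signs, hence one cell is weakly northeast of
  -- the other and its entry is larger in every standard filling.
  rigid : k ≤ 2 → ∀ (U : SYT 𝛍 n) {a b c} → cellOf U a ≺ cellOf U b → cellOf U b ≺ cellOf U c → Near (cellOf U a) (cellOf U c) →
          toℕ c ≤ 2 + toℕ b → toℕ b ≤ 2 + toℕ a →
          (∀ (V : SYT 𝛍 n) {e f} → cellOf V e ≡ cellOf U a → cellOf V f ≡ cellOf U c → e Fin.< f) ⊎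
          (∀ (V : SYT 𝛍 n) {e f} → cellOf V e ≡ cellOf U a → cellOf V f ≡ cellOf U c → f Fin.< e)
  rigid k≤2 U {a} {b} {c} a≺b b≺c near c≤b b≤a = [ (λ a< → inj₁ (right a<)) , (λ a≥ → inj₂ (left a≥)) ]′ (ℕ.<-≤-connex (col l) (col h))
    where
    l h : Cell 𝛍
    l = cellOf U a
    h = cellOf U c
    entry≤ : ∀ {e f} → toℕ e ≤ 2 + toℕ f → toℕ (filling U (cellOf U e)) ≤ 2 + toℕ (filling U (cellOf U f))
    entry≤ {e} {f} = subst₂ (λ e f → toℕ e ≤ 2 + toℕ f) (sym (filling-cellOf U e)) (sym (filling-cellOf U f))
    adjacent = ends-comparable U k≤2 {l} {cellOf U b} {h} a≺b b≺c near (entry≤ c≤b) (entry≤ b≤a)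
    l≢h : l ≢ h
    l≢h = ≺⇒≢ (ℕ.<-trans a≺b b≺c)
    right : col l < col h → ∀ (V : SYT 𝛍 n) {e f} → cellOf V e ≡ l → cellOf V f ≡ h → e Fin.< f
    right a< V {e} {f} e≡ f≡ = subst₂ Fin._<_ (filling-cellOf V e) (filling-cellOf V f)
      (subst₂ (λ x y → filling V x Fin.< filling V y) (sym e≡) (sym f≡)
        (entry-monotone V {l} {h} (proj₁ adjacent) (ℕ.<⇒≤ a<) b≤ l≢h))
      where
      b≤ : row l ≤ row h
      b≤ = ℕ.+-cancelˡ-≤ (col h) (row l) (row h) (subst (_≤ col h + row h) (sym (proj₂ adjacent)) (ℕ.+-monoˡ-≤ (row h) a<))
    left : col h ≤ col l → ∀ (V : SYT 𝛍 n) {e f} → cellOf V e ≡ l → cellOf V f ≡ h → f Fin.< e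
    left a≥ V {e} {f} e≡ f≡ = subst₂ Fin._<_ (filling-cellOf V f) (filling-cellOf V e)
      (subst₂ (λ x y → filling V x Fin.< filling V y) (sym f≡) (sym e≡)
        (entry-monotone V {h} {l} (sym (proj₁ adjacent)) a≥ (ℕ.<⇒≤ b<) (l≢h ∘ sym)))
      where
      b< : row h < row l
      b< = ℕ.+-cancelˡ-< (col h) (row h) (row l) (subst (col h + row h <_) (sym (proj₂ adjacent)) (s≤s (ℕ.+-monoˡ-≤ (row h) a≥)))

  private
    A = SYT-setoid 𝛍 n

    module K = Classes {n} {Cell 𝛍} {_≺_} _≺?_ (λ {x} {y} {z} → ≺-trans {x} {y} {z}) (λ {x} {y} → ≺-asym {x} {y}) ≺-total
      {Near} near? near-mono A Des φ φ-cong φ-involutive cellOf (λ T → cellOf-injective T)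
      (λ {T} {U} → ≈⇒cellOf {T} {U}) (λ {T} {U} → cellOf⇒≈ {T} {U}) lookup-Des φ-triple φ-off

    open DualEquivalence A Des φ using (ClassSum)

  module _ (h i : Interior n) (h≤i : idx h ≤ idx i) (r≤3 : idx i ∸ idx h ≤ 3) (T : SYT 𝛍 n) where

    private
      module W = K.Window h i h≤i T
      π = proj₁ W.sorting
      π∈ = proj₁ (proj₂ W.sorting)
      module V = W.Word π π∈ (proj₂ (proj₂ W.sorting))
      good : LocalSoundness.Good W.r V.reach (inverse π)
      good = check-sound W.r (checked W.r r≤3) V.reach-Far π∈

    schurPositive-class : ClassSum h i h≤i T SchurPositive
    schurPositive-class = V.class-schurPositive (proj₁ good) (proj₂ good)

    isSchur-class : idx h ≡ idx i ⊎ k ≤ 2 → ClassSum h i h≤i T (IsSchur (3 + (idx i ∸ idx h)))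
    isSchur-class c = V.class-isSchur (proj₁ good) (proj₂ good)
      (Sum.map (λ eq → trans (cong (idx i ∸_) eq) (ℕ.n∸n≡0 (idx i))) (λ k≤2 → V.tame (proj₁ good) (proj₂ good) (λ U → rigid k≤2 U)) c)

  isWeak : IsWeakDualEquivalence A Des φ
  isWeak = record
    { finite        = Enumeration.tableauxList 𝛍 size≡n , Enumeration.tableaux-complete 𝛍 size≡n
    ; Desc-cong     = λ {T} {U} → Des-cong {T} {U}
    ; φ-cong        = φ-cong
    ; φ-involutive  = φ-involutive
    ; schurPositive = schurPositive-class
    ; schurSingle   = λ h i h≤i h≡i T → isSchur-class h i h≤i
        (subst (_≤ 3) (sym (trans (cong (idx i ∸_) h≡i) (ℕ.n∸n≡0 (idx i)))) z≤n) T (inj₁ h≡i)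
    ; φ-commute     = φ-commute
    }

  isDual : k ≤ 2 → IsDualEquivalence A Des φ
  isDual k≤2 = record
    { isWeakDualEquivalence = isWeak
    ; singleSchur           = λ h i h≤i r≤3 T → isSchur-class h i h≤i r≤3 T (inj₂ k≤2)
    }

theorem5p3 : ∀ (k n : ℕ) → 1 ≤ k → (𝛍 : Fin k → SkewShape) → size 𝛍 ≡ n →
    Σ[ std ∈ (∀ (i : Interior n) (T : SYT 𝛍 n) → IsSYT 𝛍 (D i T)) ]
    (IsWeakDualEquivalence (SYT-setoid 𝛍 n) Des (λ i T → syt (D i T) (std i T)) ×
    (k ≤ 2 → IsDualEquivalence (SYT-setoid 𝛍 n) Des (λ i T → syt (D i T) (std i T))))
theorem5p3 k n 1≤k 𝛍 size≡n = D-standard , isWeak , isDual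
  where
  open Operators 𝛍 size≡n using (D-standard)
  open Assembly 𝛍 size≡n using (isWeak; isDual)
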